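{- Let $\Delta\ge 3$ be a fixed integer. For every graph $G_n$ on $n$ vertices with maximum degree $\Delta(G_n)\le \Delta$ and independence number $\alpha(G_n)\le \frac{n}{4}$, \[ R(P_n,G_n)=(\chi(G_n)-1)n+\sigma(G_n)+o(n)\qquad (n\to\infty), \] that is, for every $\delta>0$ there is $n_0=n_0(\Delta,\delta)$ such that for all $n\ge n_0$ and all such $G_n$ we have $\bigl|R(P_n,G_n)-\bigl((\chi(G_n)-1)n+\sigma(G_n)\bigr)\bigr|\le \delta n$.
   Context: $P_n$ denotes the path on $n$ vertices. For graphs $F,G$, the Ramsey number $R(F,G)$ is the smallest $N$ such that every red-blue edge-coloring of the complete graph $K_N$ contains a red copy of $F$ or a blue copy of $G$. $\chi(G)$ is the chromatic number of $G$, $\alpha(G)$ its independence number, and $\sigma(G)$ is the minimum size of a color class taken over all proper vertex-colorings of $G$ with exactly $\chi(G)$ colors. -}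

module Defs where

open import Data.Nat using (ℕ; zero; suc; _+_; _*_; _≤_; _<_; _≡ᵇ_)
open import Data.Bool using (Bool; true; false; _∨_)
open import Data.Fin using (Fin; toℕ)
open import Data.Fin.Subset using (Subset; _∈_; ∣_∣)
open import Data.List using (List; length; filterᵇ; allFin)
open import Data.Product using (Σ; ∃; _×_; _,_)
open import Data.Sum using (_⊎_)
open import Relation.Nullary using (¬_)
open import Relation.Binary.PropositionalEquality using (_≡_; _≢_)
open import Function.Definitions using (Injective)

Graph : ℕ → Set
Graph n = Fin n → Fin n → Bool

IsSimple : ∀ {n} → Graph n → Set
IsSimple {n} G = (∀ (i j : Fin n) → G i j ≡ G j i) × (∀ (i : Fin n) → G i i ≡ false)

path : (n : ℕ) → Graph n
path n i j = (suc (toℕ i) ≡ᵇ toℕ j) ∨ (suc (toℕ j) ≡ᵇ toℕ i)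

degree : ∀ {n} → Graph n → Fin n → ℕ
degree {n} G v = length (filterᵇ (G v) (allFin n))

MaxDegreeAtMost : ∀ {n} → Graph n → ℕ → Set
MaxDegreeAtMost {n} G Δ = ∀ (v : Fin n) → degree G v ≤ Δ

IsIndependent : ∀ {n} → Graph n → Subset n → Set
IsIndependent {n} G S = ∀ (i j : Fin n) → i ∈ S → j ∈ S → G i j ≡ false

IndependenceAtMostQuarter : ∀ {n} → Graph n → Set
IndependenceAtMostQuarter {n} G = ∀ (S : Subset n) → IsIndependent G S → 4 * ∣ S ∣ ≤ n

IsProperColouring : ∀ {n k} → Graph n → (Fin n → Fin k) → Set
IsProperColouring {n} G c = ∀ (i j : Fin n) → G i j ≡ true → c i ≢ c j

Colourable : ∀ {n} → Graph n → ℕ → Set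
Colourable {n} G k = Σ (Fin n → Fin k) (λ c → IsProperColouring G c)

IsChromaticNumber : ∀ {n} → Graph n → ℕ → Set
IsChromaticNumber G k = Colourable G k × (∀ m → m < k → ¬ Colourable G m)

classSize : ∀ {n k} → (Fin n → Fin k) → Fin k → ℕ
classSize {n} {k} c i = length (filterᵇ (λ v → toℕ (c v) ≡ᵇ toℕ i) (allFin n))

-- σ(G) = s, where χ = χ(G): minimum colour-class size over proper χ-colourings.
IsSigma : ∀ {n} → Graph n → (χ : ℕ) → ℕ → Set
IsSigma {n} G χ s =
  (Σ (Fin n → Fin χ) λ c → IsProperColouring G c × Σ (Fin χ) λ i → classSize c i ≡ s)
  × (∀ (c : Fin n → Fin χ) → IsProperColouring G c → ∀ (i : Fin χ) → s ≤ classSize c i)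

data Colour : Set where
  red blue : Colour

EdgeColouring : ℕ → Set
EdgeColouring N = Fin N → Fin N → Colour

IsSymmetricColouring : ∀ {N} → EdgeColouring N → Set
IsSymmetricColouring {N} c = ∀ (x y : Fin N) → c x y ≡ c y x

HasCopy : ∀ {m N} → Colour → Graph m → EdgeColouring N → Set
HasCopy {m} {N} col F c =
  Σ (Fin m → Fin N) λ f → Injective _≡_ _≡_ f ×
    (∀ (i j : Fin m) → F i j ≡ true → c (f i) (f j) ≡ col)

Arrows : ℕ → ∀ {m k} → Graph m → Graph k → Set
Arrows N F G = ∀ (c : EdgeColouring N) → IsSymmetricColouring c →
  HasCopy red F c ⊎ HasCopy blue G c

IsRamseyNumber : ∀ {m k} → Graph m → Graph k → ℕ → Set
IsRamseyNumber F G N = Arrows N F G × (∀ M → M < N → ¬ Arrows M F G)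

{-# OPTIONS --safe #-}

-- Lower bound: red cliques, χ − 1 of them on n − 1 vertices and one on σ − 1, with blue between them.
--
-- Upper bound: only red-free pairs of sets matter, so regularity is replaced by a cruder partition of
-- K_N into clusters of equal size in which almost every pair is either red-free or has no large hole
-- (a pair of large subsets without red edges).  Refining along the holes of the remaining bad pairs
-- increases the number of vertex pairs in red-free pairs of clusters, so this stops after boundedly
-- many rounds.  In the graph Γ of hole-free pairs, a connected matching (in the bipartite double cover,
-- so that every cluster is used in two halves) covering n vertices yields a red path on n vertices:
-- depth-first search nearly exhausts each matched pair, and reserved vertices link the pieces.
-- If there is no such matching, the deficiency version of Hall's theorem finds, for every size
-- m ≤ n / 2, a set of m vertices (in whole clusters) whose closed Γ-neighbourhood has at most n vertices.
-- Removing χ − 1 such neighbourhoods one after the other leaves room for the smallest colour class,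
-- and the χ sets found, of the sizes of the colour classes of G, are joined by red-free or bad pairs
-- only.  As each vertex meets few bad pairs, G with its bounded degree embeds greedily in blue.
module Submission where

open import Defs
open import Data.Nat
open import Data.Nat.Properties
open import Data.Nat.DivMod hiding (result)
open import Data.Nat.Tactic.RingSolver using (solve-∀)
open import Data.Bool using (Bool; true; false; _∧_; _∨_; not; if_then_else_)
import Data.Bool.Properties as Bool
open import Data.Fin as Fin using (Fin; zero; suc; toℕ; fromℕ<)
import Data.Fin.Properties as Fin
open import Data.Fin.Subset using (Subset; ∣_∣; _∈_)
open import Data.Fin.Subset.Properties using (anySubset?)
open import Data.Vec using ([]; _∷_; lookup; tabulate)
open import Data.Vec.Properties using (lookup∘tabulate; []=⇒lookup)
open import Data.List using (List; []; _∷_; length; filterᵇ; _++_)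
import Data.List as List
open import Data.Product using (∃; _×_; _,_; proj₁; proj₂)
open import Data.Sum using (_⊎_; inj₁; inj₂)
open import Data.Empty using (⊥; ⊥-elim)
open import Function using (_∘_; id)
open import Function.Definitions using (Injective)
open import Relation.Nullary using (¬_; Dec; yes; no; does)
open import Relation.Nullary.Decidable using (map′; dec-true; dec-false; _×-dec_; _→-dec_)
open import Relation.Binary.PropositionalEquality
open import Relation.Binary.Definitions using (tri<; tri≈; tri>)
open import Data.Unit using (⊤; tt)
open import Data.List.Properties using (length-++; ++-assoc)
import Data.Fin.Permutation.Components as Perm

-- All errors are measured on one scale `Y`, a constant depending only on `Δ` and `q`. Incomplete
-- clusters, and clusters meeting too many bad pairs, contain about `N / Y` vertices each; a vertex
-- of a remaining cluster has at most `D = N / Y` red neighbours in each of the other chosen sets; a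
-- matched pair yields a cluster size of path vertices up to a fraction of about `1 / Y`. Each error
-- is incurred boundedly often in terms of `Δ`, so that the slack `n / suc q` absorbs them all.
-- Hence `suc E = 24 * Y` for the hole size, and `Y * Y` for the bad pairs: the square turns an
-- average into a bound valid outside `N / Y` vertices.
--
-- A pair without large holes says nothing about a single vertex, which may have no red neighbour
-- across. So no individual end of a path can be prolonged; a whole set of `h` possible ends is
-- carried along, and the actual end is chosen only after the next red edge is known.
--
-- Sets of `m` clusters with small closed neighbourhood need `m + m ≤ t`, where `t` clusters hold
-- about `n` vertices. Colour classes are independent, so they have at most `n / 4` vertices; the
-- other half of `n` pays for rounding and for the greedy choice.

infixl 8 _==_

-- Counting elements of finite sets

⟦_⟧ : Bool → ℕ
⟦ true ⟧  = 1
⟦ false ⟧ = 0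

opaque
  ∑ : ∀ {n} → (Fin n → ℕ) → ℕ
  ∑ {zero}  f = 0
  ∑ {suc n} f = f zero + ∑ (f ∘ suc)

opaque
  # : ∀ {n} → (Fin n → Bool) → ℕ
  # p = ∑ (λ x → ⟦ p x ⟧)

  #-∑ : ∀ {n} (p : Fin n → Bool) → # p ≡ ∑ (λ x → ⟦ p x ⟧)
  #-∑ p = refl

opaque
  unfolding ∑ #

  #-nil : (p : Fin 0 → Bool) → # p ≡ 0
  #-nil p = refl

  #-suc : ∀ {n} (p : Fin (suc n) → Bool) → # p ≡ ⟦ p zero ⟧ + # (p ∘ suc)
  #-suc p = refl

_==_ : ∀ {n} → Fin n → Fin n → Bool
i == j = does (i Fin.≟ j)

infix 4 _⊑_
_⊑_ : ∀ {n} → (Fin n → Bool) → (Fin n → Bool) → Set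
p ⊑ q = ∀ x → p x ≡ true → q x ≡ true

==-refl : ∀ {n} (i : Fin n) → (i == i) ≡ true
==-refl i = dec-true (i Fin.≟ i) refl

==⇒≡ : ∀ {n} {i j : Fin n} → (i == j) ≡ true → i ≡ j
==⇒≡ {i = i} {j} e with i Fin.≟ j
... | yes p = p

≢⇒== : ∀ {n} {i j : Fin n} → i ≢ j → (i == j) ≡ false
≢⇒== {i = i} {j} = dec-false (i Fin.≟ j)

true≢false : ∀ {b} → b ≡ true → b ≡ false → ⊥
true≢false refl ()

does⇒ : ∀ {p} {P : Set p} (d : Dec P) → does d ≡ true → P
does⇒ (yes p) _ = p

does⇒¬ : ∀ {p} {P : Set p} (d : Dec P) → does d ≡ false → ¬ P
does⇒¬ (no ¬p) _ = ¬p

∧-true : ∀ {a b} → a ≡ true → b ≡ true → (a ∧ b) ≡ true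
∧-true refl refl = refl

∧-fst : ∀ {a b} → (a ∧ b) ≡ true → a ≡ true
∧-fst {true} e = refl

∧-snd : ∀ {a b} → (a ∧ b) ≡ true → b ≡ true
∧-snd {true} e = e

∨-inj₁ : ∀ {a b} → a ≡ true → (a ∨ b) ≡ true
∨-inj₁ refl = refl

∨-inj₂ : ∀ {a b} → b ≡ true → (a ∨ b) ≡ true
∨-inj₂ {true}  _ = refl
∨-inj₂ {false} e = e

∨-case : ∀ {a b} → (a ∨ b) ≡ true → a ≡ true ⊎ b ≡ true
∨-case {true}  e = inj₁ refl
∨-case {false} e = inj₂ e

not-true : ∀ {a} → not a ≡ true → a ≡ false
not-true {false} _ = refl

false⇒not : ∀ {a} → a ≡ false → not a ≡ true
false⇒not refl = refl

¬true⇒false : ∀ {a} → ¬ (a ≡ true) → a ≡ false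
¬true⇒false {true}  h = ⊥-elim (h refl)
¬true⇒false {false} h = refl

true? : ∀ b → b ≡ true ⊎ b ≡ false
true? true  = inj₁ refl
true? false = inj₂ refl

⟦⟧-mono : ∀ {a b} → (a ≡ true → b ≡ true) → ⟦ a ⟧ ≤ ⟦ b ⟧
⟦⟧-mono {false} h = z≤n
⟦⟧-mono {true}  h rewrite h refl = ≤-refl

⟦⟧-true : ∀ {a} → a ≡ true → ⟦ a ⟧ ≡ 1
⟦⟧-true refl = refl

⟦⟧-false : ∀ {a} → a ≡ false → ⟦ a ⟧ ≡ 0
⟦⟧-false refl = refl

opaque
  unfolding ∑

  ∑-mono : ∀ {n} {f g : Fin n → ℕ} → (∀ x → f x ≤ g x) → ∑ f ≤ ∑ g
  ∑-mono {zero}  h = z≤n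
  ∑-mono {suc n} h = +-mono-≤ (h zero) (∑-mono (h ∘ suc))

  ∑-cong : ∀ {n} {f g : Fin n → ℕ} → (∀ x → f x ≡ g x) → ∑ f ≡ ∑ g
  ∑-cong {zero}  h = refl
  ∑-cong {suc n} h = cong₂ _+_ (h zero) (∑-cong (h ∘ suc))

  ∑-+ : ∀ {n} (f g : Fin n → ℕ) → ∑ (λ x → f x + g x) ≡ ∑ f + ∑ g
  ∑-+ {zero}  f g = refl
  ∑-+ {suc n} f g rewrite ∑-+ (f ∘ suc) (g ∘ suc) = lem (f zero) (g zero) (∑ (f ∘ suc)) (∑ (g ∘ suc))
    where
    lem : ∀ a b c d → a + b + (c + d) ≡ a + c + (b + d)
    lem = solve-∀

  ∑-*ˡ : ∀ {n} c (f : Fin n → ℕ) → ∑ (λ x → c * f x) ≡ c * ∑ f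
  ∑-*ˡ {zero}  c f = sym (*-zeroʳ c)
  ∑-*ˡ {suc n} c f rewrite ∑-*ˡ c (f ∘ suc) = sym (*-distribˡ-+ c (f zero) _)

  ∑-*ʳ : ∀ {n} (f : Fin n → ℕ) c → ∑ (λ x → f x * c) ≡ ∑ f * c
  ∑-*ʳ f c = trans (∑-cong (λ x → *-comm (f x) c)) (trans (∑-*ˡ c f) (*-comm c _))

  ∑-const : ∀ {n} c → ∑ {n} (λ _ → c) ≡ n * c
  ∑-const {zero}  c = refl
  ∑-const {suc n} c = cong (c +_) (∑-const {n} c)

  ∑-zero : ∀ n → ∑ {n} (λ _ → 0) ≡ 0
  ∑-zero n = trans (∑-const {n} 0) (*-zeroʳ n)

  ∑-swap : ∀ {m n} (f : Fin m → Fin n → ℕ) → ∑ (λ i → ∑ (f i)) ≡ ∑ (λ j → ∑ (λ i → f i j))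
  ∑-swap {zero}  {n} f = sym (∑-zero n)
  ∑-swap {suc m} {n} f rewrite ∑-swap (f ∘ suc) = sym (∑-+ (f zero) (λ j → ∑ (λ i → f (suc i) j)))

  ∑-≥ : ∀ {n} (f : Fin n → ℕ) x → f x ≤ ∑ f
  ∑-≥ f zero    = m≤m+n _ _
  ∑-≥ f (suc x) = ≤-trans (∑-≥ (f ∘ suc) x) (m≤n+m _ (f zero))

  ∑-pick : ∀ {n} (i : Fin n) (g : Fin n → ℕ) → ∑ (λ j → ⟦ i == j ⟧ * g j) ≡ g i
  ∑-pick {suc n} zero g = begin
    g zero + 0 + ∑ {n} (λ _ → 0)  ≡⟨ cong (g zero + 0 +_) (∑-zero n) ⟩
    g zero + 0 + 0  ≡⟨ trans (+-identityʳ _) (+-identityʳ _) ⟩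
    g zero  ∎
    where open ≡-Reasoning
  ∑-pick {suc n} (suc i) g = trans (∑-cong step) (∑-pick i (g ∘ suc))
    where
    step : ∀ j → ⟦ suc i == suc j ⟧ * g (suc j) ≡ ⟦ i == j ⟧ * g (suc j)
    step j with i Fin.≟ j
    ... | yes _ = refl
    ... | no  _ = refl

∅ : ∀ {n} → Fin n → Bool
∅ _ = false

cons : ∀ {n} → Bool → (Fin n → Bool) → Fin (suc n) → Bool
cons b p zero    = b
cons b p (suc x) = p x

opaque
  unfolding ∑ #

  #-pos : ∀ {n} (p : Fin n → Bool) → 1 ≤ # p → ∃ λ x → p x ≡ true
  #-pos {suc n} p h with true? (p zero)
  ... | inj₁ e = zero , e
  ... | inj₂ e rewrite e with #-pos (p ∘ suc) h
  ...   | x , e′ = suc x , e′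

opaque
  unfolding #

  ∑-fibre : ∀ {N K} (c : Fin N → Fin K) (g : Fin K → ℕ) →
            ∑ (λ x → g (c x)) ≡ ∑ (λ i → # (λ x → c x == i) * g i)
  ∑-fibre c g = begin
    ∑ (λ x → g (c x))  ≡⟨ ∑-cong (λ x → sym (∑-pick (c x) g)) ⟩
    ∑ (λ x → ∑ (λ i → ⟦ c x == i ⟧ * g i))  ≡⟨ ∑-swap _ ⟩
    ∑ (λ i → ∑ (λ x → ⟦ c x == i ⟧ * g i))  ≡⟨ ∑-cong (λ i → ∑-*ʳ _ (g i)) ⟩
    ∑ (λ i → # (λ x → c x == i) * g i)  ∎
    where open ≡-Reasoning

  #-mono : ∀ {n} {p q : Fin n → Bool} → p ⊑ q → # p ≤ # q
  #-mono h = ∑-mono (λ x → ⟦⟧-mono (h x))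

  #-cong : ∀ {n} {p q : Fin n → Bool} → (∀ x → p x ≡ q x) → # p ≡ # q
  #-cong h = ∑-cong (λ x → cong ⟦_⟧ (h x))

  #-all : ∀ n → # {n} (λ _ → true) ≡ n
  #-all n = trans (∑-const {n} 1) (*-identityʳ n)

  #≤n : ∀ {n} (p : Fin n → Bool) → # p ≤ n
  #≤n {n} p = subst (# p ≤_) (#-all n) (#-mono (λ _ _ → refl))

  #-none : ∀ {n} {p : Fin n → Bool} → (∀ x → p x ≡ false) → # p ≡ 0
  #-none {n} h = trans (#-cong h) (∑-zero n)

  #-∨ : ∀ {n} (p q : Fin n → Bool) → # (λ x → p x ∨ q x) ≤ # p + # q
  #-∨ p q = subst (# (λ x → p x ∨ q x) ≤_) (∑-+ (⟦_⟧ ∘ p) (⟦_⟧ ∘ q)) (∑-mono step)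
    where
    step : ∀ x → ⟦ p x ∨ q x ⟧ ≤ ⟦ p x ⟧ + ⟦ q x ⟧
    step x with p x
    ... | true  = s≤s z≤n
    ... | false = ≤-refl

  #-split : ∀ {n} (p q : Fin n → Bool) → # p ≡ # (λ x → p x ∧ q x) + # (λ x → p x ∧ not (q x))
  #-split p q = trans (∑-cong step) (∑-+ _ _)
    where
    step : ∀ x → ⟦ p x ⟧ ≡ ⟦ p x ∧ q x ⟧ + ⟦ p x ∧ not (q x) ⟧
    step x with p x | q x
    ... | true  | true  = refl
    ... | true  | false = refl
    ... | false | _     = refl

  #-cover : ∀ {n} {p q r : Fin n → Bool} → (∀ x → p x ≡ true → q x ≡ true ⊎ r x ≡ true) → # p ≤ # q + # r
  #-cover {p = p} {q} {r} h = ≤-trans (#-mono lem) (#-∨ q r)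
    where
    lem : p ⊑ (λ x → q x ∨ r x)
    lem x e with h x e
    ... | inj₁ a = ∨-inj₁ a
    ... | inj₂ b = ∨-inj₂ {q x} b

  #-disj : ∀ {n} {p q r : Fin n → Bool} → q ⊑ p → r ⊑ p → (∀ x → q x ≡ true → r x ≡ true → ⊥) → # q + # r ≤ # p
  #-disj {p = p} {q} {r} hq hr d = subst (_≤ # p) (∑-+ (⟦_⟧ ∘ q) (⟦_⟧ ∘ r)) (∑-mono step)
    where
    step : ∀ x → ⟦ q x ⟧ + ⟦ r x ⟧ ≤ ⟦ p x ⟧
    step x with q x | hq x | r x | hr x | d x
    ... | true  | a | true  | b | c = ⊥-elim (c refl refl)
    ... | true  | a | false | b | c rewrite a refl = ≤-refl
    ... | false | a | true  | b | c rewrite b refl = ≤-refl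
    ... | false | a | false | b | c = z≤n

  #-witness : ∀ {n} (p : Fin n → Bool) x → p x ≡ true → 1 ≤ # p
  #-witness p x e = ≤-trans (≤-reflexive (sym (⟦⟧-true e))) (∑-≥ (⟦_⟧ ∘ p) x)

  #-single : ∀ {n} (i : Fin n) → # (λ j → i == j) ≡ 1
  #-single i = trans (∑-cong (λ j → sym (*-identityʳ ⟦ i == j ⟧))) (∑-pick i (λ _ → 1))

  #-⋃ : ∀ {m n} (P : Fin m → Fin n → Bool) (p : Fin n → Bool) →
        (∀ y → p y ≡ true → ∃ λ i → P i y ≡ true) → # p ≤ ∑ (λ i → # (P i))
  #-⋃ P p h = subst (# p ≤_) (sym (∑-swap (λ i y → ⟦ P i y ⟧))) (∑-mono step)
    where
    step : ∀ y → ⟦ p y ⟧ ≤ ∑ (λ i → ⟦ P i y ⟧)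
    step y with p y | h y
    ... | false | _ = z≤n
    ... | true  | f with f refl
    ...   | i , e = ≤-trans (≤-reflexive (sym (⟦⟧-true e))) (∑-≥ (λ i → ⟦ P i y ⟧) i)

  -- Counts the pairs `(x , f x)`: each `x` in `p` is in exactly one of them, each `y` in at most
  -- one.
  #-inj : ∀ {m n} (f : Fin m → Fin n) (p : Fin m → Bool) (q : Fin n → Bool) →
          (∀ x → p x ≡ true → q (f x) ≡ true) →
          (∀ x y → p x ≡ true → p y ≡ true → f x ≡ f y → x ≡ y) → # p ≤ # q
  #-inj f p q h inj = begin
    # p  ≡⟨ ∑-cong (λ x → sym (pt x)) ⟩
    ∑ (λ x → ∑ (λ y → ⟦ p x ∧ (f x == y) ⟧))  ≡⟨ ∑-swap (λ x y → ⟦ p x ∧ (f x == y) ⟧) ⟩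
    ∑ (λ y → ∑ (λ x → ⟦ p x ∧ (f x == y) ⟧))  ≤⟨ ∑-mono bound ⟩
    # q  ∎
    where
    open ≤-Reasoning
    pt : ∀ x → # (λ y → p x ∧ (f x == y)) ≡ ⟦ p x ⟧
    pt x with p x
    ... | true  = #-single (f x)
    ... | false = #-none {p = λ _ → false} (λ _ → refl)
    bound : ∀ y → # (λ x → p x ∧ (f x == y)) ≤ ⟦ q y ⟧
    bound y with 1 ≤? # (λ x → p x ∧ (f x == y))
    ... | no ¬le = ≤-trans (s≤s⁻¹ (≰⇒> ¬le)) z≤n
    ... | yes le with #-pos _ le
    ...   | x₀ , e = ≤-trans (#-mono sub) (≤-reflexive (trans (#-single x₀) (sym (⟦⟧-true qy))))
      where
      fx₀ : f x₀ ≡ y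
      fx₀ = ==⇒≡ (∧-snd {p x₀} e)
      qy : q y ≡ true
      qy = subst (λ z → q z ≡ true) fx₀ (h x₀ (∧-fst e))
      sub : (λ x → p x ∧ (f x == y)) ⊑ (λ x → x₀ == x)
      sub x e′ rewrite inj x₀ x (∧-fst e) (∧-fst e′) (trans fx₀ (sym (==⇒≡ (∧-snd {p x} e′)))) = ==-refl x

opaque
  unfolding ∑ #

  #-take : ∀ {n} (p : Fin n → Bool) k → k ≤ # p → ∃ λ q → q ⊑ p × # q ≡ k
  #-take {zero}  p zero h = ∅ , (λ ()) , refl
  #-take {suc n} p zero h = ∅ , (λ _ ()) , #-none {p = ∅ {suc n}} (λ _ → refl)
  #-take {suc n} p (suc k) h with true? (p zero)
  ... | inj₁ e with #-take (p ∘ suc) k (s≤s⁻¹ (subst (λ b → suc k ≤ ⟦ b ⟧ + # (p ∘ suc)) e h))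
  ...   | q , sub , eq = cons true q , (λ { zero _ → e ; (suc x) → sub x }) , cong suc eq
  #-take {suc n} p (suc k) h | inj₂ e with #-take (p ∘ suc) (suc k) (subst (λ b → suc k ≤ ⟦ b ⟧ + # (p ∘ suc)) e h)
  ...   | q , sub , eq = cons false q , (λ { zero () ; (suc x) → sub x }) , eq

  filterᵇ-# : ∀ {n} {A : Set} (p : A → Bool) (f : Fin n → A) →
              length (filterᵇ p (List.tabulate f)) ≡ # (p ∘ f)
  filterᵇ-# {zero}  p f = refl
  filterᵇ-# {suc n} p f with p (f zero)
  ... | true  = cong suc (filterᵇ-# p (f ∘ suc))
  ... | false = filterᵇ-# p (f ∘ suc)

  ∣∣-# : ∀ {n} (S : Subset n) → ∣ S ∣ ≡ # (lookup S)
  ∣∣-# []          = refl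
  ∣∣-# (true ∷ S)  = cong suc (∣∣-# S)
  ∣∣-# (false ∷ S) = ∣∣-# S

-- Exhaustive search over subsets, used wherever a classical argument asks whether some set is
-- tight, deficient, closed or a hole. `resp` is required because a Boolean predicate is recovered
-- from its vector only pointwise.
any-set? : ∀ {n} {P : (Fin n → Bool) → Set} → (∀ {p q} → (∀ x → p x ≡ q x) → P p → P q) →
           (∀ p → Dec (P p)) → Dec (∃ P)
any-set? resp P? = map′ (λ { (S , h) → lookup S , h })
                        (λ { (p , h) → tabulate p , resp (λ x → sym (lookup∘tabulate p x)) h })
                        (anySubset? (λ S → P? (lookup S)))

-- Greedy choices

_<ᶠ_ : ∀ {n} → Fin n → Fin n → Bool
i <ᶠ j = does (toℕ i <? toℕ j)

<ᶠ⇒ : ∀ {n} {i j : Fin n} → (i <ᶠ j) ≡ true → toℕ i < toℕ j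
<ᶠ⇒ {i = i} {j} = does⇒ (toℕ i <? toℕ j)

⇒<ᶠ : ∀ {n} {i j : Fin n} → toℕ i < toℕ j → (i <ᶠ j) ≡ true
⇒<ᶠ {i = i} {j} = dec-true (toℕ i <? toℕ j)

any : ∀ {n} → (Fin n → Bool) → Bool
any p = does (Fin.any? (λ x → p x Bool.≟ true))

any-intro : ∀ {n} (p : Fin n → Bool) x → p x ≡ true → any p ≡ true
any-intro p x e = dec-true (Fin.any? (λ x → p x Bool.≟ true)) (x , e)

any-elim : ∀ {n} (p : Fin n → Bool) → any p ≡ true → ∃ λ x → p x ≡ true
any-elim p = does⇒ (Fin.any? (λ x → p x Bool.≟ true))

any-false : ∀ {n} (p : Fin n → Bool) → any p ≡ false → ∀ x → p x ≡ false
any-false p e x = ¬true⇒false (λ px → does⇒¬ (Fin.any? (λ x → p x Bool.≟ true)) e (x , px))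

#-avoid : ∀ {m n} (p : Fin n → Bool) (P : Fin m → Fin n → Bool) →
          ∑ (λ i → # (λ y → p y ∧ P i y)) < # p → ∃ λ y → p y ≡ true × ∀ i → P i y ≡ false
#-avoid p P lt with #-pos q (+-cancelˡ-≤ (∑ (λ i → # (λ y → p y ∧ P i y))) 1 (# q) (begin
    s + 1  ≡⟨ +-comm s 1 ⟩
    suc s  ≤⟨ lt ⟩
    # p  ≡⟨ #-split p (λ y → any (λ i → P i y)) ⟩
    # (λ y → p y ∧ any (λ i → P i y)) + # q
           ≤⟨ +-monoˡ-≤ (# q) (#-⋃ (λ i y → p y ∧ P i y) _ split) ⟩
    s + # q ∎))
  where
  open ≤-Reasoning
  s = ∑ (λ i → # (λ y → p y ∧ P i y))
  q : Fin _ → Bool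
  q y = p y ∧ not (any (λ i → P i y))
  split : ∀ y → (p y ∧ any (λ i → P i y)) ≡ true → ∃ λ i → (p y ∧ P i y) ≡ true
  split y e with any-elim (λ i → P i y) (∧-snd {p y} e)
  ... | i , e′ = i , ∧-true (∧-fst e) e′
... | y , e = y , ∧-fst e , any-false (λ i → P i y) (not-true (∧-snd {p y} e))

-- `ok` is admissibility of a single choice, `conf` a clash with an earlier one. The clashes to be
-- counted in `few` may rely on the earlier choices being admissible. Serves both for colouring with
-- `suc Δ` colours and for the blue embedding.
module Greedy {n M : ℕ} (y₀ : Fin M) (ok : Fin n → Fin M → Bool)
              (conf : Fin n → Fin M → Fin n → Fin M → Bool)
              (few : ∀ g (f : Fin n → Fin M) → (∀ g′ → toℕ g′ < toℕ g → ok g′ (f g′) ≡ true) →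
                     ∑ (λ g′ → # (λ y → ok g y ∧ (g′ <ᶠ g) ∧ conf g′ (f g′) g y)) < # (ok g))
  where

  Good : ℕ → (Fin n → Fin M) → Set
  Good i f = (∀ g → toℕ g < i → ok g (f g) ≡ true) ×
             (∀ g′ g → toℕ g′ < toℕ g → toℕ g < i → conf g′ (f g′) g (f g) ≡ false)

  upto : ∀ i → i ≤ n → ∃ (Good i)
  upto zero    _ = (λ _ → y₀) , (λ _ ()) , (λ _ _ _ ())
  upto (suc i) i<n with upto i (<⇒≤ i<n)
  ... | f , okf , cf = f′ , okf′ , cf′
    where
    g : Fin n
    g = fromℕ< i<n
    tg : toℕ g ≡ i
    tg = Fin.toℕ-fromℕ< i<n
    ch = #-avoid (ok g) (λ g′ y → (g′ <ᶠ g) ∧ conf g′ (f g′) g y)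
                 (few g f (λ g′ lt → okf g′ (subst (toℕ g′ <_) tg lt)))
    y = proj₁ ch
    f′ : Fin n → Fin M
    f′ x = if x == g then y else f x
    old : ∀ {x} → toℕ x < i → f′ x ≡ f x
    old {x} lt rewrite ≢⇒== {i = x} {g} (λ { refl → <-irrefl tg lt }) = refl
    new : f′ g ≡ y
    new rewrite ==-refl g = refl
    last : ∀ {x} → toℕ x < suc i → toℕ x < i ⊎ x ≡ g
    last {x} lt with m≤n⇒m<n∨m≡n (s≤s⁻¹ lt)
    ... | inj₁ l = inj₁ l
    ... | inj₂ e = inj₂ (Fin.toℕ-injective (trans e (sym tg)))
    okf′ : ∀ x → toℕ x < suc i → ok x (f′ x) ≡ true
    okf′ x lt with last lt
    ... | inj₁ l    = trans (cong (ok x) (old l)) (okf x l)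
    ... | inj₂ refl = trans (cong (ok g) new) (proj₁ (proj₂ ch))
    cf′ : ∀ x′ x → toℕ x′ < toℕ x → toℕ x < suc i → conf x′ (f′ x′) x (f′ x) ≡ false
    cf′ x′ x l′ lt with last lt
    ... | inj₁ l rewrite old l | old (<-trans l′ l) = cf x′ x l′ l
    ... | inj₂ refl rewrite new | old (subst (toℕ x′ <_) tg l′) =
      trans (cong (_∧ conf x′ (f x′) g y) (sym (⇒<ᶠ l′))) (proj₂ (proj₂ ch) x′)

  greedy : ∃ λ f → (∀ g → ok g (f g) ≡ true) ×
                   (∀ g′ g → toℕ g′ < toℕ g → conf g′ (f g′) g (f g) ≡ false)
  greedy with upto n ≤-refl
  ... | f , a , b = f , (λ g → a g (Fin.toℕ<n g)) , (λ g′ g l → b g′ g l (Fin.toℕ<n g))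

degree-# : ∀ {n} (G : Graph n) v → degree G v ≡ # (G v)
degree-# G v = filterᵇ-# (G v) id

-- Gives `χ ∸ 1 ≤ Δ`, so that errors made once per colour remain bounded.
greedily-colourable : ∀ {n} (G : Graph n) Δ → IsSimple G → MaxDegreeAtMost G Δ → Colourable G (suc Δ)
greedily-colourable {n} G Δ (sy , ir) deg = f , proper
  where
  few : ∀ g (f : Fin n → Fin (suc Δ)) → (∀ g′ → toℕ g′ < toℕ g → true ≡ true) →
        ∑ (λ g′ → # (λ y → true ∧ (g′ <ᶠ g) ∧ G g′ g ∧ (f g′ == y))) < # {suc Δ} (λ _ → true)
  few g f _ = begin-strict
    ∑ (λ g′ → # (λ y → true ∧ (g′ <ᶠ g) ∧ G g′ g ∧ (f g′ == y)))  ≤⟨ ∑-mono bound ⟩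
    ∑ (λ g′ → ⟦ G g g′ ⟧)  ≡⟨ sym (#-∑ (G g)) ⟩
    # (G g)  ≡⟨ sym (degree-# G g) ⟩
    degree G g  ≤⟨ deg g ⟩
    Δ  <⟨ ≤-refl ⟩
    suc Δ  ≡⟨ sym (#-all (suc Δ)) ⟩
    # {suc Δ} (λ _ → true)  ∎
    where
    open ≤-Reasoning
    bound : ∀ g′ → # (λ y → (g′ <ᶠ g) ∧ G g′ g ∧ (f g′ == y)) ≤ ⟦ G g g′ ⟧
    bound g′ with true? (G g g′)
    ... | inj₁ e = ≤-trans (#-mono (λ y h → ∧-snd {G g′ g} (∧-snd {g′ <ᶠ g} h)))
                           (≤-reflexive (trans (#-single (f g′)) (sym (⟦⟧-true e))))
    ... | inj₂ e = ≤-trans (≤-reflexive (#-none (λ y → ¬true⇒false (λ h →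
                     true≢false (∧-fst (∧-snd {g′ <ᶠ g} h)) (trans (sy g′ g) e))))) z≤n
  open Greedy {n} {suc Δ} zero (λ _ _ → true) (λ g′ y′ g y → G g′ g ∧ (y′ == y)) few
  f = proj₁ greedy
  ne : ∀ i j → toℕ i < toℕ j → G i j ≡ true → f i ≢ f j
  ne i j l e eq = true≢false (∧-true e (subst (λ z → (f i == z) ≡ true) eq (==-refl (f i))))
                             (proj₂ (proj₂ greedy) i j l)
  proper : IsProperColouring G f
  proper i j e eq with <-cmp (toℕ i) (toℕ j)
  ... | tri< l _ _ = ne i j l e eq
  ... | tri> _ _ l = ne j i l (trans (sy j i) e) (sym eq)
  ... | tri≈ _ t _ with Fin.toℕ-injective t
  ...   | refl = true≢false e (ir i)

-- The lower bound

≡ᵇ-true : ∀ {a b} → a ≡ b → (a ≡ᵇ b) ≡ true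
≡ᵇ-true {zero}  refl = refl
≡ᵇ-true {suc a} refl = ≡ᵇ-true {a} refl

true-≡ᵇ : ∀ {a b} → (a ≡ᵇ b) ≡ true → a ≡ b
true-≡ᵇ {zero}  {zero}  _ = refl
true-≡ᵇ {suc a} {suc b} e = cong suc (true-≡ᵇ e)

classSize-# : ∀ {n k} (c : Fin n → Fin k) i → classSize c i ≡ # (λ v → c v == i)
classSize-# c i = trans (filterᵇ-# (λ v → toℕ (c v) ≡ᵇ toℕ i) id) (#-cong agree)
  where
  agree : ∀ v → (toℕ (c v) ≡ᵇ toℕ i) ≡ (c v == i)
  agree v with c v Fin.≟ i
  ... | yes e = ≡ᵇ-true (cong toℕ e)
  ... | no ne = ¬true⇒false (λ e → ne (Fin.toℕ-injective (true-≡ᵇ e)))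

-- The extremal colouring: `w` is one less than the order of the path, the red cliques are runs of
-- `w` consecutive vertices, and the last run may be incomplete.
module Blocks (r w : ℕ) .{{_ : NonZero w}} where

  block : Fin r → ℕ
  block x = toℕ x / w

  colouring : EdgeColouring r
  colouring x y with block x ≟ block y
  ... | yes _ = red
  ... | no  _ = blue

  colouring-sym : IsSymmetricColouring colouring
  colouring-sym x y with block x ≟ block y | block y ≟ block x
  ... | yes _ | yes _ = refl
  ... | no  _ | no  _ = refl
  ... | yes e | no ne = ⊥-elim (ne (sym e))
  ... | no ne | yes e = ⊥-elim (ne (sym e))

  red⇒ : ∀ {x y} → colouring x y ≡ red → block x ≡ block y
  red⇒ {x} {y} e with block x ≟ block y
  ... | yes p = p

  blue⇒ : ∀ {x y} → colouring x y ≡ blue → block x ≢ block y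
  blue⇒ {x} {y} e with block x ≟ block y
  ... | no p = p

  -- A red path never leaves its block, but two of its `suc w` vertices agree modulo `w`.
  no-red-path : ¬ HasCopy red (path (suc w)) colouring
  no-red-path (f , inj , edge) with Fin.pigeonhole (n<1+n w) (λ v → fromℕ< (m%n<n (toℕ (f v)) w))
  ... | i , j , i<j , e = Fin.<⇒≢ i<j (inj (Fin.toℕ-injective (begin
    toℕ (f i)  ≡⟨ m≡m%n+[m/n]*n (toℕ (f i)) w ⟩
    toℕ (f i) % w + toℕ (f i) / w * w  ≡⟨ cong₂ (λ a b → a + b * w) rem (trans (same i) (sym (same j))) ⟩
    toℕ (f j) % w + toℕ (f j) / w * w  ≡⟨ sym (m≡m%n+[m/n]*n (toℕ (f j)) w) ⟩
    toℕ (f j)  ∎)))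
    where
    open ≡-Reasoning
    rem : toℕ (f i) % w ≡ toℕ (f j) % w
    rem = trans (sym (Fin.toℕ-fromℕ< _)) (trans (cong toℕ e) (Fin.toℕ-fromℕ< _))
    same′ : ∀ m v → toℕ v ≡ m → block (f v) ≡ block (f zero)
    same′ zero    v tv = cong (block ∘ f) (Fin.toℕ-injective tv)
    same′ (suc m) v tv = trans (red⇒ (edge v u (∨-inj₂ {suc (toℕ v) ≡ᵇ toℕ u} (≡ᵇ-true (trans (cong suc tu) (sym tv))))))
                               (same′ m u tu)
      where
      m< : m < suc w
      m< = <-trans (n<1+n m) (subst (_< suc w) tv (Fin.toℕ<n v))
      u = fromℕ< m<
      tu : toℕ u ≡ m
      tu = Fin.toℕ-fromℕ< m<
    same : ∀ v → block (f v) ≡ block (f zero)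
    same v = same′ _ v refl

  block-colouring : ∀ {n} {G : Graph n} → HasCopy blue G colouring → ∀ k → r ≤ k * w → Colourable G k
  block-colouring (f , inj , edge) k le =
    (λ v → fromℕ< (lt v)) ,
    (λ i j e ceq → blue⇒ (edge i j e) (trans (sym (Fin.toℕ-fromℕ< _)) (trans (cong toℕ ceq) (Fin.toℕ-fromℕ< _))))
    where
    lt : ∀ v → block (f v) < k
    lt v = m<n*o⇒m/o<n (<-≤-trans (Fin.toℕ<n (f v)) le)

-- If `r` were smaller, the blocks would properly colour a blue copy of `G`. For `s = 0` there are
-- at most `χ ∸ 1` blocks, too few colours; otherwise the last block holds fewer than `s` vertices,
-- too few for a colour class.
lower-bound : ∀ {w} (G : Graph (suc w)) r χ s → 1 ≤ w → Arrows r (path (suc w)) G →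
              IsChromaticNumber G χ → IsSigma G χ s → (χ ∸ 1) * w + s ≤ r
lower-bound {w@(suc _)} G r zero s _ arr ((c , _) , _) sig with c zero
... | ()
lower-bound {w@(suc _)} G r (suc k) s w≥1 arr (_ , minimal) ((c₀ , _ , i₀ , cs) , least) with k * w + s ≤? r
... | yes le = le
... | no ¬le with arr (Blocks.colouring r w) (Blocks.colouring-sym r w)
...   | inj₁ p = ⊥-elim (Blocks.no-red-path r w p)
lower-bound {w@(suc _)} G r (suc k) zero w≥1 arr (_ , minimal) sig | no ¬le | inj₂ p =
  ⊥-elim (minimal k ≤-refl (Blocks.block-colouring r w p k (subst (r ≤_) (+-identityʳ (k * w)) (≰⇒≥ ¬le))))
lower-bound {w@(suc _)} G r (suc k) (suc s) w≥1 arr (_ , minimal) ((c₀ , _ , i₀ , cs) , least) | no ¬le | inj₂ p@(f , inj , edge) =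
  ⊥-elim (<⇒≱ (s≤s small) (least (proj₁ col) (proj₂ col) last))
  where
  open Blocks r w
  r≤ : r ≤ k * w + s
  r≤ = s≤s⁻¹ (subst (r <_) (+-suc (k * w) s) (≰⇒> ¬le))
  s≤w : s ≤ w
  s≤w = s≤s⁻¹ (subst (_≤ suc w) (trans (sym (classSize-# c₀ i₀)) cs) (#≤n (λ v → c₀ v == i₀)))
  col : Colourable G (suc k)
  col = block-colouring p (suc k) (≤-trans r≤ (≤-trans (+-monoʳ-≤ (k * w) s≤w) (≤-reflexive (+-comm (k * w) w))))
  last : Fin (suc k)
  last = Fin.fromℕ k
  inLast : ∀ v → (proj₁ col v == last) ≡ true → k * w ≤ toℕ (f v)
  inLast v e = subst (λ z → z * w ≤ toℕ (f v)) bl (m/n*n≤m (toℕ (f v)) w)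
    where
    bl : block (f v) ≡ k
    bl = trans (sym (Fin.toℕ-fromℕ< _)) (trans (cong toℕ (==⇒≡ {i = proj₁ col v} {last} e)) (Fin.toℕ-fromℕ k))
  -- Truncated subtraction makes this hold for every vertex, so `tgt` is total. In the last block
  -- the offset is even strictly below `s`, hence the detour through `Fin (suc s)` without its top
  -- element.
  off : ∀ v → toℕ (f v) ∸ k * w ≤ s
  off v = ≤-trans (∸-monoˡ-≤ (k * w) (≤-trans (<⇒≤ (Fin.toℕ<n (f v))) r≤)) (≤-reflexive (m+n∸m≡n (k * w) s))
  tgt : ∀ v → Fin (suc s)
  tgt v = fromℕ< (s≤s (off v))
  below : Fin (suc s) → Bool
  below y = y <ᶠ Fin.fromℕ s
  below≤ : ∀ m → # {suc m} (λ y → y <ᶠ Fin.fromℕ m) ≤ m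
  below≤ m = s≤s⁻¹ (begin
    suc (# b)  ≡⟨ +-comm 1 (# b) ⟩
    # b + 1  ≡⟨ cong (# b +_) (sym (#-single (Fin.fromℕ m))) ⟩
    # b + # (λ y → Fin.fromℕ m == y)  ≤⟨ #-disj {p = λ _ → true} (λ _ _ → refl) (λ _ _ → refl) dis ⟩
    # {suc m} (λ _ → true)  ≡⟨ #-all (suc m) ⟩
    suc m ∎)
    where
    open ≤-Reasoning
    b : Fin (suc m) → Bool
    b y = y <ᶠ Fin.fromℕ m
    dis : ∀ y → b y ≡ true → (Fin.fromℕ m == y) ≡ true → ⊥
    dis y e e′ with ==⇒≡ {i = Fin.fromℕ m} {y} e′
    ... | refl = <-irrefl refl (<ᶠ⇒ {i = y} {y} e)
  small : classSize (proj₁ col) last ≤ s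
  small = ≤-trans (≤-reflexive (classSize-# (proj₁ col) last)) (≤-trans
    (#-inj tgt (λ v → proj₁ col v == last) below
      (λ v e → ⇒<ᶠ (subst₂ _<_ (sym (Fin.toℕ-fromℕ< (s≤s (off v)))) (sym (Fin.toℕ-fromℕ s))
                 (subst (toℕ (f v) ∸ k * w <_) (m+n∸m≡n (k * w) s)
                   (∸-monoˡ-< (<-≤-trans (Fin.toℕ<n (f v)) r≤) (inLast v e)))))
      (λ x y ex ey eq → inj (Fin.toℕ-injective (trans (sym (m+[n∸m]≡n (inLast x ex))) (trans (cong (k * w +_)
         (trans (sym (Fin.toℕ-fromℕ< (s≤s (off x)))) (trans (cong toℕ eq) (Fin.toℕ-fromℕ< (s≤s (off y)))))) (m+[n∸m]≡n (inLast y ey))))))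
      ) (below≤ s))

-- Hall's theorem

_∖_ : ∀ {n} → (Fin n → Bool) → (Fin n → Bool) → Fin n → Bool
(p ∖ q) x = p x ∧ not (q x)

∖-in : ∀ {n} (p q : Fin n → Bool) {x} → p x ≡ true → q x ≡ false → (p ∖ q) x ≡ true
∖-in p q e e′ = ∧-true e (false⇒not e′)

∖-fst : ∀ {n} (p q : Fin n → Bool) {x} → (p ∖ q) x ≡ true → p x ≡ true
∖-fst p q = ∧-fst

∖-snd : ∀ {n} (p q : Fin n → Bool) {x} → (p ∖ q) x ≡ true → q x ≡ false
∖-snd p q {x} e = not-true (∧-snd {p x} e)

⊑-trans : ∀ {n} {p q r : Fin n → Bool} → p ⊑ q → q ⊑ r → p ⊑ r
⊑-trans h h′ x e = h′ x (h x e)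

sing : ∀ {n} → Fin n → Fin n → Bool
sing i j = i == j

#-remove : ∀ {n} (p : Fin n → Bool) i → p i ≡ true → # p ≡ suc (# (p ∖ sing i))
#-remove p i e = trans (#-split p (sing i)) (cong (_+ # (p ∖ sing i)) (trans (#-cong same) (#-single i)))
  where
  same : ∀ x → (p x ∧ sing i x) ≡ sing i x
  same x with i Fin.≟ x
  ... | yes refl = trans (Bool.∧-identityʳ (p x)) e
  ... | no _     = Bool.∧-zeroʳ (p x)

-- Halmos and Vaughan: split along a tight set if there is one, otherwise match any edge.
module Hall {a b : ℕ} (E : Fin a → Fin b → Bool) (r₀ : Fin b) where

  nbr : (Fin b → Bool) → (Fin a → Bool) → Fin b → Bool
  nbr R S r = R r ∧ any (λ l → S l ∧ E l r)

  nbr-in : ∀ R S {l r} → R r ≡ true → S l ≡ true → E l r ≡ true → nbr R S r ≡ true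
  nbr-in R S {l} {r} x y z = ∧-true x (any-intro (λ l → S l ∧ E l r) l (∧-true y z))

  nbr-out : ∀ R S {r} → nbr R S r ≡ true → ∃ λ l → R r ≡ true × S l ≡ true × E l r ≡ true
  nbr-out R S {r} e with any-elim (λ l → S l ∧ E l r) (∧-snd {R r} e)
  ... | l , e′ = l , ∧-fst e , ∧-fst e′ , ∧-snd {S l} e′

  Cond : (Fin a → Bool) → (Fin b → Bool) → Set
  Cond L R = ∀ S → S ⊑ L → # S ≤ # (nbr R S)

  record Matching (L : Fin a → Bool) (R : Fin b → Bool) : Set where
    field
      π     : Fin a → Fin b
      into  : ∀ l → L l ≡ true → R (π l) ≡ true
      edge  : ∀ l → L l ≡ true → E l (π l) ≡ true
      inj   : ∀ l l′ → L l ≡ true → L l′ ≡ true → π l ≡ π l′ → l ≡ l′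

  Tight : (Fin a → Bool) → (Fin b → Bool) → (Fin a → Bool) → Set
  Tight L R S = S ⊑ L × 1 ≤ # S × # S < # L × # (nbr R S) ≤ # S

  ⊑? : ∀ (S L : Fin a → Bool) → Dec (S ⊑ L)
  ⊑? S L = Fin.all? (λ x → (S x Bool.≟ true) →-dec (L x Bool.≟ true))

  nbr-cong : ∀ R {S S′} → (∀ x → S x ≡ S′ x) → # (nbr R S) ≡ # (nbr R S′)
  nbr-cong R {S} {S′} h = ≤-antisym (#-mono (go S S′ h)) (#-mono (go S′ S (sym ∘ h)))
    where
    go : ∀ S S′ → (∀ x → S x ≡ S′ x) → nbr R S ⊑ nbr R S′
    go S S′ h r e with nbr-out R S e
    ... | l , x , y , z = nbr-in R S′ x (trans (sym (h l)) y) z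

  tight? : ∀ L R → Dec (∃ (Tight L R))
  tight? L R = any-set? respects (λ S → ⊑? S L ×-dec (1 ≤? # S) ×-dec (# S <? # L) ×-dec (# (nbr R S) ≤? # S))
    where
    respects : ∀ {p q} → (∀ x → p x ≡ q x) → Tight L R p → Tight L R q
    respects {p} {q} h (x , y , z , w) =
      (λ v e → x v (trans (h v) e)) , subst (1 ≤_) eq y , subst (_< # L) eq z ,
      subst₂ _≤_ (nbr-cong R h) eq w
      where
      eq : # p ≡ # q
      eq = #-cong h

  hall : ∀ fuel L R → # L ≤ fuel → Cond L R → Matching L R
  hall fuel L R le cond with 1 ≤? # L
  hall fuel L R le cond | no none = record
    { π = λ _ → r₀ ; into = λ l e → ⊥-elim (abs l e) ; edge = λ l e → ⊥-elim (abs l e) ; inj = λ l _ e → ⊥-elim (abs l e) }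
    where
    abs : ∀ l → L l ≡ true → ⊥
    abs l e = none (#-witness L l e)
  hall zero L R le cond | yes some = ⊥-elim (<⇒≱ some le)
  hall (suc fuel) L R le cond | yes some with tight? L R
  ... | yes (S , S⊑L , ne , lt , tight) = record { π = π ; into = into ; edge = edge ; inj = inj }
    where
    m₁ = hall fuel S R (s≤s⁻¹ (≤-trans lt le)) (λ S′ h → cond S′ (⊑-trans h S⊑L))
    R′ = R ∖ nbr R S
    L′ = L ∖ S
    split : # L ≡ # S + # L′
    split = trans (#-split L S) (cong (_+ # L′) (#-cong same))
      where
      same : ∀ x → (L x ∧ S x) ≡ S x
      same x with true? (S x)
      ... | inj₁ e rewrite e | S⊑L x e = refl
      ... | inj₂ e rewrite e = Bool.∧-zeroʳ (L x)
    cond′ : Cond L′ R′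
    -- Hall's condition for the union of `S` and `S′`; as `S` is tight, its neighbours account for
    -- no more than `# S`.
    cond′ S′ h = +-cancelˡ-≤ (# S) _ _ (begin
      # S + # S′  ≤⟨ #-disj {p = λ x → S x ∨ S′ x} (λ _ → ∨-inj₁) (λ x → ∨-inj₂ {S x})
                                          (λ x e e′ → true≢false e (∖-snd L S (h x e′))) ⟩
      # (λ x → S x ∨ S′ x)  ≤⟨ cond _ un ⟩
      # (nbr R (λ x → S x ∨ S′ x))  ≤⟨ #-cover cov ⟩
      # (nbr R S) + # (nbr R′ S′)  ≤⟨ +-monoˡ-≤ _ tight ⟩
      # S + # (nbr R′ S′)  ∎)
      where
      open ≤-Reasoning
      un : (λ x → S x ∨ S′ x) ⊑ L
      un x e with ∨-case {S x} e
      ... | inj₁ s = S⊑L x s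
      ... | inj₂ s = ∖-fst L S (h x s)
      cov : ∀ r → nbr R (λ x → S x ∨ S′ x) r ≡ true → nbr R S r ≡ true ⊎ nbr R′ S′ r ≡ true
      cov r e with nbr-out R _ e | true? (nbr R S r)
      ... | l , x , y , z | inj₁ e′ = inj₁ e′
      ... | l , x , y , z | inj₂ e′ with ∨-case {S l} y
      ...   | inj₁ s = inj₁ (nbr-in R S x s z)
      ...   | inj₂ s = inj₂ (nbr-in R′ S′ (∖-in R (nbr R S) x e′) s z)
    m₂ = hall fuel L′ R′ (s≤s⁻¹ (≤-trans (≤-trans (+-monoˡ-≤ (# L′) ne) (≤-reflexive (sym split))) le)) cond′
    π = λ x → if S x then Matching.π m₁ x else Matching.π m₂ x
    into : ∀ l → L l ≡ true → R (π l) ≡ true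
    into l e with true? (S l)
    ... | inj₁ s rewrite s = Matching.into m₁ l s
    ... | inj₂ s rewrite s = ∖-fst R (nbr R S) (Matching.into m₂ l (∖-in L S e s))
    edge : ∀ l → L l ≡ true → E l (π l) ≡ true
    edge l e with true? (S l)
    ... | inj₁ s rewrite s = Matching.edge m₁ l s
    ... | inj₂ s rewrite s = Matching.edge m₂ l (∖-in L S e s)
    cross : ∀ l l′ → S l ≡ true → L l′ ≡ true → S l′ ≡ false → Matching.π m₁ l ≡ Matching.π m₂ l′ → ⊥
    cross l l′ s e s′ eq = true≢false
      (nbr-in R S (Matching.into m₁ l s) s (Matching.edge m₁ l s))
      (subst (λ z → nbr R S z ≡ false) (sym eq) (∖-snd R (nbr R S) (Matching.into m₂ l′ (∖-in L S e s′))))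
    inj : ∀ l l′ → L l ≡ true → L l′ ≡ true → π l ≡ π l′ → l ≡ l′
    inj l l′ e e′ eq with true? (S l) | true? (S l′)
    ... | inj₁ s | inj₁ s′ rewrite s | s′ = Matching.inj m₁ l l′ s s′ eq
    ... | inj₁ s | inj₂ s′ rewrite s | s′ = ⊥-elim (cross l l′ s e′ s′ eq)
    ... | inj₂ s | inj₁ s′ rewrite s | s′ = ⊥-elim (cross l′ l s′ e s (sym eq))
    ... | inj₂ s | inj₂ s′ rewrite s | s′ = Matching.inj m₂ l l′ (∖-in L S e s) (∖-in L S e′ s′) eq
  ... | no ¬tight with #-pos L some
  ...   | l₀ , L₀ with #-pos (nbr R (sing l₀)) (subst (_≤ # (nbr R (sing l₀))) (#-single l₀) (cond (sing l₀) sub))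
    where
    sub : sing l₀ ⊑ L
    sub x e with ==⇒≡ {i = l₀} {x} e
    ... | refl = L₀
  ...     | r , nr with nbr-out R (sing l₀) nr
  ...       | l₁ , Rr , l₁≡ , E₁ = record { π = π ; into = into ; edge = edge ; inj = inj }
    where
    L′ = L ∖ sing l₀
    R′ = R ∖ sing r
    E₀ : E l₀ r ≡ true
    E₀ = subst (λ z → E z r ≡ true) (sym (==⇒≡ {i = l₀} {l₁} l₁≡)) E₁
    #L : # L ≡ suc (# L′)
    #L = #-remove L l₀ L₀
    cond′ : Cond L′ R′
    cond′ S h with 1 ≤? # S
    ... | no z = ≤-trans (s≤s⁻¹ (≰⇒> z)) z≤n
    ... | yes ne = s≤s⁻¹ (begin
      -- Without tight sets there is a neighbour to spare, so `r` can be given away.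
      suc (# S)  ≤⟨ ≰⇒> (λ t → ¬tight (S , (λ x e → ∖-fst L (sing l₀) (h x e)) , ne ,
                                          ≤-trans (s≤s (#-mono h)) (≤-reflexive (sym #L)) , t)) ⟩
      # (nbr R S)  ≤⟨ #-cover cov ⟩
      # (sing r) + # (nbr R′ S)  ≡⟨ cong (_+ # (nbr R′ S)) (#-single r) ⟩
      suc (# (nbr R′ S))  ∎)
      where
      open ≤-Reasoning
      cov : ∀ x → nbr R S x ≡ true → sing r x ≡ true ⊎ nbr R′ S x ≡ true
      cov x e with true? (sing r x) | nbr-out R S e
      ... | inj₁ q | _ = inj₁ q
      ... | inj₂ q | l , u , v , w = inj₂ (nbr-in R′ S (∖-in R (sing r) u q) v w)
    m = hall fuel L′ R′ (s≤s⁻¹ (subst (_≤ suc fuel) #L le)) cond′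
    π = λ x → if sing l₀ x then r else Matching.π m x
    into : ∀ l → L l ≡ true → R (π l) ≡ true
    into l e with true? (sing l₀ l)
    ... | inj₁ s rewrite s = Rr
    ... | inj₂ s rewrite s = ∖-fst R (sing r) (Matching.into m l (∖-in L (sing l₀) e s))
    edge : ∀ l → L l ≡ true → E l (π l) ≡ true
    edge l e with true? (sing l₀ l)
    ... | inj₁ s rewrite s = subst (λ z → E z r ≡ true) (==⇒≡ {i = l₀} {l} s) E₀
    ... | inj₂ s rewrite s = Matching.edge m l (∖-in L (sing l₀) e s)
    cross : ∀ l → L l ≡ true → sing l₀ l ≡ false → r ≡ Matching.π m l → ⊥
    cross l e s eq = true≢false (==-refl r) (subst (λ z → sing r z ≡ false) (sym eq)
                       (∖-snd R (sing r) (Matching.into m l (∖-in L (sing l₀) e s))))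
    inj : ∀ l l′ → L l ≡ true → L l′ ≡ true → π l ≡ π l′ → l ≡ l′
    inj l l′ e e′ eq with true? (sing l₀ l) | true? (sing l₀ l′)
    ... | inj₁ s | inj₁ s′ = trans (sym (==⇒≡ {i = l₀} {l} s)) (==⇒≡ {i = l₀} {l′} s′)
    ... | inj₁ s | inj₂ s′ rewrite s | s′ = ⊥-elim (cross l′ e′ s′ eq)
    ... | inj₂ s | inj₁ s′ rewrite s | s′ = ⊥-elim (cross l e s (sym eq))
    ... | inj₂ s | inj₂ s′ rewrite s | s′ = Matching.inj m l l′ (∖-in L (sing l₀) e s) (∖-in L (sing l₀) e′ s′) eq

#-++ : ∀ K {d} (p : Fin (K + d) → Bool) → # p ≡ # (λ i → p (i Fin.↑ˡ d)) + # (λ j → p (K Fin.↑ʳ j))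
#-++ zero    p = cong (_+ # p) (sym (#-nil _))
#-++ (suc K) {d} p = begin
  # p  ≡⟨ #-suc p ⟩
  ⟦ p zero ⟧ + # (p ∘ suc)  ≡⟨ cong (⟦ p zero ⟧ +_) (#-++ K (p ∘ suc)) ⟩
  ⟦ p zero ⟧ + (# pl + # pr)  ≡⟨ sym (+-assoc ⟦ p zero ⟧ (# pl) (# pr)) ⟩
  ⟦ p zero ⟧ + # pl + # pr  ≡⟨ cong (_+ # pr) (sym (#-suc (λ i → p (i Fin.↑ˡ d)))) ⟩
  # (λ i → p (i Fin.↑ˡ d)) + # pr  ∎
  where
  open ≡-Reasoning
  pl = λ i → p (suc (i Fin.↑ˡ d))
  pr = λ j → p (suc (K Fin.↑ʳ j))

-- Reduced to Hall's theorem by adding to the right-hand side dummies that are joined to everything.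
module Deficiency {K : ℕ} (E : Fin K → Fin K → Bool) (C : Fin K → Bool) where

  N : (Fin K → Bool) → Fin K → Bool
  N S r = C r ∧ any (λ l → S l ∧ E l r)

  record PartialMatching (t : ℕ) : Set where
    field
      dom   : Fin K → Bool
      size  : t ≤ # dom
      dom⊑  : dom ⊑ C
      π     : Fin K → Fin K
      into  : ∀ l → dom l ≡ true → C (π l) ≡ true
      edge  : ∀ l → dom l ≡ true → E l (π l) ≡ true
      inj   : ∀ l l′ → dom l ≡ true → dom l′ ≡ true → π l ≡ π l′ → l ≡ l′

  -- Violation of Ore's defect condition: `S` exceeds its neighbourhood by more than `# C - t`.
  Deficient : ℕ → (Fin K → Bool) → Set
  Deficient t S = S ⊑ C × # (N S) + # C < # S + t

  deficient? : ∀ t → Dec (∃ (Deficient t))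
  deficient? t = any-set? respects (λ S → Fin.all? (λ x → (S x Bool.≟ true) →-dec (C x Bool.≟ true))
                                       ×-dec (# (N S) + # C <? # S + t))
    where
    go : ∀ {p q} → (∀ x → p x ≡ q x) → N p ⊑ N q
    go {p} {q} h r e with any-elim (λ l → p l ∧ E l r) (∧-snd {C r} e)
    ... | l , e′ = ∧-true (∧-fst e) (any-intro (λ l → q l ∧ E l r) l (∧-true (trans (sym (h l)) (∧-fst e′)) (∧-snd {p l} e′)))
    respects : ∀ {p q} → (∀ x → p x ≡ q x) → Deficient t p → Deficient t q
    respects h (x , y) = (λ v e → x v (trans (h v) e)) ,
      subst₂ _<_ (cong (_+ # C) (≤-antisym (#-mono (go h)) (#-mono (go (sym ∘ h))))) (cong (_+ t) (#-cong h)) y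

  deficiency : ∀ t → PartialMatching t ⊎ ∃ (Deficient t)
  deficiency t with deficient? t
  deficiency t       | yes d = inj₂ d
  -- Separate because `C` may be empty here; for positive `t` it contains the default value `c₀`,
  -- used where the partner is a dummy.
  deficiency zero    | no _ = inj₁ record { dom = ∅ ; size = z≤n ; dom⊑ = λ _ () ; π = id ; into = λ _ () ; edge = λ _ () ; inj = λ _ _ () }
  deficiency t@(suc _) | no nd = inj₁ record
    { dom = dom ; size = size ; dom⊑ = λ l → ∧-fst ; π = π ; into = into ; edge = edge ; inj = inj }
    where
    cond₀ : ∀ S → S ⊑ C → # S + t ≤ # (N S) + # C
    cond₀ S h = ≮⇒≥ (λ lt → nd (S , h , lt))
    -- That the empty set is not deficient says exactly this.
    t≤C : t ≤ # C
    t≤C = ≤-trans (m≤n+m t (# {K} ∅)) (≤-trans (cond₀ ∅ (λ _ ()))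
           (≤-reflexive (cong (_+ # C) (#-none (λ r → ¬true⇒false (λ e → absurd {r} (any-elim (λ l → ∅ {K} l ∧ E l r) (∧-snd {C r} e))))))))
      where
      absurd : ∀ {r} → (∃ λ l → (∅ {K} l ∧ E l r) ≡ true) → ⊥
      absurd (_ , ())
    d = # C ∸ t
    dt : t + d ≡ # C
    dt = m+[n∸m]≡n t≤C
    lift : ∀ {A : Set} → (Fin K → A) → A → Fin (K + d) → A
    lift g a y with Fin.splitAt K y
    ... | inj₁ i = g i
    ... | inj₂ _ = a
    liftˡ : ∀ {A : Set} (g : Fin K → A) a i → lift g a (i Fin.↑ˡ d) ≡ g i
    liftˡ g a i rewrite Fin.splitAt-↑ˡ K i d = refl
    liftʳ : ∀ {A : Set} (g : Fin K → A) a j → lift g a (K Fin.↑ʳ j) ≡ a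
    liftʳ g a j rewrite Fin.splitAt-↑ʳ K d j = refl
    E′ : Fin K → Fin (K + d) → Bool
    E′ l = lift (E l) true
    R : Fin (K + d) → Bool
    R = lift C true
    c₀ = proj₁ (#-pos C (≤-trans (s≤s z≤n) t≤C))
    open Hall E′ (c₀ Fin.↑ˡ d) hiding (module Matching)
    cond : Cond C R
    cond S h with 1 ≤? # S
    ... | no z = ≤-trans (s≤s⁻¹ (≰⇒> z)) z≤n
    ... | yes ne = +-cancelʳ-≤ t _ _ (begin
      # S + t  ≤⟨ cond₀ S h ⟩
      # (N S) + # C  ≡⟨ cong (# (N S) +_) (sym dt) ⟩
      # (N S) + (t + d)  ≡⟨ lem (# (N S)) t d ⟩
      # (N S) + d + t  ≤⟨ +-monoˡ-≤ t (+-mono-≤ (#-mono left) (≤-trans (≤-reflexive (sym (#-all d))) (#-mono right))) ⟩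
      # (λ i → nbr R S (i Fin.↑ˡ d)) + # (λ j → nbr R S (K Fin.↑ʳ j)) + t ≡⟨ cong (_+ t) (sym (#-++ K (nbr R S))) ⟩
      # (nbr R S) + t  ∎)
      where
      open ≤-Reasoning
      lem : ∀ a b c → a + (b + c) ≡ a + c + b
      lem = solve-∀
      s₀ = #-pos S ne
      left : N S ⊑ (λ i → nbr R S (i Fin.↑ˡ d))
      left i e with any-elim (λ l → S l ∧ E l i) (∧-snd {C i} e)
      ... | l , e′ = nbr-in R S (trans (liftˡ C true i) (∧-fst e)) (∧-fst e′) (trans (liftˡ (E l) true i) (∧-snd {S l} e′))
      right : (λ _ → true) ⊑ (λ j → nbr R S (K Fin.↑ʳ j))
      right j _ = nbr-in R S {proj₁ s₀} (liftʳ C true j) (proj₂ s₀) (liftʳ (E (proj₁ s₀)) true j)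
    module M = Hall.Matching (hall (# C) C R ≤-refl cond)
    π : Fin K → Fin K
    π l = lift id c₀ (M.π l)
    real : Fin K → Bool
    real l = lift (λ _ → true) false (M.π l)
    dom : Fin K → Bool
    dom l = C l ∧ real l
    π-real : ∀ l → real l ≡ true → M.π l ≡ π l Fin.↑ˡ d
    π-real l e with Fin.splitAt K (M.π l) in eq
    ... | inj₁ i = sym (Fin.splitAt⁻¹-↑ˡ eq)
    into : ∀ l → dom l ≡ true → C (π l) ≡ true
    into l e = trans (sym (liftˡ C true (π l))) (subst (λ z → R z ≡ true) (π-real l (∧-snd {C l} e)) (M.into l (∧-fst e)))
    edge : ∀ l → dom l ≡ true → E l (π l) ≡ true
    edge l e = trans (sym (liftˡ (E l) true (π l))) (subst (λ z → E′ l z ≡ true) (π-real l (∧-snd {C l} e)) (M.edge l (∧-fst e)))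
    inj : ∀ l l′ → dom l ≡ true → dom l′ ≡ true → π l ≡ π l′ → l ≡ l′
    inj l l′ e e′ eq = M.inj l l′ (∧-fst e) (∧-fst e′)
      (trans (π-real l (∧-snd {C l} e)) (trans (cong (Fin._↑ˡ d) eq) (sym (π-real l′ (∧-snd {C l′} e′)))))
    dummy : Fin (K + d) → Bool
    dummy = lift (λ _ → false) true
    #dummy : # dummy ≤ d
    #dummy = ≤-trans (≤-reflexive (trans (#-++ K dummy) (cong (_+ # (λ j → dummy (K Fin.↑ʳ j)))
               (#-none (liftˡ (λ _ → false) true))))) (#≤n _)
    isDummy : ∀ l → (C l ∧ not (real l)) ≡ true → dummy (M.π l) ≡ true
    isDummy l e with Fin.splitAt K (M.π l) | ∧-snd {C l} e
    ... | inj₁ _ | ()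
    ... | inj₂ _ | _ = refl
    size : t ≤ # dom
    size = +-cancelʳ-≤ d _ _ (begin
      t + d  ≡⟨ dt ⟩
      # C  ≡⟨ #-split C real ⟩
      # dom + # (λ l → C l ∧ not (real l))
                     ≤⟨ +-monoʳ-≤ (# dom) (#-inj M.π _ dummy isDummy (λ l l′ e e′ → M.inj l l′ (∧-fst e) (∧-fst e′))) ⟩
      # dom + # dummy ≤⟨ +-monoʳ-≤ (# dom) #dummy ⟩
      # dom + d  ∎)
      where open ≤-Reasoning

-- Connected matchings and separated sets of clusters

-- A connected matching is one whose pairs all lie in a connected set of clusters.  Without one
-- of size t, every large set of clusters contains m clusters with at most t closed neighbours.
module Separation {K : ℕ} (Γ : Fin K → Fin K → Bool) (Γ-sym : ∀ i j → Γ i j ≡ true → Γ j i ≡ true) where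

  -- Connectedness by cuts rather than by walks, since what is used later is an edge leaving the
  -- clusters reached so far.
  Connected : (Fin K → Bool) → Set
  Connected C = ∀ S → S ⊑ C → ∀ x y → S x ≡ true → C y ≡ true → S y ≡ false →
                ∃ λ i → ∃ λ j → S i ≡ true × C j ≡ true × S j ≡ false × Γ i j ≡ true

  ConnectedMatching : ℕ → (Fin K → Bool) → Set
  ConnectedMatching t S = ∃ λ C → C ⊑ S × Connected C × Deficiency.PartialMatching Γ C t

  cl : (Fin K → Bool) → (Fin K → Bool) → Fin K → Bool
  cl S T r = S r ∧ (T r ∨ any (λ l → T l ∧ Γ l r))

  cl-out : ∀ S T {r} → cl S T r ≡ true → S r ≡ true × (T r ≡ true ⊎ ∃ λ l → T l ≡ true × Γ l r ≡ true)
  cl-out S T {r} e with ∨-case {T r} (∧-snd {S r} e)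
  ... | inj₁ h = ∧-fst e , inj₁ h
  ... | inj₂ h with any-elim (λ l → T l ∧ Γ l r) h
  ...   | l , h′ = ∧-fst e , inj₂ (l , ∧-fst h′ , ∧-snd {T l} h′)

  cl-nbr : ∀ S T {l r} → S r ≡ true → T l ≡ true → Γ l r ≡ true → cl S T r ≡ true
  cl-nbr S T {l} {r} a b c = ∧-true a (∨-inj₂ {T r} (any-intro (λ l → T l ∧ Γ l r) l (∧-true b c)))

  cl-self : ∀ S T {r} → S r ≡ true → T r ≡ true → cl S T r ≡ true
  cl-self S T a b = ∧-true a (∨-inj₁ b)

  -- For `C ⊑ S`: a union of components of the graph induced on `S`. Neighbours taken in `C` are
  -- then all the neighbours in `S`.
  Closed : (Fin K → Bool) → (Fin K → Bool) → Set
  Closed S C = ∀ x y → C x ≡ true → S y ≡ true → Γ x y ≡ true → C y ≡ true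

  module _ (t : ℕ) (S : Fin K → Bool) (m : ℕ) (2m≤t : m + m ≤ t) where

    Small : (Fin K → Bool) → Set
    Small T = T ⊑ S × # T ≡ m × # (cl S T) ≤ t

    Splits : (Fin K → Bool) → (Fin K → Bool) → Set
    Splits C D = D ⊑ C × 1 ≤ # D × # D < # C × Closed C D

    splits? : ∀ C → Dec (∃ (Splits C))
    splits? C = any-set? respects (λ D →
      Fin.all? (λ x → (D x Bool.≟ true) →-dec (C x Bool.≟ true)) ×-dec (1 ≤? # D) ×-dec (# D <? # C) ×-dec
      Fin.all? (λ x → Fin.all? (λ y → (D x Bool.≟ true) →-dec ((C y Bool.≟ true) →-dec ((Γ x y Bool.≟ true) →-dec (D y Bool.≟ true))))))
      where
      respects : ∀ {p q} → (∀ x → p x ≡ q x) → Splits C p → Splits C q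
      respects {p} {q} h (a , b , c , d) =
        (λ x e → a x (trans (h x) e)) , subst (1 ≤_) eq b , subst (_< # C) eq c ,
        (λ x y e e′ g → trans (sym (h y)) (d x y (trans (h x) e) e′ g))
        where
        eq : # p ≡ # q
        eq = #-cong h

    within : ∀ C → C ⊑ S → Closed S C → m ≤ # C → # C ≤ t → ∃ Small
    within C C⊑S clo m≤ ≤t with #-take C m m≤
    ... | T , T⊑C , #T = T , ⊑-trans T⊑C C⊑S , #T , ≤-trans (#-mono sub) ≤t
      where
      sub : cl S T ⊑ C
      sub r e with cl-out S T e
      ... | _  , inj₁ h = T⊑C r h
      ... | Sr , inj₂ (l , h , g) = clo l r (T⊑C l h) Sr g

    -- Put I = S₀ ∖ N(S₀), A = N(S₀) ∖ S₀ and let D be the rest of C.  Deficiency becomes 2|A| + |D| < t,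
    -- and all neighbours of I lie in A, so D together with part of I contains a set with few neighbours.
    deficient⇒small : ∀ C → C ⊑ S → Closed S C → m ≤ # C → ∃ (Deficiency.Deficient Γ C t) → ∃ Small
    deficient⇒small C C⊑S clo m≤ (S₀ , S₀⊑C , def) = found
      where
      open Deficiency Γ C using (N)
      open ≤-Reasoning
      N₀ = N S₀
      I = S₀ ∖ N₀
      A = N₀ ∖ S₀
      D = (C ∖ I) ∖ A
      N-in : ∀ {l r} → C r ≡ true → S₀ l ≡ true → Γ l r ≡ true → N₀ r ≡ true
      N-in {l} {r} a b c = ∧-true a (any-intro (λ l → S₀ l ∧ Γ l r) l (∧-true b c))
      I⊑C : I ⊑ C
      I⊑C x e = S₀⊑C x (∖-fst S₀ N₀ e)
      A⊑C : A ⊑ C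
      A⊑C x e = ∧-fst (∖-fst N₀ S₀ e)
      D⊑C : D ⊑ C
      D⊑C x e = ∖-fst C I (∖-fst (C ∖ I) A e)
      #C : # C ≡ # I + (# A + # D)
      #C = trans (trans (#-split C I) (cong (_+ # (C ∖ I)) (#-cong same)))
                 (cong (# I +_) (trans (#-split (C ∖ I) A) (cong (_+ # D) (#-cong same′))))
        where
        same : ∀ x → (C x ∧ I x) ≡ I x
        same x with true? (I x)
        ... | inj₁ e rewrite e | I⊑C x e = refl
        ... | inj₂ e rewrite e = Bool.∧-zeroʳ (C x)
        same′ : ∀ x → ((C ∖ I) x ∧ A x) ≡ A x
        same′ x with true? (A x)
        ... | inj₁ e = trans (∧-true (∖-in C I (A⊑C x e) (¬true⇒false (λ i →
                         true≢false (∖-fst S₀ N₀ i) (∖-snd N₀ S₀ e)))) e) (sym e)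
        ... | inj₂ e rewrite e = Bool.∧-zeroʳ ((C ∖ I) x)
      exch : # S₀ + # A ≡ # N₀ + # I
      exch = trans (cong (_+ # A) (#-split S₀ N₀)) (trans (cong (λ z → z + # I + # A) (#-cong (λ x → Bool.∧-comm (S₀ x) (N₀ x))))
               (trans (lem (# (λ x → N₀ x ∧ S₀ x)) (# I) (# A)) (cong (_+ # I) (sym (#-split N₀ S₀)))))
        where
        lem : ∀ a b c → a + b + c ≡ a + c + b
        lem = solve-∀
      2A+D<t : # A + # A + # D < t
      2A+D<t = +-cancelˡ-< (# N₀ + # I) _ _ (begin-strict
        # N₀ + # I + (# A + # A + # D)  ≡⟨ lem₁ (# N₀) (# I) (# A) (# D) ⟩
        # N₀ + (# I + (# A + # D)) + # A  ≡⟨ cong (λ z → # N₀ + z + # A) (sym #C) ⟩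
        # N₀ + # C + # A  <⟨ +-monoˡ-< (# A) def ⟩
        # S₀ + t + # A  ≡⟨ lem₂ (# S₀) t (# A) ⟩
        # S₀ + # A + t  ≡⟨ cong (_+ t) exch ⟩
        # N₀ + # I + t  ∎)
        where
        lem₁ : ∀ n i a d → n + i + (a + a + d) ≡ n + (i + (a + d)) + a
        lem₁ = solve-∀
        lem₂ : ∀ a b c → a + b + c ≡ a + c + b
        lem₂ = solve-∀
      -- Both `m` and `# A` are at most half of `t`.
      m+A≤t : m + # A ≤ t
      m+A≤t with ≤-total m (# A)
      ... | inj₁ le = ≤-trans (+-monoˡ-≤ (# A) le) (≤-trans (m≤m+n (# A + # A) (# D)) (<⇒≤ 2A+D<t))
      ... | inj₂ le = ≤-trans (+-monoʳ-≤ m le) 2m≤t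
      -- A neighbour in `C` of `r ∈ I` lies in `N₀`, because `r ∈ S₀`, and not in `S₀`, because
      -- `r ∉ N₀`. So it lies in `A`, which `D` avoids.
      DI : ∀ l r → D l ≡ true → I r ≡ true → Γ l r ≡ true → ⊥
      DI l r d i g with true? (S₀ l)
      ... | inj₁ s = true≢false (N-in (I⊑C r i) s g) (∖-snd S₀ N₀ i)
      ... | inj₂ s = true≢false (∖-in N₀ S₀ (N-in (D⊑C l d) (∖-fst S₀ N₀ i) (Γ-sym l r g)) s)
                                (∖-snd (C ∖ I) A d)
      nbr-D : ∀ l r → D l ≡ true → S r ≡ true → Γ l r ≡ true → D r ≡ true ⊎ A r ≡ true
      nbr-D l r d s g with true? (A r)
      ... | inj₁ a = inj₂ a
      ... | inj₂ a = inj₁ (∖-in (C ∖ I) A (∖-in C I (clo l r (D⊑C l d) s g) (¬true⇒false (λ i → DI l r d i g))) a)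
      nbr-I : ∀ l r → I l ≡ true → S r ≡ true → Γ l r ≡ true → A r ≡ true
      nbr-I l r i s g = ∖-in N₀ S₀ (N-in (clo l r (I⊑C l i) s g) Sl g)
        (¬true⇒false (λ sr → true≢false (N-in (I⊑C l i) sr (Γ-sym l r g)) (∖-snd S₀ N₀ i)))
        where
        Sl = ∖-fst S₀ N₀ i
      found : ∃ Small
      found with m ≤? # D
      ... | yes m≤D with #-take D m m≤D
      ...   | T , T⊑D , #T = T , ⊑-trans T⊑D (⊑-trans D⊑C C⊑S) , #T , ≤-trans (#-cover cov)
                (≤-trans (≤-reflexive (+-comm (# D) (# A))) (≤-trans (+-monoˡ-≤ (# D) (m≤m+n (# A) (# A))) (<⇒≤ 2A+D<t)))
        where
        cov : ∀ r → cl S T r ≡ true → D r ≡ true ⊎ A r ≡ true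
        cov r e with cl-out S T e
        ... | s , inj₁ h = inj₁ (T⊑D r h)
        ... | s , inj₂ (l , h , g) = nbr-D l r (T⊑D l h) s g
      found | no m≰D with m ∸ # D ≤? # I
      ... | yes k≤I with #-take I (m ∸ # D) k≤I
      ...   | I′ , I′⊑I , #I′ = T , T⊑S , #T , ≤-trans (#-cover cov) (≤-trans (≤-reflexive (cong (_+ # A) #T)) m+A≤t)
        where
        T : Fin K → Bool
        T x = D x ∨ I′ x
        T⊑S : T ⊑ S
        T⊑S x e with ∨-case {D x} e
        ... | inj₁ h = C⊑S x (D⊑C x h)
        ... | inj₂ h = C⊑S x (I⊑C x (I′⊑I x h))
        #D+ : # D + # I′ ≡ m
        #D+ = trans (cong (# D +_) #I′) (m+[n∸m]≡n (<⇒≤ (≰⇒> m≰D)))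
        #T : # T ≡ m
        #T = ≤-antisym (≤-trans (#-∨ D I′) (≤-reflexive #D+))
               (≤-trans (≤-reflexive (sym #D+)) (#-disj (λ _ → ∨-inj₁) (λ x → ∨-inj₂ {D x})
                 (λ x d i → true≢false (I′⊑I x i) (∖-snd C I (∖-fst (C ∖ I) A d)))))
        cov : ∀ r → cl S T r ≡ true → T r ≡ true ⊎ A r ≡ true
        cov r e with cl-out S T e
        ... | s , inj₁ h = inj₁ h
        ... | s , inj₂ (l , h , g) with ∨-case {D l} h
        ...   | inj₂ i = inj₂ (nbr-I l r (I′⊑I l i) s g)
        ...   | inj₁ d with nbr-D l r d s g
        ...     | inj₁ d′ = inj₁ (∨-inj₁ d′)
        ...     | inj₂ a  = inj₂ a
      found | no m≰D | no k≰I = within C C⊑S clo m≤ (begin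
        # C  ≡⟨ #C ⟩
        # I + (# A + # D)  ≡⟨ lem (# I) (# A) (# D) ⟩
        # I + # D + # A  ≤⟨ +-monoˡ-≤ (# A) (≤-trans (+-monoˡ-≤ (# D) (<⇒≤ (≰⇒> k≰I))) (≤-reflexive (m∸n+n≡m (<⇒≤ (≰⇒> m≰D))))) ⟩
        m + # A  ≤⟨ m+A≤t ⟩
        t  ∎)
        where
        lem : ∀ a b c → a + (b + c) ≡ a + c + b
        lem = solve-∀

    -- Descends towards a component: while `C` splits into two closed parts, continue with one that
    -- has at least `m` clusters. If neither has, `C` itself has at most `m + m ≤ t` clusters and
    -- any `m` of them will do. An unsplittable `C` is connected, and the deficiency theorem
    -- decides.
    search : ∀ fuel C → # C ≤ fuel → C ⊑ S → Closed S C → m ≤ # C → ConnectedMatching t S ⊎ ∃ Small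
    search fuel C le C⊑S clo m≤ with splits? C
    search fuel C le C⊑S clo m≤ | no ns with Deficiency.deficiency Γ C t
    ... | inj₁ pm = inj₁ (C , C⊑S , conn , pm)
      where
      conn : Connected C
      conn P P⊑C x y Px Cy ¬Py with Fin.any? (λ i → Fin.any? (λ j → (P i Bool.≟ true) ×-dec (C j Bool.≟ true) ×-dec (P j Bool.≟ false) ×-dec (Γ i j Bool.≟ true)))
      ... | yes (i , j , h) = i , j , h
      ... | no none = ⊥-elim (ns (P , P⊑C , #-witness P x Px , proper , closed))
        where
        proper : # P < # C
        proper = ≤-trans (≤-trans (+-monoˡ-≤ (# P) (#-witness (C ∖ P) y (∖-in C P Cy ¬Py))) (≤-reflexive (+-comm (# (C ∖ P)) (# P))))
                   (#-disj P⊑C (λ z → ∖-fst C P) (λ z a b → true≢false a (∖-snd C P b)))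
        closed : Closed C P
        closed i j Pi Cj g with true? (P j)
        ... | inj₁ e = e
        ... | inj₂ e = ⊥-elim (none (i , j , Pi , Cj , e , g))
    ... | inj₂ d = inj₂ (deficient⇒small C C⊑S clo m≤ d)
    search zero C le C⊑S clo m≤ | yes (D , D⊑C , ne , lt , cloD) = ⊥-elim (<⇒≱ (≤-trans (s≤s z≤n) lt) le)
    search (suc fuel) C le C⊑S clo m≤ | yes (D , D⊑C , ne , lt , cloD) with m ≤? # D | m ≤? # (C ∖ D)
    ... | yes h | _ = search fuel D (s≤s⁻¹ (≤-trans lt le)) (⊑-trans D⊑C C⊑S)
                        (λ x y Dx Sy g → cloD x y Dx (clo x y (D⊑C x Dx) Sy g) g) h
    ... | no _ | yes h = search fuel (C ∖ D) (s≤s⁻¹ (≤-trans (≤-trans (+-monoˡ-≤ (# (C ∖ D)) ne)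
                            (#-disj D⊑C (λ z → ∖-fst C D) (λ z a b → true≢false a (∖-snd C D b)))) le))
                          (λ x e → C⊑S x (∖-fst C D e))
                          (λ x y e Sy g → ∖-in C D (clo x y (∖-fst C D e) Sy g)
                            (¬true⇒false (λ Dy → true≢false (cloD y x Dy (∖-fst C D e) (Γ-sym x y g)) (∖-snd C D e)))) h
    ... | no a | no b = inj₂ (within C C⊑S clo m≤ (≤-trans (#-cover cov)
                          (≤-trans (+-mono-≤ (<⇒≤ (≰⇒> a)) (<⇒≤ (≰⇒> b))) 2m≤t)))
      where
      cov : ∀ r → C r ≡ true → D r ≡ true ⊎ (C ∖ D) r ≡ true
      cov r e with true? (D r)
      ... | inj₁ d = inj₁ d
      ... | inj₂ d = inj₂ (∖-in C D e d)

    small-set : m ≤ # S → ConnectedMatching t S ⊎ ∃ Small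
    small-set = search (# S) S ≤-refl (λ _ e → e) (λ _ _ _ e _ → e)

  -- `rest` receives the last colour class. Nothing has to be found after it, so its neighbourhood
  -- is never removed and it costs only its own size `r`; this is where `σ` rather than another `n`
  -- comes from.
  record Separated (k : ℕ) (S : Fin K → Bool) (m : Fin k → ℕ) (r : ℕ) : Set where
    field
      T       : Fin k → Fin K → Bool
      rest    : Fin K → Bool
      T⊑      : ∀ i → T i ⊑ S
      rest⊑   : rest ⊑ S
      T-size  : ∀ i → # (T i) ≡ m i
      rest-≥  : r ≤ # rest
      T-T     : ∀ i j → i ≢ j → ∀ x y → T i x ≡ true → T j y ≡ true → x ≢ y × Γ x y ≡ false
      T-rest  : ∀ i x y → T i x ≡ true → rest y ≡ true → x ≢ y × Γ x y ≡ false

  separate : ∀ t k (m : Fin k → ℕ) → (∀ i → m i + m i ≤ t) → ∀ S r → k * t + r ≤ # S →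
             ConnectedMatching t S ⊎ Separated k S m r
  separate t zero m 2m S r le = inj₂ record
    { T = λ () ; rest = S ; T⊑ = λ () ; rest⊑ = λ _ e → e ; T-size = λ () ; rest-≥ = le
    ; T-T = λ () ; T-rest = λ () }
  separate t (suc k) m 2m S r le
    with small-set t S (m zero) (2m zero) (≤-trans (≤-trans (m≤m+n (m zero) (m zero)) (2m zero)) (≤-trans (m≤m+n t _) (≤-trans (m≤m+n (suc k * t) r) le)))
  ... | inj₁ c = inj₁ c
  ... | inj₂ (T₀ , T₀⊑ , #T₀ , small) with separate t k (m ∘ suc) (2m ∘ suc) (S ∖ cl S T₀) r enough
    where
    enough : k * t + r ≤ # (S ∖ cl S T₀)
    enough = +-cancelˡ-≤ t _ _ (begin
      t + (k * t + r)  ≡⟨ sym (+-assoc t (k * t) r) ⟩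
      t + k * t + r  ≤⟨ le ⟩
      # S  ≡⟨ #-split S (cl S T₀) ⟩
      # (λ x → S x ∧ cl S T₀ x) + # (S ∖ cl S T₀)  ≤⟨ +-monoˡ-≤ _ (≤-trans (#-mono (λ x e → ∧-snd {S x} e)) small) ⟩
      t + # (S ∖ cl S T₀)  ∎)
      where open ≤-Reasoning
  ...   | inj₁ (C , C⊑ , c) = inj₁ (C , (λ x e → ∖-fst S (cl S T₀) (C⊑ x e)) , c)
  ...   | inj₂ sep = inj₂ record
    { T = T ; rest = rest ; T⊑ = T⊑′ ; rest⊑ = λ x e → ∖-fst S (cl S T₀) (rest⊑ x e)
    ; T-size = λ { zero → #T₀ ; (suc i) → T-size i } ; rest-≥ = rest-≥ ; T-T = T-T′ ; T-rest = T-rest′ }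
    where
    open Separated sep renaming (T to T₁)
    T : Fin (suc k) → Fin K → Bool
    T zero    = T₀
    T (suc i) = T₁ i
    T⊑′ : ∀ i → T i ⊑ S
    T⊑′ zero = T₀⊑
    T⊑′ (suc i) x e = ∖-fst S (cl S T₀) (T⊑ i x e)
    apart : ∀ x y → T₀ x ≡ true → (S ∖ cl S T₀) y ≡ true → x ≢ y × Γ x y ≡ false
    apart x y a b = (λ { refl → true≢false (cl-self S T₀ Sy a) ¬cl }) ,
                    ¬true⇒false (λ g → true≢false (cl-nbr S T₀ Sy a g) ¬cl)
      where
      Sy = ∖-fst S (cl S T₀) b
      ¬cl = ∖-snd S (cl S T₀) b
    flip : ∀ x y → x ≢ y × Γ x y ≡ false → y ≢ x × Γ y x ≡ false
    flip x y (a , b) = (a ∘ sym) , ¬true⇒false (λ g → true≢false (Γ-sym y x g) b)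
    T-T′ : ∀ i j → i ≢ j → ∀ x y → T i x ≡ true → T j y ≡ true → x ≢ y × Γ x y ≡ false
    T-T′ zero    zero    ne x y a b = ⊥-elim (ne refl)
    T-T′ zero    (suc j) ne x y a b = apart x y a (T⊑ j y b)
    T-T′ (suc i) zero    ne x y a b = flip y x (apart y x b (T⊑ i x a))
    T-T′ (suc i) (suc j) ne x y a b = T-T i j (ne ∘ cong suc) x y a b
    T-rest′ : ∀ i x y → T i x ≡ true → rest y ≡ true → x ≢ y × Γ x y ≡ false
    T-rest′ zero    x y a b = apart x y a (rest⊑ y b)
    T-rest′ (suc i) x y a b = T-rest i x y a b

-- Paths and depth-first search

module Lists {N : ℕ} where

  mem : List (Fin N) → Fin N → Bool
  mem []      x = false
  mem (y ∷ l) x = (y == x) ∨ mem l x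

  Uniq : List (Fin N) → Set
  Uniq []      = ⊤
  Uniq (x ∷ l) = mem l x ≡ false × Uniq l

  IsPath : (Fin N → Fin N → Bool) → List (Fin N) → Set
  IsPath E []          = ⊤
  IsPath E (x ∷ [])    = ⊤
  IsPath E (x ∷ y ∷ l) = E x y ≡ true × IsPath E (y ∷ l)

  count : (Fin N → Bool) → List (Fin N) → ℕ
  count p []      = 0
  count p (x ∷ l) = ⟦ p x ⟧ + count p l

  mem-head : ∀ x l → mem (x ∷ l) x ≡ true
  mem-head x l = ∨-inj₁ (==-refl x)

  mem-∷ : ∀ {y l x} → mem (y ∷ l) x ≡ true → y ≡ x ⊎ mem l x ≡ true
  mem-∷ {y} {l} {x} e with ∨-case {y == x} e
  ... | inj₁ a = inj₁ (==⇒≡ {i = y} {x} a)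
  ... | inj₂ b = inj₂ b

  mem-++ : ∀ l {l′ x} → mem (l ++ l′) x ≡ true → mem l x ≡ true ⊎ mem l′ x ≡ true
  mem-++ []      e = inj₂ e
  mem-++ (y ∷ l) {l′} {x} e with ∨-case {y == x} e
  ... | inj₁ a = inj₁ (∨-inj₁ a)
  ... | inj₂ b with mem-++ l b
  ...   | inj₁ c = inj₁ (∨-inj₂ {y == x} c)
  ...   | inj₂ c = inj₂ c

  mem-++ˡ : ∀ l {l′ x} → mem l x ≡ true → mem (l ++ l′) x ≡ true
  mem-++ˡ (y ∷ l) {l′} {x} e with ∨-case {y == x} e
  ... | inj₁ a = ∨-inj₁ a
  ... | inj₂ b = ∨-inj₂ {y == x} (mem-++ˡ l b)

  mem-++ʳ : ∀ l {l′ x} → mem l′ x ≡ true → mem (l ++ l′) x ≡ true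
  mem-++ʳ []      e = e
  mem-++ʳ (y ∷ l) {l′} {x} e = ∨-inj₂ {y == x} (mem-++ʳ l e)

  mem-split : ∀ l {x} → mem l x ≡ true → ∃ λ l₁ → ∃ λ l₂ → l ≡ l₁ ++ x ∷ l₂
  mem-split (y ∷ l) e with mem-∷ {y} {l} e
  ... | inj₁ refl = [] , l , refl
  ... | inj₂ b with mem-split l b
  ...   | l₁ , l₂ , refl = y ∷ l₁ , l₂ , refl

  Uniq-++ʳ : ∀ l {l′} → Uniq (l ++ l′) → Uniq l′
  Uniq-++ʳ []      u = u
  Uniq-++ʳ (x ∷ l) (_ , u) = Uniq-++ʳ l u

  Uniq-++ˡ : ∀ l {l′} → Uniq (l ++ l′) → Uniq l
  Uniq-++ˡ []      u = tt
  Uniq-++ˡ (x ∷ l) (a , u) = ¬true⇒false (λ e → true≢false (mem-++ˡ l e) a) , Uniq-++ˡ l u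

  Uniq-++ : ∀ l {l′} → Uniq l → Uniq l′ → (∀ x → mem l x ≡ true → mem l′ x ≡ false) → Uniq (l ++ l′)
  Uniq-++ []      u u′ d = u′
  Uniq-++ (x ∷ l) {l′} (a , u) u′ d =
    ¬true⇒false (λ e → helper (mem-++ l e)) , Uniq-++ l u u′ (λ y e → d y (∨-inj₂ {x == y} e))
    where
    helper : mem l x ≡ true ⊎ mem l′ x ≡ true → ⊥
    helper (inj₁ e) = true≢false e a
    helper (inj₂ e) = true≢false e (d x (mem-head x l))

  IsPath-tail : ∀ E x l → IsPath E (x ∷ l) → IsPath E l
  IsPath-tail E x []      p = tt
  IsPath-tail E x (y ∷ l) (_ , p) = p

  IsPath-++ʳ : ∀ E l {l′} → IsPath E (l ++ l′) → IsPath E l′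
  IsPath-++ʳ E []      p = p
  IsPath-++ʳ E (x ∷ l) p = IsPath-++ʳ E l (IsPath-tail E x (l ++ _) p)

  IsPath-++ˡ : ∀ E l {l′} → IsPath E (l ++ l′) → IsPath E l
  IsPath-++ˡ E []          p = tt
  IsPath-++ˡ E (x ∷ [])    p = tt
  IsPath-++ˡ E (x ∷ y ∷ l) (e , p) = e , IsPath-++ˡ E (y ∷ l) p

  IsPath-mono : ∀ {E E′} → (∀ x y → E x y ≡ true → E′ x y ≡ true) → ∀ l → IsPath E l → IsPath E′ l
  IsPath-mono h []          p = tt
  IsPath-mono h (x ∷ [])    p = tt
  IsPath-mono h (x ∷ y ∷ l) (e , p) = h x y e , IsPath-mono h (y ∷ l) p

  -- Leaves the first path at `f` for the second one and abandons the remainder `l₂`.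
  glue : ∀ E l f l₂ x w → IsPath E (l ++ f ∷ l₂) → E f x ≡ true → IsPath E (x ∷ w) → IsPath E (l ++ f ∷ x ∷ w)
  glue E []          f l₂ x w p e q = e , q
  glue E (y ∷ [])    f l₂ x w (a , p) e q = a , e , q
  glue E (y ∷ z ∷ l) f l₂ x w (a , p) e q = a , glue E (z ∷ l) f l₂ x w p e q

  #-mem : ∀ (p : Fin N → Bool) l → # (λ x → p x ∧ mem l x) ≤ count p l
  #-mem p [] = ≤-reflexive (#-none (λ x → Bool.∧-zeroʳ (p x)))
  #-mem p (y ∷ l) = ≤-trans (#-cover cov) (+-mono-≤ one (#-mem p l))
    where
    cov : ∀ x → (p x ∧ mem (y ∷ l) x) ≡ true → (p y ∧ sing y x) ≡ true ⊎ (p x ∧ mem l x) ≡ true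
    cov x e with mem-∷ {y} {l} (∧-snd {p x} e)
    ... | inj₁ refl = inj₁ (∧-true (∧-fst e) (==-refl y))
    ... | inj₂ b    = inj₂ (∧-true (∧-fst e) b)
    one : # (λ x → p y ∧ sing y x) ≤ ⟦ p y ⟧
    one with p y
    ... | true  = ≤-reflexive (#-single y)
    ... | false = ≤-reflexive (#-none (λ _ → refl))

  mem-# : ∀ (p : Fin N → Bool) l → Uniq l → count p l ≤ # (λ x → p x ∧ mem l x)
  mem-# p [] u = z≤n
  mem-# p (y ∷ l) (a , u) = ≤-trans (+-mono-≤ one (mem-# p l u)) (#-disj sub₁ sub₂ dis)
    where
    one : ⟦ p y ⟧ ≤ # (λ x → p y ∧ sing y x)
    one with p y
    ... | true  = ≤-reflexive (sym (#-single y))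
    ... | false = z≤n
    sub₁ : (λ x → p y ∧ sing y x) ⊑ (λ x → p x ∧ mem (y ∷ l) x)
    sub₁ x e with ==⇒≡ {i = y} {x} (∧-snd {p y} e)
    ... | refl = ∧-true (∧-fst e) (mem-head y l)
    sub₂ : (λ x → p x ∧ mem l x) ⊑ (λ x → p x ∧ mem (y ∷ l) x)
    sub₂ x e = ∧-true (∧-fst e) (∨-inj₂ {y == x} (∧-snd {p x} e))
    dis : ∀ x → (p y ∧ sing y x) ≡ true → (p x ∧ mem l x) ≡ true → ⊥
    dis x e e′ with ==⇒≡ {i = y} {x} (∧-snd {p y} e)
    ... | refl = true≢false (∧-snd {p y} e′) a

  splitAt-length : ∀ k (l : List (Fin N)) → k ≤ length l → ∃ λ l₁ → ∃ λ l₂ → l ≡ l₁ ++ l₂ × length l₁ ≡ k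
  splitAt-length zero    l       le = [] , l , refl , refl
  splitAt-length (suc k) (x ∷ l) (s≤s le) with splitAt-length k l le
  ... | l₁ , l₂ , refl , e = x ∷ l₁ , l₂ , refl , cong suc e

open Lists public

-- A finished vertex has no unexplored neighbour, so all its neighbours are finished or on the stack.
module DFS {N : ℕ} (E : Fin N → Fin N → Bool) (E-sym : ∀ x y → E x y ≡ true → E y x ≡ true)
           (V : Fin N → Bool) where

  record State : Set where
    field
      stack     : List (Fin N)
      done new  : Fin N → Bool
      isPath      : IsPath E stack
      uniq      : Uniq stack
      stack⊑    : mem stack ⊑ V
      done⊑     : done ⊑ V
      new⊑      : new ⊑ V
      cover     : ∀ x → V x ≡ true → done x ≡ true ⊎ new x ≡ true ⊎ mem stack x ≡ true
      done-new  : ∀ x → done x ≡ true → new x ≡ false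
      done-stack : ∀ x → done x ≡ true → mem stack x ≡ false
      new-stack : ∀ x → new x ≡ true → mem stack x ≡ false
      separated : ∀ x y → done x ≡ true → new y ≡ true → E x y ≡ false

  open State

  push : (s : State) → ∀ x → new s x ≡ true → IsPath E (x ∷ stack s) → State
  push s x nx p = record
    { stack = x ∷ stack s ; done = done s ; new = new s ∖ sing x ; isPath = p
    ; uniq = new-stack s x nx , uniq s
    ; stack⊑ = st ; done⊑ = done⊑ s ; new⊑ = λ y e → new⊑ s y (∖-fst (new s) (sing x) e)
    ; cover = cov
    ; done-new = λ y d → ¬true⇒false (λ e → true≢false (∖-fst (new s) (sing x) e) (done-new s y d))
    ; done-stack = λ y d → ¬true⇒false (λ e → ds y d (mem-∷ {y = x} {stack s} e))
    ; new-stack = λ y n → ¬true⇒false (λ e → ns y n (mem-∷ {y = x} {stack s} e))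
    ; separated = λ y z d n → separated s y z d (∖-fst (new s) (sing x) n) }
    where
    st : mem (x ∷ stack s) ⊑ V
    st y e with mem-∷ {y = x} {stack s} e
    ... | inj₁ refl = new⊑ s x nx
    ... | inj₂ m    = stack⊑ s y m
    ds : ∀ y → done s y ≡ true → x ≡ y ⊎ mem (stack s) y ≡ true → ⊥
    ds y d (inj₁ refl) = true≢false nx (done-new s y d)
    ds y d (inj₂ m)    = true≢false m (done-stack s y d)
    ns : ∀ y → (new s ∖ sing x) y ≡ true → x ≡ y ⊎ mem (stack s) y ≡ true → ⊥
    ns y n (inj₁ refl) = true≢false (==-refl x) (∖-snd (new s) (sing x) n)
    ns y n (inj₂ m)    = true≢false m (new-stack s y (∖-fst (new s) (sing x) n))
    cov : ∀ y → V y ≡ true → done s y ≡ true ⊎ (new s ∖ sing x) y ≡ true ⊎ mem (x ∷ stack s) y ≡ true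
    cov y v with cover s y v | true? (sing x y)
    ... | inj₁ d        | _      = inj₁ d
    ... | inj₂ (inj₁ n) | inj₁ e = inj₂ (inj₂ (∨-inj₁ e))
    ... | inj₂ (inj₁ n) | inj₂ e = inj₂ (inj₁ (∖-in (new s) (sing x) n e))
    ... | inj₂ (inj₂ m) | _      = inj₂ (inj₂ (∨-inj₂ {x == y} m))

  pop : (s : State) → ∀ x l → stack s ≡ x ∷ l → (∀ y → new s y ≡ true → E x y ≡ false) → State
  pop s x l refl none = record
    { stack = l ; done = λ y → sing x y ∨ done s y ; new = new s ; isPath = IsPath-tail E x l (isPath s)
    ; uniq = proj₂ (uniq s) ; stack⊑ = λ y e → stack⊑ s y (∨-inj₂ {x == y} e)
    ; done⊑ = dn ; new⊑ = new⊑ s ; cover = cov ; done-new = dnew ; done-stack = dst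
    ; new-stack = λ y n → ¬true⇒false (λ m → true≢false (∨-inj₂ {x == y} m) (new-stack s y n))
    ; separated = sep }
    where
    isdone : ∀ {y} → (sing x y ∨ done s y) ≡ true → x ≡ y ⊎ done s y ≡ true
    isdone {y} e with ∨-case {sing x y} e
    ... | inj₁ a = inj₁ (==⇒≡ {i = x} {y} a)
    ... | inj₂ b = inj₂ b
    dn : (λ y → sing x y ∨ done s y) ⊑ V
    dn y e with isdone e
    ... | inj₁ refl = stack⊑ s x (mem-head x l)
    ... | inj₂ d    = done⊑ s y d
    cov : ∀ y → V y ≡ true → (sing x y ∨ done s y) ≡ true ⊎ new s y ≡ true ⊎ mem l y ≡ true
    cov y v with cover s y v
    ... | inj₁ d        = inj₁ (∨-inj₂ {sing x y} d)
    ... | inj₂ (inj₁ n) = inj₂ (inj₁ n)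
    ... | inj₂ (inj₂ m) with ∨-case {x == y} m
    ...   | inj₁ e = inj₁ (∨-inj₁ e)
    ...   | inj₂ e = inj₂ (inj₂ e)
    dnew : ∀ y → (sing x y ∨ done s y) ≡ true → new s y ≡ false
    dnew y e with isdone e
    ... | inj₁ refl = ¬true⇒false (λ n → true≢false (mem-head x l) (new-stack s x n))
    ... | inj₂ d    = done-new s y d
    dst : ∀ y → (sing x y ∨ done s y) ≡ true → mem l y ≡ false
    dst y e with isdone e
    ... | inj₁ refl = proj₁ (uniq s)
    ... | inj₂ d    = ¬true⇒false (λ m → true≢false (∨-inj₂ {x == y} m) (done-stack s y d))
    sep : ∀ y z → (sing x y ∨ done s y) ≡ true → new s z ≡ true → E y z ≡ false
    sep y z e n with isdone e
    ... | inj₁ refl = none z n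
    ... | inj₂ d    = separated s y z d n

  pop-done : ∀ s x l e none → # (done (pop s x l e none)) ≡ suc (# (done s))
  pop-done s x l refl none = trans (#-remove _ x (∨-inj₁ (==-refl x))) (cong suc (#-cong same))
    where
    same : ∀ y → ((sing x y ∨ done s y) ∧ not (sing x y)) ≡ done s y
    same y with x Fin.≟ y
    ... | yes refl = sym (¬true⇒false (λ d → true≢false (mem-head x l) (done-stack s x d)))
    ... | no _     = Bool.∧-identityʳ (done s y)

  -- A push moves a new vertex to the stack and a pop takes one off it; with weights two and one
  -- both decrease the total.
  measure : State → ℕ
  measure s = # (new s) + # (new s) + length (stack s)

  push-measure : ∀ s x nx p → measure (push s x nx p) < measure s
  push-measure s x nx p = subst (λ z → # n′ + # n′ + suc (length (stack s)) < z + z + length (stack s))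
    (sym (#-remove (new s) x nx)) (≤-reflexive (lem (# n′) (length (stack s))))
    where
    n′ = new s ∖ sing x
    lem : ∀ a b → suc (a + a + suc b) ≡ suc a + suc a + b
    lem = solve-∀

  pop-measure : ∀ s x l e none → measure (pop s x l e none) ≡ # (new s) + # (new s) + length l
  pop-measure s x l refl none = refl

  -- Each pop finishes exactly one vertex, so the search can be halted at the moment when `T`
  -- vertices are done.
  run : ∀ T → T ≤ # V → ∀ fuel (s : State) → measure s < fuel → # (done s) ≤ T → ∃ λ s′ → # (done s′) ≡ T
  run T le (suc fuel) s (s≤s lt) le′ with m≤n⇒m<n∨m≡n le′
  ... | inj₂ eq = s , eq
  ... | inj₁ more with stack s in st
  ...   | [] with #-pos (new s) (+-cancelˡ-≤ (# (done s)) 1 (# (new s)) (≤-trans (≤-trans (≤-reflexive (+-comm _ 1)) more) (≤-trans le (#-cover cov))))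
    where
    cov : ∀ x → V x ≡ true → done s x ≡ true ⊎ new s x ≡ true
    cov x v with cover s x v
    ... | inj₁ d        = inj₁ d
    ... | inj₂ (inj₁ n) = inj₂ n
    ... | inj₂ (inj₂ m) = ⊥-elim (true≢false m (cong (λ l → mem l x) st))
  ...     | x , nx = run T le fuel (push s x nx p) dec le′
    where
    p : IsPath E (x ∷ stack s)
    p = subst (λ l → IsPath E (x ∷ l)) (sym st) tt
    dec : measure (push s x nx p) < fuel
    dec = <-≤-trans (push-measure s x nx p) (≤-trans (≤-reflexive (cong (λ l → # (new s) + # (new s) + length l) st)) lt)
  run T le (suc fuel) s (s≤s lt) le′ | inj₁ more | x ∷ l with Fin.any? (λ y → (new s y Bool.≟ true) ×-dec (E x y Bool.≟ true))
  ... | yes (y , ny , exy) = run T le fuel (push s y ny p) dec le′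
    where
    p : IsPath E (y ∷ stack s)
    p = subst (λ l → IsPath E (y ∷ l)) (sym st) (E-sym x y exy , subst (IsPath E) st (isPath s))
    dec : measure (push s y ny p) < fuel
    dec = <-≤-trans (push-measure s y ny p) (≤-trans (≤-reflexive (cong (λ l → # (new s) + # (new s) + length l) st)) lt)
  ... | no none = run T le fuel s′ dec (≤-trans (≤-reflexive (pop-done s x l st none′)) more)
    where
    none′ : ∀ y → new s y ≡ true → E x y ≡ false
    none′ y n = ¬true⇒false (λ e → none (y , n , e))
    s′ = pop s x l st none′
    dec : measure s′ < fuel
    dec = <-≤-trans (subst (_< # (new s) + # (new s) + suc (length l)) (sym (pop-measure s x l st none′)) (+-monoʳ-< (# (new s) + # (new s)) (n<1+n (length l)))) lt

  dfs : ∀ T → T ≤ # V → ∃ λ s → # (done s) ≡ T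
  dfs T le = run T le (suc (measure s₀)) s₀ ≤-refl (≤-trans (≤-reflexive (#-none (λ _ → refl))) z≤n)
    where
    s₀ : State
    s₀ = record { stack = [] ; done = ∅ ; new = V ; isPath = tt ; uniq = tt ; stack⊑ = λ _ () ; done⊑ = λ _ ()
                ; new⊑ = λ _ e → e ; cover = λ x v → inj₂ (inj₁ v) ; done-new = λ _ () ; done-stack = λ _ ()
                ; new-stack = λ _ _ → refl ; separated = λ _ _ () }

-- The ends `H` and `T` are spare parts: the earlier path is attached at one of the `h` vertices of
-- `X` in `T`, and those in `H` become the next fat end. Only `M` is certain to be traversed, so
-- only its length is counted.
record LongPath {N : ℕ} (R : Fin N → Fin N → Bool) (X Y : Fin N → Bool) (h L : ℕ) : Set where
  field
    H M T  : List (Fin N)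
    walk   : IsPath R (H ++ M ++ T)
    uniq   : Uniq (H ++ M ++ T)
    inside : mem (H ++ M ++ T) ⊑ (λ x → X x ∨ Y x)
    long   : L + L ≤ suc (8 * h + length M)
    H-X    : h ≤ # (λ x → X x ∧ mem H x)
    T-X    : h ≤ # (λ x → X x ∧ mem T x)

module PairPath {N : ℕ} (R : Fin N → Fin N → Bool) (R-sym : ∀ x y → R x y ≡ true → R y x ≡ true)
  (X Y : Fin N → Bool) (X-Y : ∀ x → X x ≡ true → Y x ≡ true → ⊥) (h L : ℕ) (h≤L : h ≤ L)
  (L≤X : L ≤ # X) (L≤Y : L ≤ # Y)
  (joined : ∀ p q → p ⊑ X → q ⊑ Y → h ≤ # p → h ≤ # q → ∃ λ x → ∃ λ y → p x ≡ true × q y ≡ true × R x y ≡ true)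
  where

  E : Fin N → Fin N → Bool
  E x y = R x y ∧ ((X x ∧ Y y) ∨ (Y x ∧ X y))

  E-sym : ∀ x y → E x y ≡ true → E y x ≡ true
  E-sym x y e = ∧-true (R-sym x y (∧-fst e)) (swap (∨-case {X x ∧ Y y} (∧-snd {R x y} e)))
    where
    swap : (X x ∧ Y y) ≡ true ⊎ (Y x ∧ X y) ≡ true → ((X y ∧ Y x) ∨ (Y y ∧ X x)) ≡ true
    swap (inj₁ a) = ∨-inj₂ {X y ∧ Y x} (∧-true (∧-snd {X x} a) (∧-fst a))
    swap (inj₂ b) = ∨-inj₁ (∧-true (∧-snd {Y x} b) (∧-fst b))

  V : Fin N → Bool
  V x = X x ∨ Y x

  X⇒¬Y : ∀ {x} → X x ≡ true → Y x ≡ false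
  X⇒¬Y {x} a = ¬true⇒false (X-Y x a)

  Y⇒¬X : ∀ {x} → Y x ≡ true → X x ≡ false
  Y⇒¬X {x} a = ¬true⇒false (λ b → X-Y x b a)

  record Balanced (p q : Fin N → Bool) (l : List (Fin N)) : Set where
    field
      lower : count q l ≤ count p l
      upper : count p l ≤ suc (count q l)
      total : length l ≡ count p l + count q l

  prepend : ∀ p q x l → p x ≡ true → q x ≡ false → count p l ≤ count q l → count q l ≤ suc (count p l) →
            length l ≡ count q l + count p l → Balanced p q (x ∷ l)
  prepend p q x l px qx lo up to = record
    { lower = subst₂ _≤_ (sym eq) (sym ep) up
    ; upper = subst₂ (λ a b → a ≤ suc b) (sym ep) (sym eq) (s≤s lo)
    ; total = trans (cong suc (trans to (+-comm (count q l) _))) (sym (cong₂ _+_ ep eq)) }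
    where
    ep : count p (x ∷ l) ≡ suc (count p l)
    ep = cong (_+ count p l) (⟦⟧-true px)
    eq : count q (x ∷ l) ≡ count q l
    eq = cong (_+ count q l) (⟦⟧-false qx)

  alternateX : ∀ x l → X x ≡ true → IsPath E (x ∷ l) → mem (x ∷ l) ⊑ V → Balanced X Y (x ∷ l)
  alternateY : ∀ x l → Y x ≡ true → IsPath E (x ∷ l) → mem (x ∷ l) ⊑ V → Balanced Y X (x ∷ l)
  alternateX x [] Xx p v = prepend X Y x [] Xx (X⇒¬Y Xx) z≤n z≤n refl
  alternateX x (y ∷ l) Xx (e , p) v with ∨-case {X x ∧ Y y} (∧-snd {R x y} e)
  ... | inj₂ b = ⊥-elim (X-Y x Xx (∧-fst b))
  ... | inj₁ a with alternateY y l (∧-snd {X x} a) p (λ z m → v z (∨-inj₂ {x == z} m))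
  ...   | record { lower = lo ; upper = up ; total = to } = prepend X Y x (y ∷ l) Xx (X⇒¬Y Xx) lo up to
  alternateY x [] Yx p v = prepend Y X x [] Yx (Y⇒¬X Yx) z≤n z≤n refl
  alternateY x (y ∷ l) Yx (e , p) v with ∨-case {X x ∧ Y y} (∧-snd {R x y} e)
  ... | inj₁ a = ⊥-elim (X-Y x (∧-fst a) Yx)
  ... | inj₂ b with alternateX y l (∧-snd {Y x} b) p (λ z m → v z (∨-inj₂ {x == z} m))
  ...   | record { lower = lo ; upper = up ; total = to } = prepend Y X x (y ∷ l) Yx (Y⇒¬X Yx) lo up to

  record Near (l : List (Fin N)) : Set where
    field
      X≤Y   : count X l ≤ suc (count Y l)
      Y≤X   : count Y l ≤ suc (count X l)
      total : length l ≡ count X l + count Y l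

  near : ∀ l → IsPath E l → mem l ⊑ V → Near l
  near [] p v = record { X≤Y = z≤n ; Y≤X = z≤n ; total = refl }
  near (x ∷ l) p v with ∨-case {X x} (v x (mem-head x l))
  ... | inj₁ e = record { X≤Y = Balanced.upper b ; Y≤X = m≤n⇒m≤1+n (Balanced.lower b) ; total = Balanced.total b }
    where b = alternateX x l e p v
  ... | inj₂ e = record { X≤Y = m≤n⇒m≤1+n (Balanced.lower b) ; Y≤X = Balanced.upper b ; total = trans (Balanced.total b) (+-comm (count Y (x ∷ l)) _) }
    where b = alternateY x l e p v

  -- The path alternates: fewer than `h` vertices in `X` would leave at most `h` in `Y`, too few for
  -- `h + h` in all.
  half : ∀ l → IsPath E l → mem l ⊑ V → length l ≡ h + h → h ≤ count X l
  half l p v e = ≮⇒≥ (λ lt → <-irrefl (trans (sym (Near.total n)) e)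
    (≤-<-trans (+-monoʳ-≤ (count X l) (Near.Y≤X n)) (lem (count X l) lt)))
    where
    n = near l p v
    lem : ∀ a → a < h → a + suc a < h + h
    lem a lt = +-mono-≤ lt lt

  X+Y≤V : # X + # Y ≤ # V
  X+Y≤V = #-disj (λ x → ∨-inj₁) (λ x → ∨-inj₂ {X x}) X-Y

  -- Halt the search when `h + h` vertices are done. One side then contains at least `h` of them, so
  -- the other side has at most `h` done and, lacking red edges from done to new, fewer than `h` new
  -- vertices. Its remaining `L - 2h` or more vertices are on the stack, which alternates between
  -- the sides.
  long-stack : ∃ λ l → IsPath E l × Uniq l × mem l ⊑ V × L + L ≤ suc (4 * h + length l)
  long-stack with DFS.dfs E E-sym V (h + h) (≤-trans (+-mono-≤ (≤-trans h≤L L≤X) (≤-trans h≤L L≤Y)) X+Y≤V)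
  ... | s , #D = stack , isPath , uniq , stack⊑ , bound
    where
    open DFS.State s
    open Near (near stack isPath stack⊑)
    open ≤-Reasoning
    D∧X D∧Y N∧X N∧Y : Fin N → Bool
    D∧X x = done x ∧ X x
    D∧Y x = done x ∧ Y x
    N∧X x = new x ∧ X x
    N∧Y x = new x ∧ Y x
    D-sum : # D∧X + # D∧Y ≤ h + h
    D-sum = ≤-trans (#-disj (λ x → ∧-fst) (λ x → ∧-fst) (λ x a b → X-Y x (∧-snd {done x} a) (∧-snd {done x} b))) (≤-reflexive #D)
    D-sum′ : h + h ≤ # D∧X + # D∧Y
    D-sum′ = ≤-trans (≤-reflexive (sym #D)) (#-cover cov)
      where
      cov : ∀ x → done x ≡ true → D∧X x ≡ true ⊎ D∧Y x ≡ true
      cov x d with ∨-case {X x} (done⊑ x d)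
      ... | inj₁ e = inj₁ (∧-true d e)
      ... | inj₂ e = inj₂ (∧-true d e)
    part : ∀ P → P ⊑ V → # P ≤ # (λ x → done x ∧ P x) + (# (λ x → new x ∧ P x) + count P stack)
    part P P⊑ = ≤-trans (#-cover cov) (+-monoʳ-≤ _ (≤-trans (#-∨ _ _) (+-monoʳ-≤ _ (#-mem P stack))))
      where
      cov : ∀ x → P x ≡ true → (done x ∧ P x) ≡ true ⊎ ((new x ∧ P x) ∨ (P x ∧ mem stack x)) ≡ true
      cov x e with cover x (P⊑ x e)
      ... | inj₁ d        = inj₁ (∧-true d e)
      ... | inj₂ (inj₁ n) = inj₂ (∨-inj₁ (∧-true n e))
      ... | inj₂ (inj₂ m) = inj₂ (∨-inj₂ {new x ∧ P x} (∧-true e m))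
    arith : ∀ a b c c′ → a ≤ h → b < h → L ≤ a + (b + c) → c ≤ suc c′ → length stack ≡ c′ + c → L + L ≤ suc (4 * h + length stack)
    arith a b c c′ a≤ b< L≤ c≤ tot = begin
      L + L  ≤⟨ +-mono-≤ L≤′ L≤′ ⟩
      h + (h + c) + (h + (h + c))  ≡⟨ lem₁ h c ⟩
      4 * h + (c + c)  ≤⟨ +-monoʳ-≤ (4 * h) (+-monoˡ-≤ c c≤) ⟩
      4 * h + suc (c′ + c)  ≡⟨ trans (+-suc (4 * h) (c′ + c)) (cong (λ z → suc (4 * h + z)) (sym tot)) ⟩
      suc (4 * h + length stack)  ∎
      where
      L≤′ : L ≤ h + (h + c)
      L≤′ = ≤-trans L≤ (+-mono-≤ a≤ (+-monoˡ-≤ c (<⇒≤ b<)))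
      lem₁ : ∀ h c → h + (h + c) + (h + (h + c)) ≡ 4 * h + (c + c)
      lem₁ = solve-∀
    cancel : ∀ {a b} → a + b ≤ h + h → h ≤ a → b ≤ h
    cancel le le′ = +-cancelˡ-≤ h _ _ (≤-trans (+-monoˡ-≤ _ le′) le)
    bound : L + L ≤ suc (4 * h + length stack)
    bound with h ≤? # D∧X
    ... | yes hX = arith (# D∧Y) (# N∧Y) (count Y stack) (count X stack) (cancel D-sum hX)
        (≰⇒> (λ hY → noEdge (joined D∧X N∧Y (λ x e → ∧-snd {done x} e) (λ x e → ∧-snd {new x} e) hX hY)))
        (≤-trans L≤Y (part Y (λ x → ∨-inj₂ {X x}))) Y≤X total
      where
      noEdge : (∃ λ x → ∃ λ y → D∧X x ≡ true × N∧Y y ≡ true × R x y ≡ true) → ⊥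
      noEdge (x , y , a , b , r) = true≢false
        (∧-true r (∨-inj₁ (∧-true (∧-snd {done x} a) (∧-snd {new y} b)))) (separated x y (∧-fst a) (∧-fst b))
    ... | no ¬hX = arith (# D∧X) (# N∧X) (count X stack) (count Y stack) (<⇒≤ (≰⇒> ¬hX))
        (≰⇒> (λ hN → noEdge (joined N∧X D∧Y (λ x e → ∧-snd {new x} e) (λ x e → ∧-snd {done x} e) hN hY)))
        (≤-trans L≤X (part X (λ x → ∨-inj₁))) X≤Y (trans total (+-comm (count X stack) _))
      where
      hY : h ≤ # D∧Y
      hY = +-cancelˡ-≤ h _ _ (≤-trans D-sum′ (+-monoˡ-≤ _ (<⇒≤ (≰⇒> ¬hX))))
      noEdge : (∃ λ x → ∃ λ y → N∧X x ≡ true × D∧Y y ≡ true × R x y ≡ true) → ⊥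
      noEdge (x , y , a , b , r) = true≢false
        (∧-true (R-sym x y r) (∨-inj₂ {X y ∧ Y x} (∧-true (∧-snd {done y} b) (∧-snd {new x} a)))) (separated y x (∧-fst b) (∧-fst a))

  -- Of the `8 * h`, half is lost in the search and half goes to the two ends of `h + h` vertices
  -- each; `big` ensures that these do not overlap.
  long-path : suc (8 * h) ≤ L + L → LongPath R X Y h L
  long-path big with long-stack
  ... | l , p , u , v , long with splitAt-length (h + h) l (≤-trans (m≤n+m (h + h) (h + h)) 4h≤)
    where
    4h≤ : h + h + (h + h) ≤ length l
    4h≤ = +-cancelˡ-≤ (suc (4 * h)) _ _ (≤-trans (≤-reflexive (lem h)) (≤-trans big long))
      where
      lem : ∀ h → suc (4 * h) + (h + h + (h + h)) ≡ suc (8 * h)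
      lem = solve-∀
  ...   | H , l₁ , refl , #H with splitAt-length (length l₁ ∸ (h + h)) l₁ (m∸n≤m (length l₁) (h + h))
  ...     | M , T , refl , #M = record
    { H = H ; M = M ; T = T
    ; walk = IsPath-mono (λ x y → ∧-fst) (H ++ M ++ T) p ; uniq = u ; inside = v
    ; long = ≤-trans long (s≤s (≤-reflexive (trans (cong (4 * h +_) lens) (lem h (length M)))))
    ; H-X = ≤-trans (half H (IsPath-++ˡ E H p) (λ x m → v x (mem-++ˡ H m)) #H) (mem-# X H (Uniq-++ˡ H u))
    ; T-X = ≤-trans (half T (IsPath-++ʳ E M (IsPath-++ʳ E H p)) (λ x m → v x (mem-++ʳ H (mem-++ʳ M m))) #T)
                    (mem-# X T (Uniq-++ʳ M (Uniq-++ʳ H u))) }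
    where
    lem : ∀ h m → 4 * h + (h + h + (m + (h + h))) ≡ 8 * h + m
    lem = solve-∀
    l₁≥ : h + h ≤ length (M ++ T)
    l₁≥ = +-cancelˡ-≤ (suc (4 * h + (h + h))) _ _ (begin
      suc (4 * h + (h + h)) + (h + h)  ≡⟨ lem₃ h ⟩
      suc (8 * h)  ≤⟨ big ⟩
      L + L  ≤⟨ long ⟩
      suc (4 * h + length (H ++ M ++ T))  ≡⟨ cong (λ z → suc (4 * h + z)) (trans (length-++ H) (cong (_+ length (M ++ T)) #H)) ⟩
      suc (4 * h + (h + h + length (M ++ T)))  ≡⟨ cong suc (sym (+-assoc (4 * h) (h + h) _)) ⟩
      suc (4 * h + (h + h)) + length (M ++ T)  ∎)
      where
      open ≤-Reasoning
      lem₃ : ∀ h → suc (4 * h + (h + h)) + (h + h) ≡ suc (8 * h)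
      lem₃ = solve-∀
    #T : length T ≡ h + h
    #T = +-cancelˡ-≡ (length M) _ _ (trans (sym (length-++ M)) (trans (sym (m∸n+n≡m l₁≥)) (cong (_+ (h + h)) (sym #M))))
    lens : length (H ++ M ++ T) ≡ h + h + (length M + (h + h))
    lens = trans (length-++ H) (cong₂ _+_ #H (trans (length-++ M) (cong (length M +_) #T)))

-- Linking the matched pairs into one red path

#≤1 : ∀ {n} (p : Fin n → Bool) → (∀ x y → p x ≡ true → p y ≡ true → x ≡ y) → # p ≤ 1
#≤1 p h with 1 ≤? # p
... | no z = ≤-trans (s≤s⁻¹ (≰⇒> z)) z≤n
... | yes ne with #-pos p ne
...   | x , px = ≤-trans (#-mono sub) (≤-reflexive (#-single x))
  where
  sub : p ⊑ sing x
  sub y py rewrite h x y px py = ==-refl y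

-- A fat end is a set of at least h vertices in one cluster, each of which is the end of a
-- path of the required length.  The reserved parts Z of the clusters let a fat end be moved
-- to any cluster of the connected set C, and the matched pairs are then absorbed one by one.
module FatEnds {N K : ℕ} (R : Fin N → Fin N → Bool) (R-sym : ∀ x y → R x y ≡ true → R y x ≡ true)
  (Γ : Fin K → Fin K → Bool) (Γ-sym : ∀ i j → Γ i j ≡ true → Γ j i ≡ true)
  (cls : Fin N → Fin K) (isX isY isZ : Fin N → Bool)
  (X-Y : ∀ v → isX v ≡ true → isY v ≡ true → ⊥) (X-Z : ∀ v → isX v ≡ true → isZ v ≡ true → ⊥)
  (Y-Z : ∀ v → isY v ≡ true → isZ v ≡ true → ⊥)
  (h L t g : ℕ) (1≤h : 1 ≤ h) (h≤L : h ≤ L) (big : g + suc (8 * h) ≤ L + L)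
  (C : Fin K → Bool) (connected : Separation.Connected Γ Γ-sym C)
  (joined : ∀ a b → Γ a b ≡ true → C a ≡ true → C b ≡ true → ∀ p q →
            p ⊑ (λ v → cls v == a) → q ⊑ (λ v → cls v == b) → h ≤ # p → h ≤ # q →
            ∃ λ x → ∃ λ y → p x ≡ true × q y ≡ true × R x y ≡ true)
  (sizeX : ∀ a → C a ≡ true → L ≤ # (λ v → (cls v == a) ∧ isX v))
  (sizeY : ∀ a → C a ≡ true → L ≤ # (λ v → (cls v == a) ∧ isY v))
  (sizeZ : ∀ a → C a ≡ true → 3 * h + t ≤ # (λ v → (cls v == a) ∧ isZ v))
  (pm : Deficiency.PartialMatching Γ C t)
  where

  open Deficiency.PartialMatching pm

  U Xs Ys Zs : Fin K → Fin N → Bool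
  U a v = cls v == a
  Xs a v = U a v ∧ isX v
  Ys a v = U a v ∧ isY v
  Zs a v = U a v ∧ isZ v

  PathFrom : (Fin N → Bool) → ℕ → Fin N → List (Fin N) → Set
  PathFrom W ℓ x w = IsPath R (x ∷ w) × Uniq (x ∷ w) × ℓ ≤ length (x ∷ w) × mem (x ∷ w) ⊑ W

  -- Outside the vertices already used, a link meets each cluster at most once; this keeps the cost
  -- of a link to one reserved vertex per cluster.
  Once : (Fin N → Bool) → Fin N → List (Fin N) → Set
  Once W x w = ∀ u v → mem (x ∷ w) u ≡ true → mem (x ∷ w) v ≡ true → W u ≡ false → W v ≡ false → cls u ≡ cls v → u ≡ v

  -- `W` contains whatever any of the candidate paths uses. In `W-Z`, `h` is the initial fat end and
  -- `s` the number of links made. `Rem` indexes the matched pairs not yet absorbed.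
  record Fat (s ℓ : ℕ) (Rem : Fin K → Bool) : Set where
    field
      W      : Fin N → Bool
      a      : Fin K
      X      : Fin N → Bool
      Ca     : C a ≡ true
      X⊑U    : X ⊑ U a
      X-big  : h ≤ # X
      W-Z    : ∀ i → # (λ v → W v ∧ Zs i v) ≤ h + s
      W-X    : ∀ l v → Rem l ≡ true → Xs l v ≡ true → W v ≡ false
      W-Y    : ∀ l v → Rem l ≡ true → Ys (π l) v ≡ true → W v ≡ false
      ends   : ∀ x → X x ≡ true → ∃ (PathFrom W ℓ x)

  module Spread {s ℓ Rem} (F : Fat s ℓ Rem) (s≤t : s ≤ t) where
    open Fat F

    Env : (Fin K → Bool) → Fin N → Bool
    Env Rch v = W v ∨ (isZ v ∧ Rch (cls v))

    record Reached (Rch : Fin K → Bool) (d : Fin K) : Set where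
      field
        X′     : Fin N → Bool
        X′⊑    : X′ ⊑ U d
        X′-big : h ≤ # X′
        ends′  : ∀ x → X′ x ≡ true → ∃ λ w → PathFrom (Env Rch) ℓ x w ×
                 Once W x w

    Env-mono : ∀ {P Q} → P ⊑ Q → Env P ⊑ Env Q
    Env-mono h v e with ∨-case {W v} e
    ... | inj₁ x = ∨-inj₁ x
    ... | inj₂ y = ∨-inj₂ {W v} (∧-true (∧-fst y) (h (cls v) (∧-snd {isZ v} y)))

    widen : ∀ {P Q d} → P ⊑ Q → Reached P d → Reached Q d
    widen {P} {Q} h r = record { X′ = X′ ; X′⊑ = X′⊑ ; X′-big = X′-big ; ends′ = e }
      where
      open Reached r
      e : ∀ x → X′ x ≡ true → _
      e x px with ends′ x px
      ... | w , (p , u , l , m) , one = w , (p , u , l , λ v e → Env-mono {P} {Q} h v (m v e)) , one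

    extend : ∀ Rch i j → Rch ⊑ C → Reached Rch i → C i ≡ true → C j ≡ true → Rch j ≡ false → Γ i j ≡ true →
             Reached (λ k → sing j k ∨ Rch k) j
    extend Rch i j Rch⊑ r Ci Cj ¬j g = record
      { X′ = Xj ; X′⊑ = λ v e → ∧-fst (∖-fst (Zs j) W (∧-fst e)) ; X′-big = bigj ; ends′ = ends-j }
      where
      open Reached r
      free : Fin N → Bool
      free = Zs j ∖ W
      nbr : Fin N → Bool
      nbr v = any (λ x → X′ x ∧ R x v)
      Xj : Fin N → Bool
      Xj v = free v ∧ nbr v
      free-big : h + h ≤ # free
      free-big = +-cancelˡ-≤ (h + t) _ _ (begin
        h + t + (h + h)  ≡⟨ lem h t ⟩
        3 * h + t  ≤⟨ sizeZ j Cj ⟩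
        # (Zs j)  ≡⟨ #-split (Zs j) W ⟩
        # (λ v → Zs j v ∧ W v) + # free ≡⟨ cong (_+ # free) (#-cong (λ v → Bool.∧-comm (Zs j v) (W v))) ⟩
        # (λ v → W v ∧ Zs j v) + # free ≤⟨ +-monoˡ-≤ (# free) (≤-trans (W-Z j) (+-monoʳ-≤ h s≤t)) ⟩
        h + t + # free  ∎)
        where
        open ≤-Reasoning
        lem : ∀ h t → h + t + (h + h) ≡ 3 * h + t
        lem = solve-∀
      few : # (λ v → free v ∧ not (nbr v)) < h
      few = ≰⇒> (λ le → bad (joined i j g Ci Cj X′ _ X′⊑ (λ v e → ∧-fst (∖-fst (Zs j) W (∧-fst e))) X′-big le))
        where
        bad : (∃ λ x → ∃ λ y → X′ x ≡ true × (free y ∧ not (nbr y)) ≡ true × R x y ≡ true) → ⊥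
        bad (x , y , a , b , r) = true≢false (any-intro (λ x → X′ x ∧ R x y) x (∧-true a r)) (not-true (∧-snd {free y} b))
      bigj : h ≤ # Xj
      bigj = +-cancelʳ-≤ h _ _ (≤-trans free-big (≤-trans (≤-reflexive (#-split free nbr)) (+-monoʳ-≤ (# Xj) (<⇒≤ few))))
      Rch′ : Fin K → Bool
      Rch′ k = sing j k ∨ Rch k
      ends-j : ∀ z → Xj z ≡ true → ∃ λ w → PathFrom (Env Rch′) ℓ z w ×
                 Once W z w
      ends-j z e with any-elim (λ x → X′ x ∧ R x z) (∧-snd {free z} e)
      ... | x , e′ with ends′ x (∧-fst e′)
      ...   | w , (p , u , l , m) , one = x ∷ w , ((R-sym x z (∧-snd {X′ x} e′) , p) , (fresh , u) , m≤n⇒m≤1+n l , env) , one′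
        where
        zU : cls z ≡ j
        zU = ==⇒≡ {i = cls z} {j} (∧-fst (∖-fst (Zs j) W (∧-fst e)))
        zZ : isZ z ≡ true
        zZ = ∧-snd {U j z} (∖-fst (Zs j) W (∧-fst e))
        zW : W z ≡ false
        zW = ∖-snd (Zs j) W (∧-fst e)
        outside : ∀ v → mem (x ∷ w) v ≡ true → W v ≡ false → cls v ≡ j → ⊥
        outside v mv Wv c with ∨-case {W v} (m v mv)
        ... | inj₁ a = true≢false a Wv
        ... | inj₂ b = true≢false (subst (λ k → Rch k ≡ true) c (∧-snd {isZ v} b)) ¬j
        fresh : mem (x ∷ w) z ≡ false
        fresh = ¬true⇒false (λ mz → outside z mz zW zU)
        env : mem (z ∷ x ∷ w) ⊑ Env Rch′
        env v mv with mem-∷ {y = z} {x ∷ w} mv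
        ... | inj₁ refl = ∨-inj₂ {W z} (∧-true zZ (∨-inj₁ (subst (λ k → sing j k ≡ true) (sym zU) (==-refl j))))
        ... | inj₂ mv′  = Env-mono {Rch} {Rch′} (λ k → ∨-inj₂ {sing j k}) v (m v mv′)
        one′ : Once W z (x ∷ w)
        one′ u v mu mv Wu Wv c with mem-∷ {y = z} {x ∷ w} mu | mem-∷ {y = z} {x ∷ w} mv
        ... | inj₁ a   | inj₁ b   = trans (sym a) b
        ... | inj₁ a   | inj₂ mv′ = ⊥-elim (outside v mv′ Wv (trans (sym c) (trans (cong cls (sym a)) zU)))
        ... | inj₂ mu′ | inj₁ b   = ⊥-elim (outside u mu′ Wu (trans c (trans (cong cls (sym b)) zU)))
        ... | inj₂ mu′ | inj₂ mv′ = one u v mu′ mv′ Wu Wv c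

    grow : ∀ d → C d ≡ true → ∀ fuel Rch → # (C ∖ Rch) < fuel → Rch ⊑ C → Rch a ≡ true →
           (∀ i → Rch i ≡ true → Reached Rch i) → ∃ λ Rch′ → Reached Rch′ d
    grow d Cd (suc fuel) Rch (s≤s lt) Rch⊑ Ra all with true? (Rch d)
    ... | inj₁ e = Rch , all d e
    ... | inj₂ ¬d with connected Rch Rch⊑ a d Ra Cd ¬d
    ...   | i , j , Ri , Cj , ¬j , gij = grow d Cd fuel Rch′
              (<-≤-trans smaller lt) sub (∨-inj₂ {sing j a} Ra) all′
      where
      Rch′ : Fin K → Bool
      Rch′ k = sing j k ∨ Rch k
      sub : Rch′ ⊑ C
      sub k e with ∨-case {sing j k} e
      ... | inj₁ x = subst (λ k → C k ≡ true) (==⇒≡ {i = j} {k} x) Cj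
      ... | inj₂ y = Rch⊑ k y
      smaller : # (C ∖ Rch′) < # (C ∖ Rch)
      smaller = ≤-trans (s≤s (#-mono sub′)) (≤-reflexive (sym (#-remove (C ∖ Rch) j (∖-in C Rch Cj ¬j))))
        where
        sub′ : (C ∖ Rch′) ⊑ ((C ∖ Rch) ∖ sing j)
        sub′ k e = ∖-in (C ∖ Rch) (sing j)
          (∖-in C Rch (∖-fst C Rch′ e) (¬true⇒false (λ r → true≢false (∨-inj₂ {sing j k} r) (∖-snd C Rch′ e))))
          (¬true⇒false (λ r → true≢false (∨-inj₁ r) (∖-snd C Rch′ e)))
      all′ : ∀ k → Rch′ k ≡ true → Reached Rch′ k
      all′ k e with ∨-case {sing j k} e
      ... | inj₁ x = subst (Reached Rch′) (==⇒≡ {i = j} {k} x) (extend Rch i j Rch⊑ (all i Ri) (Rch⊑ i Ri) Cj ¬j gij)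
      ... | inj₂ y = widen (λ k → ∨-inj₂ {sing j k}) (all k y)

    spread : ∀ d → C d ≡ true → ∃ λ Rch → Reached Rch d
    spread d Cd = grow d Cd (suc (# (C ∖ sing a))) (sing a) ≤-refl
      (λ k e → subst (λ k → C k ≡ true) (==⇒≡ {i = a} {k} e) Ca) (==-refl a)
      (λ i e → subst (Reached (sing a)) (==⇒≡ {i = a} {i} e) start)
      where
      start : Reached (sing a) a
      start = record { X′ = X ; X′⊑ = X⊑U ; X′-big = X-big ; ends′ = e }
        where
        e : ∀ x → X x ≡ true → _
        e x Xx with ends x Xx
        ... | w , (p , u , l , m) = w , (p , u , l , λ v mv → ∨-inj₁ (m v mv)) ,
                                    λ u v mu mv Wu Wv c → ⊥-elim (true≢false (m u mu) Wu)

  -- The new path comes from `H`, runs through `M` into `T` as far as `f`, crosses to `x` and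
  -- continues along `w`. From here on all of it is fixed except its starting point among the
  -- vertices of `X` in `H`.
  module Absorb {s ℓ Rem} (F : Fat s ℓ Rem) (Rem⊑ : Rem ⊑ dom) (l : Fin K) (Rl : Rem l ≡ true)
    (lp : LongPath R (Xs l) (Ys (π l)) h L) (x f : Fin N) (w : List (Fin N))
    (Tf : (Xs l f ∧ mem (LongPath.T lp) f) ≡ true) (Rxf : R x f ≡ true)
    (pw : PathFrom (λ v → Fat.W F v ∨ isZ v) ℓ x w)
    (once : Once (Fat.W F) x w)
    where
    open Fat F
    open LongPath lp
    dl = Rem⊑ l Rl
    Cl = dom⊑ l dl

    Qp = H ++ M ++ T
    headset : Fin N → Bool
    headset v = Xs l v ∧ mem H v

    T-split = mem-split T (∧-snd {Xs l f} Tf)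
    T₁ = proj₁ T-split
    T₂ = proj₁ (proj₂ T-split)

    pre = H ++ M ++ T₁
    Qp≡ : Qp ≡ pre ++ f ∷ T₂
    Qp≡ = trans (cong (λ z → H ++ M ++ z) (proj₂ (proj₂ T-split)))
            (trans (cong (H ++_) (sym (++-assoc M T₁ (f ∷ T₂)))) (sym (++-assoc H (M ++ T₁) (f ∷ T₂))))
    full = pre ++ f ∷ x ∷ w

    Qp-XY : ∀ v → mem Qp v ≡ true → Xs l v ≡ true ⊎ Ys (π l) v ≡ true
    Qp-XY v m = ∨-case {Xs l v} (inside v m)

    Qp-fresh : ∀ v → mem Qp v ≡ true → mem (x ∷ w) v ≡ true → ⊥
    Qp-fresh v m m′ with Qp-XY v m | ∨-case {W v} (proj₂ (proj₂ (proj₂ pw)) v m′)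
    ... | inj₁ a | inj₁ b = true≢false b (W-X l v Rl a)
    ... | inj₁ a | inj₂ b = X-Z v (∧-snd {U l v} a) b
    ... | inj₂ a | inj₁ b = true≢false b (W-Y l v Rl a)
    ... | inj₂ a | inj₂ b = Y-Z v (∧-snd {U (π l) v} a) b

    pre-mem : ∀ v → mem (pre ++ f ∷ []) v ≡ true → mem Qp v ≡ true
    pre-mem v m with mem-++ pre m
    ... | inj₁ a = subst (λ z → mem z v ≡ true) (sym Qp≡) (mem-++ˡ pre a)
    ... | inj₂ b with mem-∷ {y = f} {[]} b
    ...   | inj₁ refl = subst (λ z → mem z f ≡ true) (sym Qp≡) (mem-++ʳ pre (mem-head f T₂))

    full-path : IsPath R full
    full-path = glue R pre f T₂ x w (subst (IsPath R) Qp≡ walk) (R-sym x f Rxf) (proj₁ pw)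

    full≡ : full ≡ (pre ++ f ∷ []) ++ x ∷ w
    full≡ = sym (++-assoc pre (f ∷ []) (x ∷ w))

    full-uniq : Uniq full
    full-uniq = subst Uniq (sym full≡) (Uniq-++ (pre ++ f ∷ [])
      (Uniq-++ˡ (pre ++ f ∷ []) {T₂} (subst Uniq (trans Qp≡ (sym (++-assoc pre (f ∷ []) T₂))) uniq))
      (proj₁ (proj₂ pw)) (λ v m → ¬true⇒false (λ m′ → Qp-fresh v (pre-mem v m) m′)))

    W′ : Fin N → Bool
    W′ v = (W v ∨ mem (x ∷ w) v) ∨ mem Qp v

    W′-case : ∀ v → W′ v ≡ true → W v ≡ true ⊎ mem (x ∷ w) v ≡ true ⊎ mem Qp v ≡ true
    W′-case v e with ∨-case {W v ∨ mem (x ∷ w) v} e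
    ... | inj₂ q = inj₂ (inj₂ q)
    ... | inj₁ e′ with ∨-case {W v} e′
    ...   | inj₁ a = inj₁ a
    ...   | inj₂ b = inj₂ (inj₁ b)

    full⊑ : mem full ⊑ W′
    full⊑ v m with mem-++ (pre ++ f ∷ []) (subst (λ z → mem z v ≡ true) full≡ m)
    ... | inj₁ a = ∨-inj₂ {W v ∨ mem (x ∷ w) v} (pre-mem v a)
    ... | inj₂ b = ∨-inj₁ (∨-inj₂ {W v} b)

    Zs-Qp : ∀ i v → Zs i v ≡ true → mem Qp v ≡ true → ⊥
    Zs-Qp i v z m with Qp-XY v m
    ... | inj₁ a = X-Z v (∧-snd {U l v} a) (∧-snd {U i v} z)
    ... | inj₂ a = Y-Z v (∧-snd {U (π l) v} a) (∧-snd {U i v} z)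

    W′-Z : ∀ i → # (λ v → W′ v ∧ Zs i v) ≤ h + suc s
    W′-Z i = ≤-trans (#-cover cov) (≤-trans (+-mono-≤ (W-Z i) (#≤1 extra atMost)) (≤-reflexive (trans (+-assoc h s 1) (cong (h +_) (+-comm s 1)))))
      where
      extra : Fin N → Bool
      extra v = (mem (x ∷ w) ∖ W) v ∧ U i v
      cov : ∀ v → (W′ v ∧ Zs i v) ≡ true → (W v ∧ Zs i v) ≡ true ⊎ extra v ≡ true
      cov v e with true? (W v) | W′-case v (∧-fst e)
      ... | inj₁ a | _             = inj₁ (∧-true a (∧-snd {W′ v} e))
      ... | inj₂ a | inj₁ b        = ⊥-elim (true≢false b a)
      ... | inj₂ a | inj₂ (inj₁ m) = inj₂ (∧-true (∖-in (mem (x ∷ w)) W m a) (∧-fst (∧-snd {W′ v} e)))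
      ... | inj₂ a | inj₂ (inj₂ m) = ⊥-elim (Zs-Qp i v (∧-snd {W′ v} e) m)
      atMost : ∀ u v → extra u ≡ true → extra v ≡ true → u ≡ v
      atMost u v e e′ = once u v (∖-fst (mem (x ∷ w)) W (∧-fst e)) (∖-fst (mem (x ∷ w)) W (∧-fst e′))
        (∖-snd (mem (x ∷ w)) W (∧-fst e)) (∖-snd (mem (x ∷ w)) W (∧-fst e′))
        (trans (==⇒≡ {i = cls u} {i} (∧-snd {(mem (x ∷ w) ∖ W) u} e)) (sym (==⇒≡ {i = cls v} {i} (∧-snd {(mem (x ∷ w) ∖ W) v} e′))))

    Rem′ : Fin K → Bool
    Rem′ = Rem ∖ sing l

    path-env : ∀ v → mem (x ∷ w) v ≡ true → W v ≡ true ⊎ isZ v ≡ true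
    path-env v m = ∨-case {W v} (proj₂ (proj₂ (proj₂ pw)) v m)

    same-class : ∀ {v i j} → U i v ≡ true → U j v ≡ true → i ≡ j
    same-class {v} {i} {j} e e′ = trans (sym (==⇒≡ {i = cls v} {i} e)) (==⇒≡ {i = cls v} {j} e′)

    Rem′-fst : ∀ {k} → Rem′ k ≡ true → Rem k ≡ true
    Rem′-fst r = ∖-fst Rem (sing l) r

    Rem′-≢ : ∀ {k} → Rem′ k ≡ true → l ≡ k → ⊥
    Rem′-≢ r refl = true≢false (==-refl l) (∖-snd Rem (sing l) r)

    X-in-Qp : ∀ k v → Rem′ k ≡ true → Xs k v ≡ true → Xs l v ≡ true ⊎ Ys (π l) v ≡ true → ⊥
    X-in-Qp k v r e (inj₁ a) = Rem′-≢ r (same-class (∧-fst a) (∧-fst e))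
    X-in-Qp k v r e (inj₂ a) = X-Y v (∧-snd {U k v} e) (∧-snd {U (π l) v} a)

    Y-in-Qp : ∀ k v → Rem′ k ≡ true → Ys (π k) v ≡ true → Xs l v ≡ true ⊎ Ys (π l) v ≡ true → ⊥
    Y-in-Qp k v r e (inj₁ a) = X-Y v (∧-snd {U l v} a) (∧-snd {U (π k) v} e)
    -- Injectivity of `π`: no other pair uses the `Y` part of the cluster `π l`.
    Y-in-Qp k v r e (inj₂ a) = Rem′-≢ r (inj l k dl (Rem⊑ k (Rem′-fst r)) (same-class (∧-fst a) (∧-fst e)))

    X-in-W : ∀ k v → Rem′ k ≡ true → Xs k v ≡ true → W v ≡ true ⊎ isZ v ≡ true → ⊥
    X-in-W k v r e (inj₁ a) = true≢false a (W-X k v (Rem′-fst r) e)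
    X-in-W k v r e (inj₂ z) = X-Z v (∧-snd {U k v} e) z

    Y-in-W : ∀ k v → Rem′ k ≡ true → Ys (π k) v ≡ true → W v ≡ true ⊎ isZ v ≡ true → ⊥
    Y-in-W k v r e (inj₁ a) = true≢false a (W-Y k v (Rem′-fst r) e)
    Y-in-W k v r e (inj₂ z) = Y-Z v (∧-snd {U (π k) v} e) z

    W′-X : ∀ k v → Rem′ k ≡ true → Xs k v ≡ true → W′ v ≡ false
    W′-X k v r e = ¬true⇒false (λ e′ → bad (W′-case v e′))
      where
      bad : W v ≡ true ⊎ mem (x ∷ w) v ≡ true ⊎ mem Qp v ≡ true → ⊥
      bad (inj₁ a)        = X-in-W k v r e (inj₁ a)
      bad (inj₂ (inj₁ m)) = X-in-W k v r e (path-env v m)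
      bad (inj₂ (inj₂ m)) = X-in-Qp k v r e (Qp-XY v m)

    W′-Y : ∀ k v → Rem′ k ≡ true → Ys (π k) v ≡ true → W′ v ≡ false
    W′-Y k v r e = ¬true⇒false (λ e′ → bad (W′-case v e′))
      where
      bad : W v ≡ true ⊎ mem (x ∷ w) v ≡ true ⊎ mem Qp v ≡ true → ⊥
      bad (inj₁ a)        = Y-in-W k v r e (inj₁ a)
      bad (inj₂ (inj₁ m)) = Y-in-W k v r e (path-env v m)
      bad (inj₂ (inj₂ m)) = Y-in-Qp k v r e (Qp-XY v m)

    g≤M : g ≤ length M
    g≤M = +-cancelʳ-≤ (suc (8 * h)) _ _ (≤-trans big (≤-trans long (≤-reflexive (trans (cong suc (+-comm (8 * h) _)) (sym (+-suc (length M) _))))))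

    suffix : ∀ v H₁ H₂ → H ≡ H₁ ++ v ∷ H₂ → ∃ (PathFrom W′ (g + ℓ) v)
    suffix v H₁ H₂ H≡ = rest , IsPath-++ʳ R H₁ (subst (IsPath R) split full-path) ,
                        Uniq-++ʳ H₁ (subst Uniq split full-uniq) , len ,
                        (λ u m → full⊑ u (subst (λ z → mem z u ≡ true) (sym split) (mem-++ʳ H₁ m)))
      where
      rest : List (Fin N)
      rest = H₂ ++ M ++ T₁ ++ f ∷ x ∷ w
      split : full ≡ H₁ ++ v ∷ rest
      split = begin
        (H ++ M ++ T₁) ++ f ∷ x ∷ w  ≡⟨ ++-assoc H (M ++ T₁) _ ⟩
        H ++ (M ++ T₁) ++ f ∷ x ∷ w  ≡⟨ cong (H ++_) (++-assoc M T₁ _) ⟩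
        H ++ M ++ T₁ ++ f ∷ x ∷ w  ≡⟨ cong (_++ (M ++ T₁ ++ f ∷ x ∷ w)) H≡ ⟩
        (H₁ ++ v ∷ H₂) ++ M ++ T₁ ++ f ∷ x ∷ w ≡⟨ ++-assoc H₁ (v ∷ H₂) _ ⟩
        H₁ ++ v ∷ rest  ∎
        where open ≡-Reasoning
      len : g + ℓ ≤ suc (length rest)
      len = begin
        g + ℓ  ≤⟨ +-mono-≤ g≤M (proj₁ (proj₂ (proj₂ pw))) ⟩
        length M + length (x ∷ w)  ≤⟨ +-monoʳ-≤ (length M) (≤-trans (n≤1+n _) (m≤n+m _ (length T₁))) ⟩
        length M + (length T₁ + length (f ∷ x ∷ w))  ≡⟨ cong (length M +_) (sym (length-++ T₁)) ⟩
        length M + length (T₁ ++ f ∷ x ∷ w)  ≡⟨ sym (length-++ M) ⟩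
        length (M ++ T₁ ++ f ∷ x ∷ w)  ≤⟨ ≤-trans (m≤n+m _ (length H₂)) (≤-reflexive (sym (length-++ H₂))) ⟩
        length rest  ≤⟨ n≤1+n _ ⟩
        suc (length rest)  ∎
        where open ≤-Reasoning

    new-ends : ∀ v → headset v ≡ true → ∃ (PathFrom W′ (g + ℓ) v)
    new-ends v e = from-split (mem-split H (∧-snd {Xs l v} e))
      where
      from-split : (∃ λ H₁ → ∃ λ H₂ → H ≡ H₁ ++ v ∷ H₂) → ∃ (PathFrom W′ (g + ℓ) v)
      from-split (H₁ , H₂ , H≡) = suffix v H₁ H₂ H≡

    absorbed : Fat (suc s) (g + ℓ) Rem′
    absorbed = record
      { W = W′ ; a = l ; X = headset ; Ca = Cl ; X⊑U = λ v e → ∧-fst (∧-fst e) ; X-big = H-X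
      ; W-Z = W′-Z ; W-X = W′-X ; W-Y = W′-Y ; ends = new-ends }

  absorb : ∀ {s ℓ Rem} (F : Fat s ℓ Rem) → s ≤ t → Rem ⊑ dom → ∀ l → Rem l ≡ true → Fat (suc s) (g + ℓ) (Rem ∖ sing l)
  absorb {s} {ℓ} {Rem} F s≤t Rem⊑ l Rl = step (Spread.spread F s≤t (π l) Cπ)
    where
    open Spread F s≤t using (Reached; module Reached)
    dl = Rem⊑ l Rl
    Cl = dom⊑ l dl
    Cπ = into l dl
    lp : LongPath R (Xs l) (Ys (π l)) h L
    lp = PairPath.long-path R R-sym (Xs l) (Ys (π l))
      (λ v e e′ → X-Y v (∧-snd {U l v} e) (∧-snd {U (π l) v} e′)) h L h≤L (sizeX l Cl) (sizeY (π l) Cπ)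
      (λ p q p⊑ q⊑ → joined l (π l) (edge l dl) Cl Cπ p q (λ v e → ∧-fst (p⊑ v e)) (λ v e → ∧-fst (q⊑ v e)))
      (≤-trans (m≤n+m (suc (8 * h)) g) big)
    module _ (Rch : Fin K → Bool) (r : Reached Rch (π l)) where
      open Reached r
      Hit : Set
      Hit = ∃ λ x → ∃ λ f → X′ x ≡ true × (Xs l f ∧ mem (LongPath.T lp) f) ≡ true × R x f ≡ true
      hit : Hit
      hit = joined (π l) l (Γ-sym l (π l) (edge l dl)) Cπ Cl X′ (λ v → Xs l v ∧ mem (LongPath.T lp) v)
              X′⊑ (λ v e → ∧-fst (∧-fst e)) X′-big (LongPath.T-X lp)
      env : ∀ v → (Fat.W F v ∨ (isZ v ∧ Rch (cls v))) ≡ true → (Fat.W F v ∨ isZ v) ≡ true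
      env v e with ∨-case {Fat.W F v} e
      ... | inj₁ a = ∨-inj₁ a
      ... | inj₂ b = ∨-inj₂ {Fat.W F v} (∧-fst b)
      attach : Hit → Fat (suc s) (g + ℓ) (Rem ∖ sing l)
      attach (x , f , X′x , Tf , Rxf) = use (ends′ x X′x)
        where
        use : _ → Fat (suc s) (g + ℓ) (Rem ∖ sing l)
        use (w , (p , u , len , m) , once) =
          Absorb.absorbed F Rem⊑ l Rl lp x f w Tf Rxf (p , u , len , (λ v mv → env v (m v mv))) once
    step : (∃ λ Rch → Reached Rch (π l)) → Fat (suc s) (g + ℓ) (Rem ∖ sing l)
    step (Rch , r) = attach Rch r (hit Rch r)

  Result : ℕ → Set
  Result ℓ = ∃ λ s → ∃ λ Rem → Fat s ℓ Rem

  loop : ∀ k s ℓ Rem → s + k ≤ t → Rem ⊑ dom → k ≤ # Rem → Fat s ℓ Rem → Result (k * g + ℓ)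
  loop zero    s ℓ Rem le sub enough F = s , Rem , F
  loop (suc k) s ℓ Rem le sub enough F = next (#-pos Rem (≤-trans (s≤s z≤n) enough))
    where
    lem : ∀ k g ℓ → k * g + (g + ℓ) ≡ g + k * g + ℓ
    lem = solve-∀
    next : (∃ λ l → Rem l ≡ true) → Result (suc k * g + ℓ)
    next (l , Rl) = subst Result (lem k g ℓ) (loop k (suc s) (g + ℓ) (Rem ∖ sing l)
      (≤-trans (≤-reflexive (sym (+-suc s k))) le) (λ i e → sub i (∖-fst Rem (sing l) e))
      (s≤s⁻¹ (≤-trans enough (≤-reflexive (#-remove Rem l Rl)))) (absorb F (≤-trans (m≤m+n s (suc k)) le) sub l Rl))

  -- Starting inside a reserve leaves all `X` and `Y` parts intact.
  initial : ∀ a → dom a ≡ true → ∀ X₀ → X₀ ⊑ Zs a → # X₀ ≡ h → Fat 0 0 dom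
  initial a da X₀ X₀⊑ #X₀ = record
    { W = X₀ ; a = a ; X = X₀ ; Ca = dom⊑ a da ; X⊑U = λ v e → ∧-fst (X₀⊑ v e) ; X-big = ≤-reflexive (sym #X₀)
    ; W-Z = λ i → ≤-trans (#-mono (λ v e → ∧-fst e)) (≤-trans (≤-reflexive #X₀) (m≤m+n h 0))
    ; W-X = λ l v _ e → ¬true⇒false (λ e′ → X-Z v (∧-snd {U l v} e) (∧-snd {U a v} (X₀⊑ v e′)))
    ; W-Y = λ l v _ e → ¬true⇒false (λ e′ → Y-Z v (∧-snd {U (π l) v} e) (∧-snd {U a v} (X₀⊑ v e′)))
    ; ends = λ x e → [] , tt , (refl , tt) , z≤n , λ v m → single x v e (mem-∷ {y = x} {[]} m) }
    where
    single : ∀ x v → X₀ x ≡ true → x ≡ v ⊎ mem [] v ≡ true → X₀ v ≡ true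
    single x v e (inj₁ refl) = e

  LongRedPath : ℕ → Set
  LongRedPath ℓ = ∃ λ l → IsPath R l × Uniq l × ℓ ≤ length l

  extract : ∀ {ℓ} → Result ℓ → LongRedPath ℓ
  extract {ℓ} (s , Rem , F) = first (#-pos X (≤-trans 1≤h X-big))
    where
    open Fat F
    last : ∀ {x} → ∃ (PathFrom W ℓ x) → LongRedPath ℓ
    last {x} (w , p , u , len , _) = x ∷ w , p , u , len
    first : (∃ λ x → X x ≡ true) → LongRedPath ℓ
    first (x , Xx) = last (ends x Xx)

  long-red-path : 1 ≤ t → LongRedPath (t * g)
  long-red-path 1≤t = begin-at (#-pos dom (≤-trans 1≤t size))
    where
    begin-at : (∃ λ a → dom a ≡ true) → LongRedPath (t * g)
    begin-at (a , da) = from (#-take (Zs a) h (≤-trans (≤-trans (m≤m+n h (h + (h + 0))) (m≤m+n (3 * h) t)) (sizeZ a (dom⊑ a da))))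
      where
      from : (∃ λ q → q ⊑ Zs a × # q ≡ h) → LongRedPath (t * g)
      from (X₀ , X₀⊑ , #X₀) = extract (subst Result (+-identityʳ (t * g))
        (loop t 0 0 dom ≤-refl (λ _ e → e) size (initial a da X₀ X₀⊑ #X₀)))

-- The partition

rank : ∀ {n} → (Fin n → Bool) → Fin n → ℕ
rank p zero    = 0
rank p (suc x) = ⟦ p zero ⟧ + rank (p ∘ suc) x

rank≤ : ∀ {n} (p : Fin n → Bool) x → rank p x ≤ toℕ x
rank≤ p zero    = z≤n
rank≤ p (suc x) = +-mono-≤ (bit (p zero)) (rank≤ (p ∘ suc) x)
  where
  bit : ∀ b → ⟦ b ⟧ ≤ 1
  bit true  = ≤-refl
  bit false = z≤n

below : ∀ {n} → (Fin n → Bool) → ℕ → Fin n → Bool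
below p m x = p x ∧ (rank p x <ᵇ m)

#-below : ∀ {n} (p : Fin n → Bool) m → # (below p m) ≡ m ⊓ # p
#-below {zero} p m = trans (#-nil (below p m)) (trans (sym (⊓-zeroʳ m)) (cong (m ⊓_) (sym (#-nil p))))
#-below {suc n} p m = trans (#-suc (below p m)) (trans (step (p zero) m) (cong (m ⊓_) (sym (#-suc p))))
  where
  step : ∀ b m → ⟦ b ∧ (0 <ᵇ m) ⟧ + # (λ x → p (suc x) ∧ (⟦ b ⟧ + rank (p ∘ suc) x <ᵇ m)) ≡ m ⊓ (⟦ b ⟧ + # (p ∘ suc))
  step false m       = #-below (p ∘ suc) m
  step true  zero    = #-none (λ x → Bool.∧-zeroʳ (p (suc x)))
  step true  (suc m) = cong suc (#-below (p ∘ suc) m)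

<ᵇ-true : ∀ {a b} → a < b → (a <ᵇ b) ≡ true
<ᵇ-true {zero}  {suc b} _       = refl
<ᵇ-true {suc a} {suc b} (s≤s l) = <ᵇ-true l

true-<ᵇ : ∀ {a b} → (a <ᵇ b) ≡ true → a < b
true-<ᵇ {zero}  {suc b} _ = s≤s z≤n
true-<ᵇ {suc a} {suc b} e = s≤s (true-<ᵇ e)

-- Classes of equal size Q can later be matched with each other one to one.
module Chunks {N A : ℕ} (a : Fin N → Fin A) (B : ℕ) .{{_ : NonZero B}} where

  Q : ℕ
  Q = suc (N / B)

  N<QB : N < Q * B
  N<QB = begin-strict
    N  ≡⟨ m≡m%n+[m/n]*n N B ⟩
    N % B + N / B * B  <⟨ +-monoˡ-< (N / B * B) (m%n<n N B) ⟩
    B + N / B * B  ∎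
    where open ≤-Reasoning

  atom : Fin A → Fin N → Bool
  atom α y = a y == α

  -- Each atom is cut into consecutive runs of `Q` vertices, at most `B` of them since `N < Q * B`;
  -- only its last run can be short.
  idx : Fin N → ℕ
  idx x = rank (atom (a x)) x / Q

  idx<B : ∀ x → idx x < B
  idx<B x = m<n*o⇒m/o<n (≤-<-trans (rank≤ (atom (a x)) x) (<-trans (Fin.toℕ<n x) (subst (N <_) (*-comm Q B) N<QB)))

  chunk : Fin N → Fin (A * B)
  chunk x = Fin.combine (a x) (fromℕ< (idx<B x))

  chunk-refines : ∀ {x y} → chunk x ≡ chunk y → a x ≡ a y
  chunk-refines {x} {y} e = Fin.combine-injectiveˡ (a x) _ (a y) _ e

  class : Fin (A * B) → Fin N → Bool
  class i y = chunk y == i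

  idx-rank : ∀ x {α} → a x ≡ α → idx x ≡ rank (atom α) x / Q
  idx-rank x refl = refl

  module _ (x : Fin N) where
    private
      p = atom (a x)
      β = idx x
      S = # p

    class-split : # (below p (suc β * Q)) ≡ # (below p (β * Q)) + # (class (chunk x))
    class-split = trans (#-split (below p (suc β * Q)) (below p (β * Q))) (cong₂ _+_ (#-cong l) (#-cong r))
      where
      l : ∀ y → (below p (suc β * Q) y ∧ below p (β * Q) y) ≡ below p (β * Q) y
      l y with true? (below p (β * Q) y)
      ... | inj₂ e rewrite e = Bool.∧-zeroʳ _
      ... | inj₁ e rewrite e = ∧-true (∧-true (∧-fst e) (<ᵇ-true (<-≤-trans (true-<ᵇ (∧-snd {p y} e)) (m≤n+m (β * Q) Q)))) refl
      r : ∀ y → (below p (suc β * Q) y ∧ not (below p (β * Q) y)) ≡ class (chunk x) y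
      r y with true? (class (chunk x) y)
      ... | inj₁ e = trans (∧-true (∧-true py (<ᵇ-true up)) (false⇒not (¬true⇒false (λ b → <⇒≱ (true-<ᵇ (∧-snd {p y} b)) lo)))) (sym e)
        where
        ceq : chunk y ≡ chunk x
        ceq = ==⇒≡ {i = chunk y} {chunk x} e
        aeq : a y ≡ a x
        aeq = chunk-refines ceq
        py : p y ≡ true
        py = subst (λ z → (a y == z) ≡ true) aeq (==-refl (a y))
        ieq : idx y ≡ β
        ieq = trans (sym (Fin.toℕ-fromℕ< (idx<B y))) (trans (cong toℕ (Fin.combine-injectiveʳ (a y) (fromℕ< (idx<B y)) (a x) (fromℕ< (idx<B x)) ceq)) (Fin.toℕ-fromℕ< (idx<B x)))
        req : rank p y / Q ≡ β
        req = trans (sym (idx-rank y aeq)) ieq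
        lo : β * Q ≤ rank p y
        lo = subst (λ z → z * Q ≤ rank p y) req (m/n*n≤m (rank p y) Q)
        up : rank p y < suc β * Q
        up = begin-strict
          rank p y  ≡⟨ m≡m%n+[m/n]*n (rank p y) Q ⟩
          rank p y % Q + rank p y / Q * Q  <⟨ +-monoˡ-< _ (m%n<n (rank p y) Q) ⟩
          Q + rank p y / Q * Q  ≡⟨ cong (λ z → Q + z * Q) req ⟩
          suc β * Q  ∎
          where open ≤-Reasoning
      ... | inj₂ e = trans (¬true⇒false (λ h → true≢false (back h) e)) (sym e)
        where
        back : (below p (suc β * Q) y ∧ not (below p (β * Q) y)) ≡ true → class (chunk x) y ≡ true
        back h = subst (λ z → (chunk y == z) ≡ true) same (==-refl (chunk y))
          where
          b₁ = ∧-fst h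
          aeq : a y ≡ a x
          aeq = ==⇒≡ {i = a y} {a x} (∧-fst b₁)
          up : rank p y < suc β * Q
          up = true-<ᵇ (∧-snd {p y} b₁)
          lo : β * Q ≤ rank p y
          lo = ≮⇒≥ (λ lt → true≢false (∧-true (∧-fst b₁) (<ᵇ-true lt)) (not-true (∧-snd {below p (suc β * Q) y} h)))
          ieq : idx y ≡ β
          ieq = trans (idx-rank y aeq) (≤-antisym (s≤s⁻¹ (m<n*o⇒m/o<n up)) (subst (_≤ rank p y / Q) (m*n/n≡m β Q) (/-monoˡ-≤ Q lo)))
          same : chunk y ≡ chunk x
          same = cong₂ Fin.combine aeq (Fin.toℕ-injective (trans (Fin.toℕ-fromℕ< (idx<B y)) (trans ieq (sym (Fin.toℕ-fromℕ< (idx<B x))))))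

    count-eq : (suc β * Q) ⊓ S ≡ (β * Q) ⊓ S + # (class (chunk x))
    count-eq = trans (sym (#-below p (suc β * Q))) (trans class-split (cong (_+ # (class (chunk x))) (#-below p (β * Q))))

    class≤Q′ : # (class (chunk x)) ≤ Q
    class≤Q′ = +-cancelˡ-≤ ((β * Q) ⊓ S) _ _ (≤-trans (≤-reflexive (sym count-eq)) (lem (β * Q)))
      where
      lem : ∀ m → (Q + m) ⊓ S ≤ (m ⊓ S) + Q
      lem m with ≤-total m S
      ... | inj₁ le rewrite m≤n⇒m⊓n≡m le = ≤-trans (m⊓n≤m (Q + m) S) (≤-reflexive (+-comm Q m))
      ... | inj₂ ge rewrite m≥n⇒m⊓n≡n ge = ≤-trans (m⊓n≤n (Q + m) S) (m≤m+n S Q)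

    full-if : suc β * Q ≤ S → # (class (chunk x)) ≡ Q
    full-if le = +-cancelˡ-≡ (β * Q) _ _ (begin
      β * Q + # (class (chunk x))  ≡⟨ cong (_+ # (class (chunk x))) (sym (m≤n⇒m⊓n≡m (≤-trans (m≤n+m (β * Q) Q) le))) ⟩
      (β * Q) ⊓ S + # (class (chunk x))  ≡⟨ sym count-eq ⟩
      (suc β * Q) ⊓ S  ≡⟨ m≤n⇒m⊓n≡m le ⟩
      Q + β * Q  ≡⟨ +-comm Q (β * Q) ⟩
      β * Q + Q  ∎)
      where open ≡-Reasoning

  class≤Q : ∀ i → # (class i) ≤ Q
  class≤Q i with 1 ≤? # (class i)
  ... | no z = ≤-trans (s≤s⁻¹ (≰⇒> z)) z≤n
  ... | yes ne with #-pos (class i) ne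
  ...   | x , e = subst (λ j → # (class j) ≤ Q) (==⇒≡ {i = chunk x} {i} e) (class≤Q′ x)

  full : Fin N → Bool
  full x = does (# (class (chunk x)) ≟ Q)

  -- A vertex that is not among the last `Q` of its atom lies in a complete run.
  few-nonfull : # (λ x → not (full x)) ≤ A * Q
  few-nonfull = ≤-trans (#-⋃ tail _ sub) (≤-trans (∑-mono tail≤) (≤-reflexive (∑-const {A} Q)))
    where
    tail : Fin A → Fin N → Bool
    tail α y = atom α y ∧ not (below (atom α) (# (atom α) ∸ Q) y)
    tail≤ : ∀ α → # (tail α) ≤ Q
    tail≤ α = +-cancelˡ-≤ (S ∸ Q) _ _ (begin
      (S ∸ Q) + # (tail α)  ≡⟨ cong (_+ # (tail α)) (sym (trans (#-below p (S ∸ Q)) (m≤n⇒m⊓n≡m (m∸n≤m S Q)))) ⟩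
      # (below p (S ∸ Q)) + # (tail α)  ≡⟨ cong (_+ # (tail α)) (#-cong same) ⟩
      # (λ y → p y ∧ below p (S ∸ Q) y) + # (tail α)  ≡⟨ sym (#-split p (below p (S ∸ Q))) ⟩
      S  ≤⟨ m≤n+m∸n S Q ⟩
      Q + (S ∸ Q)  ≡⟨ +-comm Q (S ∸ Q) ⟩
      (S ∸ Q) + Q  ∎)
      where
      open ≤-Reasoning
      p = atom α
      S = # p
      same : ∀ y → below p (S ∸ Q) y ≡ (p y ∧ below p (S ∸ Q) y)
      same y with p y
      ... | true  = refl
      ... | false = refl
    sub : ∀ x → not (full x) ≡ true → ∃ λ α → tail α x ≡ true
    sub x e = a x , ∧-true (==-refl (a x)) (false⇒not (¬true⇒false (λ b → does⇒¬ (# (class (chunk x)) ≟ Q) (not-true e) (full-if x (lem b)))))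
      where
      p = atom (a x)
      S = # p
      lem : below p (S ∸ Q) x ≡ true → suc (idx x) * Q ≤ S
      lem b = begin
        Q + idx x * Q  ≤⟨ +-monoʳ-≤ Q (m/n*n≤m (rank p x) Q) ⟩
        Q + rank p x  ≡⟨ +-comm Q (rank p x) ⟩
        rank p x + Q  ≤⟨ <⇒≤ (m<n∸o⇒m+o<n (rank p x) (true-<ᵇ (∧-snd {p x} b))) ⟩
        S  ∎
        where
        open ≤-Reasoning
        m<n∸o⇒m+o<n : ∀ m {n o} → m < n ∸ o → m + o < n
        m<n∸o⇒m+o<n m {n} {o} lt = subst (m + o <_) (m∸n+n≡m {n} {o} (<⇒≤ (m∸n≢0⇒n<m {n} {o} (λ z → <⇒≱ lt (subst (_≤ m) (sym z) z≤n))))) (+-monoˡ-< o lt)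

-- Holes, bad pairs and the refinement

module Holes {N : ℕ} (R : Fin N → Fin N → Bool) {K : ℕ} (c : Fin N → Fin K) (h : ℕ) where

  U : Fin K → Fin N → Bool
  U i x = c x == i

  Hole : Fin K → Fin K → (Fin N → Bool) → (Fin N → Bool) → Set
  Hole i j u w = u ⊑ U i × w ⊑ U j × h ≤ # u × h ≤ # w × (∀ x y → u x ≡ true → w y ≡ true → R x y ≡ false)

  HasHole : Fin K → Fin K → Set
  HasHole i j = ∃ λ u → ∃ λ w → Hole i j u w

  opaque
    hole? : ∀ i j → Dec (HasHole i j)
    hole? i j = any-set? respU (λ u → any-set? (respW u) (λ w →
        sub? u (U i) ×-dec sub? w (U j) ×-dec (h ≤? # u) ×-dec (h ≤? # w) ×-dec
        Fin.all? (λ x → Fin.all? (λ y → (u x Bool.≟ true) →-dec ((w y Bool.≟ true) →-dec (R x y Bool.≟ false))))))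
      where
      sub? : ∀ (p q : Fin N → Bool) → Dec (p ⊑ q)
      sub? p q = Fin.all? (λ x → (p x Bool.≟ true) →-dec (q x Bool.≟ true))
      respW : ∀ u {p q} → (∀ x → p x ≡ q x) → Hole i j u p → Hole i j u q
      respW u e (a , b , c′ , d , f) = a , (λ x q → b x (trans (e x) q)) , c′ , subst (h ≤_) (#-cong e) d ,
        (λ x y p q → f x y p (trans (e y) q))
      respU : ∀ {p q} → (∀ x → p x ≡ q x) → (∃ λ w → Hole i j p w) → ∃ λ w → Hole i j q w
      respU e (w , a , b , c′ , d , f) = w , (λ x q → a x (trans (e x) q)) , b , subst (h ≤_) (#-cong e) c′ , d ,
        (λ x y p q → f x y (trans (e x) p) q)

  nonempty : Fin K → Fin K → Bool
  nonempty i j = any (λ x → any (λ y → U i x ∧ (U j y ∧ R x y)))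

  nonempty-intro : ∀ x y → R x y ≡ true → nonempty (c x) (c y) ≡ true
  nonempty-intro x y r = any-intro (λ x′ → any (λ y′ → U (c x) x′ ∧ (U (c y) y′ ∧ R x′ y′))) x
    (any-intro (λ y′ → U (c x) x ∧ (U (c y) y′ ∧ R x y′)) y (∧-true (==-refl (c x)) (∧-true (==-refl (c y)) r)))

  nonempty-elim : ∀ i j → nonempty i j ≡ true → ∃ λ x → ∃ λ y → c x ≡ i × c y ≡ j × R x y ≡ true
  nonempty-elim i j e with any-elim (λ x → any (λ y → U i x ∧ (U j y ∧ R x y))) e
  ... | x , e₁ with any-elim (λ y → U i x ∧ (U j y ∧ R x y)) e₁
  ...   | y , e₂ = x , y , ==⇒≡ {i = c x} {i} (∧-fst e₂) , ==⇒≡ {i = c y} {j} (∧-fst (∧-snd {U i x} e₂)) , ∧-snd {U j y} (∧-snd {U i x} e₂)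

  -- Pairs that serve neither side: the hole spoils them for red paths, the red edge for the blue
  -- embedding. The diagonal is left out, as different colour classes are placed in different
  -- clusters.
  bad : Fin K → Fin K → Bool
  bad i j = not (i == j) ∧ (does (hole? i j) ∧ nonempty i j)

  #bad : ℕ
  #bad = ∑ (λ x → # (λ y → bad (c x) (c y)))

  -- The potential of the refinement, in the role that mean square density has for regularity.
  φ : ℕ
  φ = ∑ (λ x → # (λ y → not (nonempty (c x) (c y))))

  holeU holeW : Fin K → Fin K → Fin N → Bool
  holeU i j with hole? i j
  ... | yes (u , _) = u
  ... | no _        = ∅
  holeW i j with hole? i j
  ... | yes (_ , w , _) = w
  ... | no _            = ∅

  hole-spec : ∀ i j → does (hole? i j) ≡ true → Hole i j (holeU i j) (holeW i j)
  hole-spec i j e with hole? i j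
  ... | yes (_ , _ , s) = s

  holeU⊑ : ∀ i j → holeU i j ⊑ U i
  holeU⊑ i j x e with hole? i j
  ... | yes (_ , _ , s , _) = s x e

  holeW⊑ : ∀ i j → holeW i j ⊑ U j
  holeW⊑ i j x e with hole? i j
  ... | yes (_ , _ , _ , s , _) = s x e

  -- The vertex pairs inside the selected holes of bad pairs, which the next refinement adds to `φ`.
  area : Fin N → Fin N → Bool
  area x y = bad (c x) (c y) ∧ (holeU (c x) (c y) x ∧ holeW (c x) (c y) y)

  #area : ℕ
  #area = ∑ (λ x → # (area x))

  #bad-sum : #bad ≡ ∑ (λ i → ∑ (λ j → ⟦ bad i j ⟧ * (# (U i) * # (U j))))
  #bad-sum = begin
    ∑ (λ x → # (λ y → bad (c x) (c y)))  ≡⟨ ∑-fibre c (λ i → # (λ y → bad i (c y))) ⟩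
    ∑ (λ i → # (U i) * # (λ y → bad i (c y)))  ≡⟨ ∑-cong (λ i → cong (# (U i) *_) (trans (#-∑ _) (∑-fibre c (λ j → ⟦ bad i j ⟧)))) ⟩
    ∑ (λ i → # (U i) * ∑ (λ j → # (U j) * ⟦ bad i j ⟧)) ≡⟨ ∑-cong (λ i → sym (∑-*ˡ (# (U i)) _)) ⟩
    ∑ (λ i → ∑ (λ j → # (U i) * (# (U j) * ⟦ bad i j ⟧))) ≡⟨ ∑-cong (λ i → ∑-cong (λ j → lem (# (U i)) (# (U j)) ⟦ bad i j ⟧)) ⟩
    ∑ (λ i → ∑ (λ j → ⟦ bad i j ⟧ * (# (U i) * # (U j)))) ∎
    where
    open ≡-Reasoning
    lem : ∀ a b c → a * (b * c) ≡ c * (a * b)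
    lem = solve-∀

  cell : Fin K → Fin K → Fin N → Fin N → ℕ
  cell i j x y = ⟦ bad i j ⟧ * (⟦ holeU i j x ⟧ * ⟦ holeW i j y ⟧)

  ⟦⟧-∧ : ∀ a b → ⟦ a ∧ b ⟧ ≡ ⟦ a ⟧ * ⟦ b ⟧
  ⟦⟧-∧ true  b = sym (+-identityʳ ⟦ b ⟧)
  ⟦⟧-∧ false b = refl

  ⟦⟧-absorb : ∀ {a b} → (b ≡ true → a ≡ true) → ⟦ b ⟧ ≡ ⟦ a ⟧ * ⟦ b ⟧
  ⟦⟧-absorb {a} {true}  f rewrite f refl = refl
  ⟦⟧-absorb {a} {false} f = sym (*-zeroʳ ⟦ a ⟧)

  cell-pick : ∀ x y → ∑ (λ i → ∑ (λ j → cell i j x y)) ≡ ⟦ area x y ⟧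
  cell-pick x y = begin
    ∑ (λ i → ∑ (λ j → cell i j x y))  ≡⟨ ∑-cong (λ i → ∑-cong (λ j → spread i j)) ⟩
    ∑ (λ i → ∑ (λ j → ⟦ c x == i ⟧ * (⟦ c y == j ⟧ * cell i j x y))) ≡⟨ ∑-cong (λ i → ∑-*ˡ ⟦ c x == i ⟧ _) ⟩
    ∑ (λ i → ⟦ c x == i ⟧ * ∑ (λ j → ⟦ c y == j ⟧ * cell i j x y)) ≡⟨ ∑-pick (c x) (λ i → ∑ (λ j → ⟦ c y == j ⟧ * cell i j x y)) ⟩
    ∑ (λ j → ⟦ c y == j ⟧ * cell (c x) j x y)  ≡⟨ ∑-pick (c y) (λ j → cell (c x) j x y) ⟩
    cell (c x) (c y) x y  ≡⟨ cong (⟦ bad (c x) (c y) ⟧ *_) (sym (⟦⟧-∧ (holeU (c x) (c y) x) _)) ⟩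
    ⟦ bad (c x) (c y) ⟧ * ⟦ holeU (c x) (c y) x ∧ holeW (c x) (c y) y ⟧ ≡⟨ sym (⟦⟧-∧ (bad (c x) (c y)) _) ⟩
    ⟦ area x y ⟧  ∎
    where
    open ≡-Reasoning
    lem : ∀ a b s t u → s * ((a * t) * (b * u)) ≡ a * (b * (s * (t * u)))
    lem = solve-∀
    spread : ∀ i j → cell i j x y ≡ ⟦ c x == i ⟧ * (⟦ c y == j ⟧ * cell i j x y)
    spread i j = trans (cong (⟦ bad i j ⟧ *_) (cong₂ _*_ (⟦⟧-absorb (holeU⊑ i j x)) (⟦⟧-absorb (holeW⊑ i j y))))
                       (lem ⟦ c x == i ⟧ ⟦ c y == j ⟧ ⟦ bad i j ⟧ ⟦ holeU i j x ⟧ ⟦ holeW i j y ⟧)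

  #area-sum : #area ≡ ∑ (λ i → ∑ (λ j → ⟦ bad i j ⟧ * (# (holeU i j) * # (holeW i j))))
  #area-sum = begin
    ∑ (λ x → # (area x))  ≡⟨ ∑-cong (λ x → trans (#-∑ (area x)) (∑-cong (λ y → sym (cell-pick x y)))) ⟩
    ∑ (λ x → ∑ (λ y → ∑ (λ i → ∑ (λ j → cell i j x y))))  ≡⟨ ∑-cong (λ x → ∑-swap (λ y i → ∑ (λ j → cell i j x y))) ⟩
    ∑ (λ x → ∑ (λ i → ∑ (λ y → ∑ (λ j → cell i j x y))))  ≡⟨ ∑-swap (λ x i → ∑ (λ y → ∑ (λ j → cell i j x y))) ⟩
    ∑ (λ i → ∑ (λ x → ∑ (λ y → ∑ (λ j → cell i j x y))))  ≡⟨ ∑-cong (λ i → ∑-cong (λ x → ∑-swap (λ y j → cell i j x y))) ⟩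
    ∑ (λ i → ∑ (λ x → ∑ (λ j → ∑ (λ y → cell i j x y))))  ≡⟨ ∑-cong (λ i → ∑-swap (λ x j → ∑ (λ y → cell i j x y))) ⟩
    ∑ (λ i → ∑ (λ j → ∑ (λ x → ∑ (λ y → cell i j x y))))  ≡⟨ ∑-cong (λ i → ∑-cong (λ j → inner i j)) ⟩
    ∑ (λ i → ∑ (λ j → ⟦ bad i j ⟧ * (# (holeU i j) * # (holeW i j)))) ∎
    where
    open ≡-Reasoning
    inner : ∀ i j → ∑ (λ x → ∑ (λ y → cell i j x y)) ≡ ⟦ bad i j ⟧ * (# (holeU i j) * # (holeW i j))
    inner i j = begin
      ∑ (λ x → ∑ (λ y → cell i j x y))  ≡⟨ ∑-cong (λ x → trans (∑-*ˡ ⟦ bad i j ⟧ _) (cong (⟦ bad i j ⟧ *_) (∑-*ˡ ⟦ holeU i j x ⟧ _))) ⟩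
      ∑ (λ x → ⟦ bad i j ⟧ * (⟦ holeU i j x ⟧ * ∑ (λ y → ⟦ holeW i j y ⟧))) ≡⟨ ∑-*ˡ ⟦ bad i j ⟧ _ ⟩
      ⟦ bad i j ⟧ * ∑ (λ x → ⟦ holeU i j x ⟧ * ∑ (λ y → ⟦ holeW i j y ⟧))  ≡⟨ cong (⟦ bad i j ⟧ *_) (∑-*ʳ _ _) ⟩
      ⟦ bad i j ⟧ * (∑ (λ x → ⟦ holeU i j x ⟧) * ∑ (λ y → ⟦ holeW i j y ⟧)) ≡⟨ cong (⟦ bad i j ⟧ *_) (cong₂ _*_ (sym (#-∑ (holeU i j))) (sym (#-∑ (holeW i j)))) ⟩
      ⟦ bad i j ⟧ * (# (holeU i j) * # (holeW i j))  ∎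

  bad⇒hole : ∀ {i j} → bad i j ≡ true → does (hole? i j) ≡ true
  bad⇒hole {i} {j} e = ∧-fst (∧-snd {not (i == j)} e)

  bad⇒nonempty : ∀ {i j} → bad i j ≡ true → nonempty i j ≡ true
  bad⇒nonempty {i} {j} e = ∧-snd {does (hole? i j)} (∧-snd {not (i == j)} e)

  -- Each side of a hole is at least the fraction `1 / E` of its class.
  bad≤area : ∀ Q E → Q ≤ E * h → (∀ i → # (U i) ≤ Q) → #bad ≤ E * E * #area
  bad≤area Q E Q≤ small = begin
    #bad  ≡⟨ #bad-sum ⟩
    ∑ (λ i → ∑ (λ j → ⟦ bad i j ⟧ * (# (U i) * # (U j))))  ≤⟨ ∑-mono (λ i → ∑-mono (λ j → term i j)) ⟩
    ∑ (λ i → ∑ (λ j → E * E * (⟦ bad i j ⟧ * (# (holeU i j) * # (holeW i j))))) ≡⟨ ∑-cong (λ i → ∑-*ˡ (E * E) _) ⟩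
    ∑ (λ i → E * E * ∑ (λ j → ⟦ bad i j ⟧ * (# (holeU i j) * # (holeW i j)))) ≡⟨ ∑-*ˡ (E * E) _ ⟩
    E * E * ∑ (λ i → ∑ (λ j → ⟦ bad i j ⟧ * (# (holeU i j) * # (holeW i j)))) ≡⟨ cong (E * E *_) (sym #area-sum) ⟩
    E * E * #area  ∎
    where
    open ≤-Reasoning
    term : ∀ i j → ⟦ bad i j ⟧ * (# (U i) * # (U j)) ≤ E * E * (⟦ bad i j ⟧ * (# (holeU i j) * # (holeW i j)))
    term i j with true? (bad i j)
    ... | inj₂ e rewrite e = z≤n
    ... | inj₁ e rewrite e with hole-spec i j (bad⇒hole e)
    ...   | _ , _ , hu , hw , _ = begin
      # (U i) * # (U j) + 0  ≡⟨ +-identityʳ _ ⟩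
      # (U i) * # (U j)  ≤⟨ *-mono-≤ (≤-trans (small i) (≤-trans Q≤ (*-monoʳ-≤ E hu))) (≤-trans (small j) (≤-trans Q≤ (*-monoʳ-≤ E hw))) ⟩
      E * # (holeU i j) * (E * # (holeW i j))  ≡⟨ lem E (# (holeU i j)) (# (holeW i j)) ⟩
      E * E * (# (holeU i j) * # (holeW i j) + 0)  ∎
      where
      lem : ∀ e a b → e * a * (e * b) ≡ e * e * (a * b + 0)
      lem = solve-∀

  φ≤ : φ ≤ N * N
  φ≤ = ≤-trans (∑-mono (λ x → #≤n _)) (≤-reflexive (∑-const {N} N))

  bit : Bool → Fin 2
  bit true  = suc zero
  bit false = zero

  bit-inj : ∀ {a b} → bit a ≡ bit b → a ≡ b
  bit-inj {true}  {true}  e = refl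
  bit-inj {false} {false} e = refl

  code₁ : Fin N → Fin K → Fin K → Fin (2 * 2)
  code₁ x i j = Fin.combine (bit (holeU i j x)) (bit (holeW i j x))

  -- Records in which selected holes `x` lies, for all pairs `i`, `j`. Being an element of a `Fin`
  -- whose size depends on `K` only, it bounds the number of atoms independently of `N`.
  code : Fin N → Fin (((2 * 2) ^ K) ^ K)
  code x = Fin.funToFin (λ i → Fin.funToFin (code₁ x i))

  funToFin-inj : ∀ {m n} (f g : Fin m → Fin n) → Fin.funToFin f ≡ Fin.funToFin g → ∀ i → f i ≡ g i
  funToFin-inj f g e i = trans (sym (Fin.finToFun-funToFin f i)) (trans (cong (λ z → Fin.finToFun z i) e) (Fin.finToFun-funToFin g i))

  code-inj : ∀ {x y} → code x ≡ code y → ∀ i j → holeU i j x ≡ holeU i j y × holeW i j x ≡ holeW i j y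
  code-inj {x} {y} e i j =
    bit-inj (Fin.combine-injectiveˡ (bit (holeU i j x)) (bit (holeW i j x)) (bit (holeU i j y)) (bit (holeW i j y)) e′) ,
    bit-inj (Fin.combine-injectiveʳ (bit (holeU i j x)) (bit (holeW i j x)) (bit (holeU i j y)) (bit (holeW i j y)) e′)
    where
    e′ : code₁ x i j ≡ code₁ y i j
    e′ = funToFin-inj (code₁ x i) (code₁ y i)
           (funToFin-inj (λ i → Fin.funToFin (code₁ x i)) (λ i → Fin.funToFin (code₁ y i)) e i) j

  atoms : Fin N → Fin (K * ((2 * 2) ^ K) ^ K)
  atoms x = Fin.combine (c x) (code x)

  atoms-c : ∀ {x y} → atoms x ≡ atoms y → c x ≡ c y
  atoms-c {x} {y} e = Fin.combine-injectiveˡ (c x) (code x) (c y) (code y) e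

  atoms-code : ∀ {x y} → atoms x ≡ atoms y → code x ≡ code y
  atoms-code {x} {y} e = Fin.combine-injectiveʳ (c x) (code x) (c y) (code y) e

-- Refining along the holes of all bad pairs makes these holes empty pairs of classes.
gain : ∀ {N} (R : Fin N → Fin N → Bool) {K} (c : Fin N → Fin K) h {K′} (c′ : Fin N → Fin K′) h′ →
       (∀ {x y} → c′ x ≡ c′ y → Holes.atoms R c h x ≡ Holes.atoms R c h y) →
       Holes.φ R c h + Holes.#area R c h ≤ Holes.φ R c′ h′
gain {N} R c h c′ h′ refines = ≤-trans (≤-reflexive (sym (∑-+ _ _))) (∑-mono (λ x →
    ≤-trans (≤-reflexive (trans (cong₂ _+_ (#-∑ _) (#-∑ _)) (sym (∑-+ _ _)))) (≤-trans (∑-mono (point x)) (≤-reflexive (sym (#-∑ _))))))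
  where
  module A = Holes R c h
  module B = Holes R c′ h′
  inherit : ∀ x y → B.nonempty (c′ x) (c′ y) ≡ true → A.nonempty (c x) (c y) ≡ true × (A.area x y ≡ true → ⊥)
  inherit x y e with B.nonempty-elim (c′ x) (c′ y) e
  ... | x′ , y′ , ex , ey , r = subst₂ (λ i j → A.nonempty i j ≡ true) cx cy (A.nonempty-intro x′ y′ r) , noArea
    where
    cx : c x′ ≡ c x
    cx = A.atoms-c (refines ex)
    cy : c y′ ≡ c y
    cy = A.atoms-c (refines ey)
    -- The ends of the red edge `x′ y′` lie in the same holes as `x` and `y`, so a hole around `x`
    -- and `y` would contain this edge.
    noArea : A.area x y ≡ true → ⊥
    noArea ar = true≢false r (proj₂ (proj₂ (proj₂ (proj₂ (A.hole-spec (c x) (c y) (A.bad⇒hole (∧-fst ar))))))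
      x′ y′ (trans (proj₁ (A.code-inj (A.atoms-code (refines ex)) (c x) (c y))) (∧-fst (∧-snd {A.bad (c x) (c y)} ar)))
            (trans (proj₂ (A.code-inj (A.atoms-code (refines ey)) (c x) (c y))) (∧-snd {A.holeU (c x) (c y) x} (∧-snd {A.bad (c x) (c y)} ar))))
  point : ∀ x y → ⟦ not (A.nonempty (c x) (c y)) ⟧ + ⟦ A.area x y ⟧ ≤ ⟦ not (B.nonempty (c′ x) (c′ y)) ⟧
  point x y with true? (B.nonempty (c′ x) (c′ y)) | inherit x y
  ... | inj₁ e | f = ≤-trans (≤-reflexive (cong₂ (λ a b → ⟦ not a ⟧ + ⟦ b ⟧) (proj₁ (f e)) (¬true⇒false (proj₂ (f e))))) z≤n
  ... | inj₂ e | _ = ≤-trans (disjoint (A.nonempty (c x) (c y)) (A.area x y) (λ ar → A.bad⇒nonempty (∧-fst ar)))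
                             (≤-reflexive (sym (cong (λ b → ⟦ not b ⟧) e)))
    where
    disjoint : ∀ a b → (b ≡ true → a ≡ true) → ⟦ not a ⟧ + ⟦ b ⟧ ≤ 1
    disjoint true  true  _ = ≤-refl
    disjoint true  false _ = z≤n
    disjoint false false _ = ≤-refl
    disjoint false true  f with f refl
    ... | ()

nextA : ℕ → ℕ
nextA K = K * ((2 * 2) ^ K) ^ K

-- Of tower type, but independent of `N`: a round cuts `A` atoms into `A * (A * H)` classes, whose
-- holes produce the `nextA` atoms of the next round.
Kbound : ℕ → ℕ → ℕ → ℕ
Kbound H zero       A = A * (A * H)
Kbound H (suc fuel) A = A * (A * H) + Kbound H fuel (nextA (A * (A * H)))

-- A substitute for Szemerédi's regularity lemma: almost all pairs of classes are either free of
-- red edges or have no h × h hole, h being about Q / suc e.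
record Partition {N : ℕ} (R : Fin N → Fin N → Bool) (e b H bound : ℕ) : Set where
  field
    K B Q    : ℕ
    c        : Fin N → Fin K
    B≤       : B ≤ bound
    N<QB     : N < Q * B
    QB≤      : Q * B ≤ N + B
    H≤B      : H ≤ B
    class≤Q  : ∀ i → # (λ x → c x == i) ≤ Q
    nonfull  : H * # (λ x → not (does (# (λ y → c y == c x) ≟ Q))) ≤ N + B
    few-bad  : b * Holes.#bad R c (suc (Q / suc e)) ≤ N * N

-- While there are too many bad pairs, `N * N < b * #bad ≤ T * #area`, so refining raises `φ` by at
-- least `N * N / T`. As `φ ≤ N * N`, this cannot happen `suc T` times.
partition : ∀ {N} (R : Fin N → Fin N → Bool) e b H → 1 ≤ H → 1 ≤ N →
            Partition R e b H (Kbound H (suc (b * (suc e * suc e))) 1)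
partition {N} R e b H 1≤H 1≤N = run (suc T) 0 refl 1 ≤-refl (λ _ → zero) (λ _ _ _ → z≤n)
  where
  E T : ℕ
  E = suc e
  T = b * (E * E)
  Q≤ : ∀ Q → Q ≤ E * suc (Q / E)
  Q≤ Q = begin
    Q  ≡⟨ m≡m%n+[m/n]*n Q E ⟩
    Q % E + Q / E * E  ≤⟨ +-monoˡ-≤ (Q / E * E) (<⇒≤ (m%n<n Q E)) ⟩
    E + Q / E * E  ≡⟨ *-comm (suc (Q / E)) E ⟩
    E * suc (Q / E)  ∎
    where open ≤-Reasoning
  -- progress j means that φ has grown by at least j / T of N².
  progress : ℕ → ∀ {A} → (Fin N → Fin A) → Set
  progress j {A} a = ∀ {K} (c : Fin N → Fin K) h → (∀ {x y} → c x ≡ c y → a x ≡ a y) → j * (N * N) ≤ Holes.φ R c h * T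
  exceeded : ∀ {φ} → φ ≤ N * N → suc T * (N * N) ≤ φ * T → ⊥
  exceeded {φ} le le′ = <-irrefl refl (begin-strict
    T * (N * N)  <⟨ +-monoˡ-< (T * (N * N)) (*-mono-≤ 1≤N 1≤N) ⟩
    suc T * (N * N)  ≤⟨ le′ ⟩
    φ * T  ≤⟨ *-monoˡ-≤ T le ⟩
    N * N * T  ≡⟨ *-comm (N * N) T ⟩
    T * (N * N)  ∎)
    where open ≤-Reasoning
  module Step {A} (1≤A : 1 ≤ A) (a : Fin N → Fin A) where
    B : ℕ
    B = A * H
    instance
      B≢0 : NonZero B
      B≢0 = >-nonZero (*-mono-≤ 1≤A 1≤H)
    open Chunks a B public
    h = suc (Q / E)
    module Hl = Holes R chunk h
    B≤K : B ≤ A * B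
    B≤K = ≤-trans (≤-reflexive (sym (+-identityʳ B))) (*-monoˡ-≤ B 1≤A)
    QB≤ : Q * B ≤ N + B
    QB≤ = ≤-trans (≤-reflexive (+-comm B (N / B * B))) (+-monoˡ-≤ B (m/n*n≤m N B))
    H≤B : H ≤ B
    H≤B = ≤-trans (≤-reflexive (sym (+-identityʳ H))) (*-monoˡ-≤ H 1≤A)
    nonfull : H * # (λ x → not (full x)) ≤ N + B
    nonfull = ≤-trans (*-monoʳ-≤ H few-nonfull) (≤-trans (≤-reflexive (lem H A Q)) QB≤)
      where
      lem : ∀ h a q → h * (a * q) ≡ q * (a * h)
      lem = solve-∀
    done : ∀ {bound} → A * B ≤ bound → b * Hl.#bad ≤ N * N → Partition R e b H bound
    done le few = record
      { K = A * B ; B = B ; Q = Q ; c = chunk ; B≤ = ≤-trans B≤K le ; N<QB = N<QB ; QB≤ = QB≤ ; H≤B = H≤B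
      ; class≤Q = class≤Q ; nonfull = nonfull ; few-bad = few }
    further : ∀ j → j * (N * N) ≤ Hl.φ * T → ¬ (b * Hl.#bad ≤ N * N) → progress (suc j) Hl.atoms
    further j φj many c′ h′ refines = begin
      N * N + j * (N * N)  ≤⟨ +-mono-≤ (≤-trans (<⇒≤ (≰⇒> many)) (*-monoʳ-≤ b (Hl.bad≤area Q E (Q≤ Q) class≤Q))) φj ⟩
      b * (E * E * Hl.#area) + Hl.φ * T  ≡⟨ lem b (E * E) Hl.#area Hl.φ ⟩
      (Hl.φ + Hl.#area) * T  ≤⟨ *-monoˡ-≤ T (gain R chunk h c′ h′ refines) ⟩
      Holes.φ R c′ h′ * T  ∎
      where
      open ≤-Reasoning
      lem : ∀ b ee a f → b * (ee * a) + f * (b * ee) ≡ (f + a) * (b * ee)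
      lem = solve-∀
  1≤nextA : ∀ K → 1 ≤ K → 1 ≤ nextA K
  1≤nextA K le = *-mono-≤ le (m^n>0 ((2 * 2) ^ K) {{>-nonZero (m^n>0 4 K)}} K)
  run : ∀ fuel j → j + fuel ≡ suc T → ∀ A → 1 ≤ A → (a : Fin N → Fin A) → progress j a → Partition R e b H (Kbound H fuel A)
  -- `φ` is the same for every hole size, so `0` serves as well as any.
  run zero j eq A 1≤A a pr = ⊥-elim (exceeded (Holes.φ≤ R a 0) (subst (λ k → k * (N * N) ≤ Holes.φ R a 0 * T) (trans (sym (+-identityʳ j)) eq) (pr a 0 id)))
  run (suc fuel) j eq A 1≤A a pr = decide (b * Step.Hl.#bad 1≤A a ≤? N * N)
    where
    module S = Step 1≤A a
    decide : Dec (b * S.Hl.#bad ≤ N * N) → Partition R e b H (Kbound H (suc fuel) A)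
    decide (yes few) = S.done (m≤m+n _ _) few
    decide (no many) = weaken (run fuel (suc j) (trans (sym (+-suc j fuel)) eq) (nextA (A * S.B)) (1≤nextA _ (*-mono-≤ 1≤A (≤-trans 1≤H S.H≤B)))
                          S.Hl.atoms (S.further j (pr S.chunk S.h S.chunk-refines) many))
      where
      weaken : Partition R e b H (Kbound H fuel (nextA (A * S.B))) → Partition R e b H (Kbound H (suc fuel) A)
      weaken p = record { K = K ; B = B ; Q = Q ; c = c ; B≤ = ≤-trans B≤ (m≤n+m _ _) ; N<QB = N<QB ; QB≤ = QB≤
                        ; H≤B = H≤B ; class≤Q = class≤Q ; nonfull = nonfull ; few-bad = few-bad }
        where open Partition p

-- Embedding a graph of bounded degree

module Embedding {n N k : ℕ} (G : Graph n) (simple : IsSimple G) (Δ : ℕ) (deg : MaxDegreeAtMost G Δ)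
  (col : Fin n → Fin k) (proper : IsProperColouring G col)
  (R : Fin N → Fin N → Bool) (W : Fin k → Fin N → Bool) (D : ℕ) (y₀ : Fin N)
  (W-disj : ∀ i j x → W i x ≡ true → W j x ≡ true → i ≡ j)
  (sparse : ∀ i j x → i ≢ j → W i x ≡ true → # (λ y → W j y ∧ R x y) ≤ D)
  (roomy : ∀ j → # (λ v → col v == j) + Δ * D ≤ # (W j))
  where

  ok : Fin n → Fin N → Bool
  ok g y = W (col g) y

  -- Equality of images has to be forbidden only within a colour class, the sets `W` being disjoint.
  conf : Fin n → Fin N → Fin n → Fin N → Bool
  conf g′ y′ g y = ((col g′ == col g) ∧ (y′ == y)) ∨ (G g′ g ∧ R y′ y)

  -- Earlier vertices of the same colour block one vertex each, and `g` itself is not among them;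
  -- each of the at most `Δ` neighbours blocks at most `D` by its red edges.
  few : ∀ g (f : Fin n → Fin N) → (∀ g′ → toℕ g′ < toℕ g → ok g′ (f g′) ≡ true) →
        ∑ (λ g′ → # (λ y → ok g y ∧ (g′ <ᶠ g) ∧ conf g′ (f g′) g y)) < # (ok g)
  few g f okf = begin-strict
    ∑ (λ g′ → # (λ y → ok g y ∧ (g′ <ᶠ g) ∧ conf g′ (f g′) g y))  ≤⟨ ∑-mono bound ⟩
    ∑ (λ g′ → ⟦ earlier g′ ⟧ + ⟦ G g g′ ⟧ * D)  ≡⟨ ∑-+ _ _ ⟩
    ∑ (λ g′ → ⟦ earlier g′ ⟧) + ∑ (λ g′ → ⟦ G g g′ ⟧ * D) ≡⟨ cong₂ _+_ (sym (#-∑ earlier)) (trans (∑-*ʳ _ D) (cong (_* D) (sym (#-∑ (G g))))) ⟩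
    # earlier + # (G g) * D  ≡⟨ cong (λ z → # earlier + z * D) (sym (degree-# G g)) ⟩
    # earlier + degree G g * D  ≤⟨ +-monoʳ-≤ (# earlier) (*-monoˡ-≤ D (deg g)) ⟩
    # earlier + Δ * D  <⟨ +-monoˡ-< (Δ * D) earlier< ⟩
    # (λ v → col v == col g) + Δ * D  ≤⟨ roomy (col g) ⟩
    # (ok g)  ∎
    where
    open ≤-Reasoning
    earlier : Fin n → Bool
    earlier g′ = (col g′ == col g) ∧ (g′ <ᶠ g)
    earlier< : # earlier < # (λ v → col v == col g)
    earlier< = ≤-trans (s≤s (#-mono sub)) (≤-reflexive (sym (#-remove (λ v → col v == col g) g (==-refl (col g)))))
      where
      sub : earlier ⊑ ((λ v → col v == col g) ∖ sing g)
      sub v e = ∖-in (λ v → col v == col g) (sing g) (∧-fst e) (¬true⇒false (λ s → lem (==⇒≡ {i = g} {v} s)))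
        where
        lem : g ≡ v → ⊥
        lem refl = <-irrefl refl (<ᶠ⇒ {i = g} {g} (∧-snd {col g == col g} e))
    bound : ∀ g′ → # (λ y → ok g y ∧ (g′ <ᶠ g) ∧ conf g′ (f g′) g y) ≤ ⟦ earlier g′ ⟧ + ⟦ G g g′ ⟧ * D
    bound g′ with true? (g′ <ᶠ g)
    ... | inj₂ later = ≤-trans (≤-reflexive (#-none (λ y → ¬true⇒false (λ e → true≢false (∧-fst (∧-snd {ok g y} e)) later)))) z≤n
    ... | inj₁ lt = ≤-trans (#-cover cov) (+-mono-≤ same nbr)
      where
      cov : ∀ y → (ok g y ∧ (g′ <ᶠ g) ∧ conf g′ (f g′) g y) ≡ true →
            ((col g′ == col g) ∧ (f g′ == y)) ≡ true ⊎ (ok g y ∧ (G g′ g ∧ R (f g′) y)) ≡ true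
      cov y e with ∨-case {(col g′ == col g) ∧ (f g′ == y)} (∧-snd {g′ <ᶠ g} (∧-snd {ok g y} e))
      ... | inj₁ a = inj₁ a
      ... | inj₂ b = inj₂ (∧-true (∧-fst {ok g y} e) b)
      same : # (λ y → (col g′ == col g) ∧ (f g′ == y)) ≤ ⟦ earlier g′ ⟧
      same with true? (col g′ == col g)
      ... | inj₁ e = ≤-trans (#-mono (λ y h → ∧-snd {col g′ == col g} h)) (≤-trans (≤-reflexive (#-single (f g′))) (≤-reflexive (sym (⟦⟧-true (∧-true e lt)))))
      ... | inj₂ e = ≤-trans (≤-reflexive (#-none (λ y → ¬true⇒false (λ h → true≢false (∧-fst h) e)))) z≤n
      nbr : # (λ y → ok g y ∧ (G g′ g ∧ R (f g′) y)) ≤ ⟦ G g g′ ⟧ * D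
      nbr with true? (G g g′)
      ... | inj₁ e = ≤-trans (#-mono (λ y h → ∧-true (∧-fst h) (∧-snd {G g′ g} (∧-snd {ok g y} h))))
                     (≤-trans (sparse (col g′) (col g) (f g′) (proper g′ g (trans (proj₁ simple g′ g) e)) (okf g′ (<ᶠ⇒ {i = g′} {g} lt)))
                       (≤-reflexive (trans (sym (+-identityʳ D)) (cong (_* D) (sym (⟦⟧-true e))))))
      ... | inj₂ e = ≤-trans (≤-reflexive (#-none (λ y → ¬true⇒false (λ h → true≢false (∧-fst (∧-snd {ok g y} h)) (trans (proj₁ simple g′ g) e))))) z≤n

  module Gr = Greedy y₀ ok conf few

  -- Clashes are tested from the earlier vertex to the later one only, hence the alternative in the
  -- conclusion.
  embedding : ∃ λ (f : Fin n → Fin N) → Injective _≡_ _≡_ f × (∀ i j → G i j ≡ true → R (f i) (f j) ≡ false ⊎ R (f j) (f i) ≡ false)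
  embedding = f , inj , edge
    where
    f = proj₁ Gr.greedy
    f-ok = proj₁ (proj₂ Gr.greedy)
    f-conf = proj₂ (proj₂ Gr.greedy)
    distinct : ∀ i j → toℕ i < toℕ j → f i ≢ f j
    distinct i j lt e = true≢false (∨-inj₁ (∧-true (trans (cong (_== col j) same) (==-refl (col j))) (trans (cong (_== f j) e) (==-refl (f j))))) (f-conf i j lt)
      where
      same : col i ≡ col j
      same = W-disj (col i) (col j) (f i) (f-ok i) (subst (λ z → W (col j) z ≡ true) (sym e) (f-ok j))
    inj : Injective _≡_ _≡_ f
    inj {i} {j} e with <-cmp (toℕ i) (toℕ j)
    ... | tri< lt _ _ = ⊥-elim (distinct i j lt e)
    ... | tri> _ _ lt = ⊥-elim (distinct j i lt (sym e))
    ... | tri≈ _ eq _ = Fin.toℕ-injective eq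
    later : ∀ i j → toℕ i < toℕ j → G i j ≡ true → R (f i) (f j) ≡ false
    later i j lt e = ¬true⇒false (λ r → true≢false (∨-inj₂ {(col i == col j) ∧ (f i == f j)} (∧-true e r)) (f-conf i j lt))
    edge : ∀ i j → G i j ≡ true → R (f i) (f j) ≡ false ⊎ R (f j) (f i) ≡ false
    edge i j e with <-cmp (toℕ i) (toℕ j)
    ... | tri< lt _ _ = inj₁ (later i j lt e)
    ... | tri> _ _ lt = inj₂ (later j i lt (trans (proj₁ simple j i) e))
    ... | tri≈ _ eq _ = ⊥-elim (true≢false (subst (λ z → G i z ≡ true) (sym (Fin.toℕ-injective eq)) e) (proj₂ simple i))

-- Choice of parameters

-- The parameters: clusters of size at most Q, holes of size h, reserved parts of size
-- 3h + 2B, two further parts of size L, and g vertices gained per matched pair.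
record Sizes (E Q B : ℕ) : Set where
  h : ℕ
  h = suc (Q / suc E)
  field
    L g   : ℕ
    fits  : 3 * h + 2 * B + (L + L) ≤ Q
    gain≡ : g + suc (8 * h) ≡ L + L
    h≤L   : h ≤ L
    g≤Q   : g ≤ Q
    Q≤2g  : Q ≤ 2 * g
    loss  : suc E * Q ≤ suc E * g + 12 * Q

sizes : ∀ E Q B → 24 ≤ suc E → suc E * (2 * B + 13) ≤ Q → Sizes E Q B
sizes E Q B 24≤ large = record
  { L = L ; g = g ; fits = fits ; gain≡ = gain≡ ; h≤L = h≤L ; g≤Q = g≤Q ; Q≤2g = Q≤2g ; loss = loss }
  where
  open ≤-Reasoning
  h z w L g : ℕ
  h = suc (Q / suc E)
  z = 3 * h + 2 * B
  -- What a cluster does not contribute: `3 * h + 2 * B` for the reserve, `8 * h + 1` lost in the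
  -- pair path, and one more for an odd remainder in halving.
  w = 11 * h + 2 * B + 2
  L = ⌊ Q ∸ z /2⌋
  g = L + L ∸ suc (8 * h)
  -- The `13` is `11 + 2`, where the eleven come from the `suc` in `h`.
  Ew≤ : suc E * w ≤ 12 * Q
  Ew≤ = begin
    suc E * w  ≡⟨ lem (suc E) (Q / suc E) B ⟩
    11 * (Q / suc E * suc E) + suc E * (2 * B + 13)  ≤⟨ +-mono-≤ (*-monoʳ-≤ 11 (m/n*n≤m Q (suc E))) large ⟩
    11 * Q + Q  ≡⟨ lem₁ Q ⟩
    12 * Q  ∎
    where
    lem : ∀ e q b → e * (11 * suc q + 2 * b + 2) ≡ 11 * (q * e) + e * (2 * b + 13)
    lem = solve-∀
    lem₁ : ∀ q → 11 * q + q ≡ 12 * q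
    lem₁ = solve-∀
  2w≤Q : 2 * w ≤ Q
  2w≤Q = *-cancelˡ-≤ 12 (begin
    12 * (2 * w)  ≡⟨ sym (*-assoc 12 2 w) ⟩
    24 * w  ≤⟨ *-monoˡ-≤ w 24≤ ⟩
    suc E * w  ≤⟨ Ew≤ ⟩
    12 * Q  ∎)
  w≡ : w ≡ z + suc (suc (8 * h))
  w≡ = lem h B
    where
    lem : ∀ h b → 11 * h + 2 * b + 2 ≡ 3 * h + 2 * b + suc (suc (8 * h))
    lem = solve-∀
  z≤Q : z ≤ Q
  z≤Q = ≤-trans (≤-trans (m≤m+n z _) (≤-reflexive (sym w≡))) (≤-trans (m≤m+n w (w + 0)) 2w≤Q)
  halves : L + ⌈ Q ∸ z /2⌉ ≡ Q ∸ z
  halves = ⌊n/2⌋+⌈n/2⌉≡n (Q ∸ z)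
  fits : z + (L + L) ≤ Q
  fits = begin
    z + (L + L)  ≤⟨ +-monoʳ-≤ z (+-monoʳ-≤ L (⌊n/2⌋≤⌈n/2⌉ (Q ∸ z))) ⟩
    z + (L + ⌈ Q ∸ z /2⌉)  ≡⟨ cong (z +_) halves ⟩
    z + (Q ∸ z)  ≡⟨ m+[n∸m]≡n z≤Q ⟩
    Q  ∎
  ceil : ∀ n → ⌈ n /2⌉ ≤ suc ⌊ n /2⌋
  ceil zero          = z≤n
  ceil (suc zero)    = s≤s z≤n
  ceil (suc (suc n)) = s≤s (ceil n)
  Q≤ : Q ≤ z + suc (L + L)
  Q≤ = begin
    Q  ≡⟨ sym (m+[n∸m]≡n z≤Q) ⟩
    z + (Q ∸ z)  ≡⟨ cong (z +_) (sym halves) ⟩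
    z + (L + ⌈ Q ∸ z /2⌉)  ≤⟨ +-monoʳ-≤ z (+-monoʳ-≤ L (ceil (Q ∸ z))) ⟩
    z + (L + suc L)  ≡⟨ cong (z +_) (+-suc L L) ⟩
    z + suc (L + L)  ∎
  w≤LL : w + suc (8 * h) ≤ L + L
  w≤LL = +-cancelˡ-≤ (suc z) _ _ (begin
    suc z + (w + suc (8 * h))  ≡⟨ lem z w (8 * h) ⟩
    z + suc (suc (8 * h)) + w  ≡⟨ cong (_+ w) (sym w≡) ⟩
    w + w  ≡⟨ cong (w +_) (sym (+-identityʳ w)) ⟩
    2 * w  ≤⟨ 2w≤Q ⟩
    Q  ≤⟨ Q≤ ⟩
    z + suc (L + L)  ≡⟨ +-suc z (L + L) ⟩
    suc z + (L + L)  ∎)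
    where
    lem : ∀ z w h → suc z + (w + suc h) ≡ z + suc (suc h) + w
    lem = solve-∀
  gain≡ : g + suc (8 * h) ≡ L + L
  gain≡ = m∸n+n≡m (≤-trans (m≤n+m _ w) w≤LL)
  h≤L : h ≤ L
  h≤L = ≮⇒≥ (λ L<h → <⇒≱ (+-mono-< L<h L<h) (≤-trans (≤-trans (m≤m+n (h + h) (9 * h + 2 * B + 2)) (≤-reflexive (lem h B))) (≤-trans (m≤m+n w _) w≤LL)))
    where
    lem : ∀ h b → h + h + (9 * h + 2 * b + 2) ≡ 11 * h + 2 * b + 2
    lem = solve-∀
  g≤Q : g ≤ Q
  g≤Q = ≤-trans (m∸n≤m (L + L) (suc (8 * h))) (≤-trans (m≤n+m (L + L) z) fits)
  Q≤g+w : Q ≤ g + w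
  Q≤g+w = ≤-trans Q≤ (≤-reflexive (trans (cong (λ x → z + suc x) (sym gain≡)) (trans (lem z g (8 * h)) (cong (g +_) (sym w≡)))))
    where
    lem : ∀ z g h → z + suc (g + suc h) ≡ g + (z + suc (suc h))
    lem = solve-∀
  Q≤2g : Q ≤ 2 * g
  Q≤2g = +-cancelʳ-≤ Q _ _ (begin
    Q + Q  ≤⟨ +-mono-≤ Q≤g+w Q≤g+w ⟩
    g + w + (g + w)  ≡⟨ lem g w ⟩
    2 * g + 2 * w  ≤⟨ +-monoʳ-≤ (2 * g) 2w≤Q ⟩
    2 * g + Q  ∎)
    where
    lem : ∀ g w → g + w + (g + w) ≡ 2 * g + 2 * w
    lem = solve-∀
  loss : suc E * Q ≤ suc E * g + 12 * Q
  loss = begin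
    suc E * Q  ≤⟨ *-monoʳ-≤ (suc E) Q≤g+w ⟩
    suc E * (g + w)  ≡⟨ *-distribˡ-+ (suc E) g w ⟩
    suc E * g + suc E * w  ≤⟨ +-monoʳ-≤ (suc E * g) Ew≤ ⟩
    suc E * g + 12 * Q  ∎

-- `Q` exceeds `N / B`, and `B` has a bound that does not grow with `n`.
large-Q : ∀ {N n B Q M e} → 1 ≤ B → B ≤ M → n ≤ N → N < Q * B → M * (e * (2 * M + 13)) ≤ n → e * (2 * B + 13) ≤ Q
large-Q {N} {n} {B} {Q} {M} {e} 1≤B B≤M n≤N N<QB big = ≮⇒≥ (λ Q< → <⇒≱ N<QB (begin
  Q * B  ≤⟨ *-monoˡ-≤ B (<⇒≤ Q<) ⟩
  e * (2 * B + 13) * B  ≤⟨ *-mono-≤ (*-monoʳ-≤ e (+-monoˡ-≤ 13 (*-monoʳ-≤ 2 B≤M))) B≤M ⟩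
  e * (2 * M + 13) * M  ≡⟨ *-comm _ M ⟩
  M * (e * (2 * M + 13))  ≤⟨ big ⟩
  n  ≤⟨ n≤N ⟩
  N  ∎))
  where open ≤-Reasoning

module Steps (n N g Q B : ℕ) (Q≤2g : Q ≤ 2 * g) (1≤g : 1 ≤ g) (n≤N : n ≤ N) (N<QB : N < Q * B) where

  private instance
    g≢0 : NonZero g
    g≢0 = >-nonZero 1≤g

  t₀ t : ℕ
  t₀ = n / g
  t = suc t₀

  n≤tg : n ≤ t * g
  n≤tg = begin
    n  ≡⟨ m≡m%n+[m/n]*n n g ⟩
    n % g + n / g * g  ≤⟨ +-monoˡ-≤ (n / g * g) (<⇒≤ (m%n<n n g)) ⟩
    t * g  ∎
    where open ≤-Reasoning

  t-1≤ : n / g * g ≤ n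
  t-1≤ = m/n*n≤m n g

  -- Lets `2 * B` reserved vertices per cluster suffice for `t` links. A pair gains at least half a
  -- cluster size, and `B` cluster sizes exceed `N ≥ n`.
  t≤2B : t ≤ 2 * B
  t≤2B = ≰⇒> (λ 2B≤ → <⇒≱ N<QB (begin
    Q * B  ≤⟨ *-monoˡ-≤ B Q≤2g ⟩
    2 * g * B  ≡⟨ lem g B ⟩
    2 * B * g  ≤⟨ *-monoˡ-≤ g 2B≤ ⟩
    n / g * g  ≤⟨ t-1≤ ⟩
    n  ≤⟨ n≤N ⟩
    N  ∎))
    where
    open ≤-Reasoning
    lem : ∀ g b → 2 * g * b ≡ 2 * b * g
    lem = solve-∀

  -- The closed neighbourhoods to be removed contain little more than `n` vertices: `loss` bounds
  -- `Q - g` by `Q / (2 * y)`, and so by `g / y`.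
  tQ≤ : ∀ y → 24 * y * Q ≤ 24 * y * g + 12 * Q → y * (t₀ * Q) ≤ y * n + n
  tQ≤ y loss = *-cancelˡ-≤ 24 (begin
    24 * (y * (t₀ * Q))  ≡⟨ lem₁ y t₀ Q ⟩
    t₀ * (24 * y * Q)  ≤⟨ *-monoʳ-≤ t₀ loss ⟩
    t₀ * (24 * y * g + 12 * Q)  ≡⟨ lem₂ t₀ y g Q ⟩
    24 * y * (t₀ * g) + 12 * (t₀ * Q)  ≤⟨ +-mono-≤ (*-monoʳ-≤ (24 * y) t-1≤) (*-monoʳ-≤ 12 (*-monoʳ-≤ t₀ Q≤2g)) ⟩
    24 * y * n + 12 * (t₀ * (2 * g))  ≡⟨ cong (24 * y * n +_) (lem₃ t₀ g) ⟩
    24 * y * n + 24 * (t₀ * g)  ≤⟨ +-monoʳ-≤ (24 * y * n) (*-monoʳ-≤ 24 t-1≤) ⟩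
    24 * y * n + 24 * n  ≡⟨ lem₄ y n ⟩
    24 * (y * n + n)  ∎)
    where
    open ≤-Reasoning
    lem₁ : ∀ y t q → 24 * (y * (t * q)) ≡ t * (24 * y * q)
    lem₁ = solve-∀
    lem₂ : ∀ t y g q → t * (24 * y * g + 12 * q) ≡ 24 * y * (t * g) + 12 * (t * q)
    lem₂ = solve-∀
    lem₃ : ∀ t g → 12 * (t * (2 * g)) ≡ 24 * (t * g)
    lem₃ = solve-∀
    lem₄ : ∀ y n → 24 * y * n + 24 * n ≡ 24 * (y * n + n)
    lem₄ = solve-∀

-- `(Q - 1) * B ≤ N`, and here `B` may be replaced by the smaller `Y`.
QY≤ : ∀ {Q B N Y} → 1 ≤ Q → Q * B ≤ N + B → Y ≤ B → Y * Q ≤ N + Y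
QY≤ {suc Q} {B} {N} {Y} _ le Y≤B = begin
  Y * suc Q  ≡⟨ lem Y Q ⟩
  Q * Y + Y  ≤⟨ +-monoˡ-≤ Y (*-monoʳ-≤ Q Y≤B) ⟩
  Q * B + Y  ≤⟨ +-monoˡ-≤ Y (+-cancelˡ-≤ B _ _ (≤-trans le (≤-reflexive (+-comm N B)))) ⟩
  N + Y  ∎
  where
  open ≤-Reasoning
  lem : ∀ y q → y * suc q ≡ q * y + y
  lem = solve-∀

round-up≤ : ∀ x q .{{_ : NonZero q}} → suc (x / q) * q ≤ x + q
round-up≤ x q = ≤-trans (+-monoʳ-≤ q (m/n*n≤m x q)) (≤-reflexive (+-comm q x))

≤round-up : ∀ x q .{{_ : NonZero q}} → x ≤ suc (x / q) * q
≤round-up x q = begin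
  x  ≡⟨ m≡m%n+[m/n]*n x q ⟩
  x % q + x / q * q  ≤⟨ +-monoˡ-≤ (x / q * q) (<⇒≤ (m%n<n x q)) ⟩
  q + x / q * q  ∎
  where open ≤-Reasoning

-- Here m is the number of clusters set aside for a colour class of v vertices.
half-size : ∀ {n N Q Y Δ D v m t d} → 1 ≤ Q → 4 * v ≤ n → n ≤ t * Q → m * Q ≤ v + Δ * D + Q → Y * D ≤ N → Y * Q ≤ N + Y →
            N ≤ d * n → suc ((4 * Δ + 2) * d) ≤ Y → 2 * Y < n → m + m ≤ t
half-size {n} {N} {Q} {Y} {Δ} {D} {v} {m} {t} {d} 1≤Q 4v≤n n≤tQ mQ≤ YD≤ YQ≤ N≤ Y≥ 2Y<n = ≮⇒≥ (λ t<2m → <⇒≱ 2Y<n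
  (+-cancelˡ-≤ ((4 * Δ + 2) * (d * n)) _ _ (begin
    (4 * Δ + 2) * (d * n) + n  ≡⟨ lem₀ Δ d n ⟩
    suc ((4 * Δ + 2) * d) * n  ≤⟨ *-monoˡ-≤ n Y≥ ⟩
    Y * n  ≤⟨ *-monoʳ-≤ Y (small t<2m) ⟩
    Y * (4 * (Δ * D) + 2 * Q)  ≡⟨ lem₁ Y Δ D Q ⟩
    4 * Δ * (Y * D) + 2 * (Y * Q)  ≤⟨ +-mono-≤ (*-monoʳ-≤ (4 * Δ) YD≤) (*-monoʳ-≤ 2 YQ≤) ⟩
    4 * Δ * N + 2 * (N + Y)  ≡⟨ lem₂ Δ N Y ⟩
    (4 * Δ + 2) * N + 2 * Y  ≤⟨ +-monoˡ-≤ (2 * Y) (*-monoʳ-≤ (4 * Δ + 2) N≤) ⟩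
    (4 * Δ + 2) * (d * n) + 2 * Y  ∎)))
  where
  open ≤-Reasoning
  lem₀ : ∀ a d n → (4 * a + 2) * (d * n) + n ≡ suc ((4 * a + 2) * d) * n
  lem₀ = solve-∀
  lem₁ : ∀ y a d q → y * (4 * (a * d) + 2 * q) ≡ 4 * a * (y * d) + 2 * (y * q)
  lem₁ = solve-∀
  lem₂ : ∀ a n y → 4 * a * n + 2 * (n + y) ≡ (4 * a + 2) * n + 2 * y
  lem₂ = solve-∀
  -- Twice a colour class is at most half of `n`; the other half would have to consist of error
  -- terms.
  small : t < m + m → n ≤ 4 * (Δ * D) + 2 * Q
  small t<2m = +-cancelˡ-≤ (n + 2 * Q) _ _ (begin
    n + 2 * Q + n  ≡⟨ lem₃ n Q ⟩
    2 * (n + Q)  ≤⟨ *-monoʳ-≤ 2 (begin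
      n + Q  ≤⟨ +-monoˡ-≤ Q n≤tQ ⟩
      t * Q + Q  ≡⟨ +-comm (t * Q) Q ⟩
      suc t * Q  ≤⟨ *-monoˡ-≤ Q t<2m ⟩
      (m + m) * Q  ≡⟨ *-distribʳ-+ Q m m ⟩
      m * Q + m * Q  ≤⟨ +-mono-≤ mQ≤ mQ≤ ⟩
      v + Δ * D + Q + (v + Δ * D + Q)  ∎) ⟩
    2 * (v + Δ * D + Q + (v + Δ * D + Q))  ≡⟨ lem₄ v (Δ * D) Q ⟩
    4 * v + 4 * (Δ * D) + 4 * Q  ≤⟨ +-monoˡ-≤ (4 * Q) (+-monoˡ-≤ (4 * (Δ * D)) 4v≤n) ⟩
    n + 4 * (Δ * D) + 4 * Q  ≡⟨ lem₅ n (Δ * D) Q ⟩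
    n + 2 * Q + (4 * (Δ * D) + 2 * Q)  ∎)
    where
    lem₃ : ∀ n q → n + 2 * q + n ≡ 2 * (n + q)
    lem₃ = solve-∀
    lem₄ : ∀ v x q → 2 * (v + x + q + (v + x + q)) ≡ 4 * v + 4 * x + 4 * q
    lem₄ = solve-∀
    lem₅ : ∀ n x q → n + 4 * x + 4 * q ≡ n + 2 * q + (4 * x + 2 * q)
    lem₅ = solve-∀

-- Here F is the number of good clusters; k colour classes use up at most suc T clusters each.
enough : ∀ {n N Q Y Δ D s m F T k B M d e G} →
         m * Q ≤ s + Δ * D + Q → Y * (T * Q) ≤ Y * n + n → Y * Q ≤ N + Y → Y * D ≤ N → Y * N ≤ Y * (F * Q) + (N + B) + N →
         N ≡ k * n + s + e → k ≤ Δ → B ≤ M → N ≤ d * n → n < G * suc e →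
         G * (Δ + (2 * Δ + 2) * d) < Y → G * (Δ * Y + M) + G * Y < n → k * suc T + m ≤ F
enough {n} {N} {Q} {Y} {Δ} {D} {s} {m} {F} {T} {k} {B} {M} {d} {e} {G} mQ≤ YTQ≤ YQ≤ YD≤ cover N≡ k≤ B≤ N≤ n< Y> n> =
  ≮⇒≥ (λ F< → <⇒≱ n> (+-cancelˡ-≤ (G * c₁ * n) _ _ (begin
    G * c₁ * n + n  ≡⟨ +-comm (G * c₁ * n) n ⟩
    suc (G * c₁) * n  ≤⟨ *-monoˡ-≤ n Y> ⟩
    Y * n  ≤⟨ *-monoʳ-≤ Y (<⇒≤ n<) ⟩
    Y * (G * suc e)  ≡⟨ lem₁ Y G e ⟩
    G * (Y * e) + G * Y  ≤⟨ +-monoˡ-≤ (G * Y) (*-monoʳ-≤ G (Ye≤ F<)) ⟩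
    G * (c₁ * n + (Δ * Y + M)) + G * Y  ≡⟨ lem₂ G c₁ n (Δ * Y + M) Y ⟩
    G * c₁ * n + (G * (Δ * Y + M) + G * Y)  ∎)))
  where
  open ≤-Reasoning
  c₁ : ℕ
  c₁ = Δ + (2 * Δ + 2) * d
  lem₁ : ∀ y g e → y * (g * suc e) ≡ g * (y * e) + g * y
  lem₁ = solve-∀
  lem₂ : ∀ g c n x y → g * (c * n + x) + g * y ≡ g * c * n + (g * x + g * y)
  lem₂ = solve-∀
  module _ (F< : F < k * suc T + m) where
    FQ≤ : F * Q ≤ k * (T * Q + Q) + (s + Δ * D)
    FQ≤ = +-cancelˡ-≤ Q _ _ (begin
      Q + F * Q  ≤⟨ *-monoˡ-≤ Q F< ⟩
      (k * suc T + m) * Q  ≡⟨ lem k T m Q ⟩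
      k * (T * Q + Q) + m * Q  ≤⟨ +-monoʳ-≤ (k * (T * Q + Q)) mQ≤ ⟩
      k * (T * Q + Q) + (s + Δ * D + Q)  ≡⟨ lem′ (k * (T * Q + Q)) (s + Δ * D) Q ⟩
      Q + (k * (T * Q + Q) + (s + Δ * D))  ∎)
      where
      lem : ∀ k t m q → (k * suc t + m) * q ≡ k * (t * q + q) + m * q
      lem = solve-∀
      lem′ : ∀ a b q → a + (b + q) ≡ q + (a + b)
      lem′ = solve-∀
    -- The errors would have to use up the slack `e`, which is about `n / G`; this fails as `Y`
    -- exceeds `G * c₁`.
    Ye≤ : Y * e ≤ c₁ * n + (Δ * Y + M)
    Ye≤ = +-cancelˡ-≤ (Y * (k * n) + Y * s) _ _ (begin
      Y * (k * n) + Y * s + Y * e  ≡⟨ lem₃ Y (k * n) s e ⟩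
      Y * (k * n + s + e)  ≡⟨ cong (Y *_) (sym N≡) ⟩
      Y * N  ≤⟨ cover ⟩
      Y * (F * Q) + (N + B) + N  ≤⟨ +-monoˡ-≤ N (+-mono-≤ (*-monoʳ-≤ Y FQ≤) (+-monoʳ-≤ N B≤)) ⟩
      Y * (k * (T * Q + Q) + (s + Δ * D)) + (N + M) + N  ≡⟨ lem₄ Y k (T * Q) Q s Δ D N M ⟩
      k * (Y * (T * Q) + Y * Q) + Y * s + Δ * (Y * D) + (2 * N + M)  ≤⟨ +-monoˡ-≤ (2 * N + M) (+-mono-≤ (+-monoˡ-≤ (Y * s) (*-monoʳ-≤ k (+-mono-≤ YTQ≤ YQ≤))) (*-monoʳ-≤ Δ YD≤)) ⟩
      k * (Y * n + n + (N + Y)) + Y * s + Δ * N + (2 * N + M)  ≡⟨ lem₅ k Y n N s Δ M ⟩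
      Y * (k * n) + Y * s + (k * (n + N + Y) + Δ * N + 2 * N + M)  ≤⟨ +-monoʳ-≤ (Y * (k * n) + Y * s) (begin
          k * (n + N + Y) + Δ * N + 2 * N + M  ≤⟨ +-monoˡ-≤ M (+-monoˡ-≤ (2 * N) (+-monoˡ-≤ (Δ * N) (*-monoˡ-≤ (n + N + Y) k≤))) ⟩
          Δ * (n + N + Y) + Δ * N + 2 * N + M  ≡⟨ lem₆ Δ n N Y M ⟩
          Δ * n + (2 * Δ + 2) * N + (Δ * Y + M)  ≤⟨ +-monoˡ-≤ (Δ * Y + M) (+-monoʳ-≤ (Δ * n) (*-monoʳ-≤ (2 * Δ + 2) N≤)) ⟩
          Δ * n + (2 * Δ + 2) * (d * n) + (Δ * Y + M)  ≡⟨ cong (_+ (Δ * Y + M)) (lem₇ Δ (2 * Δ + 2) d n) ⟩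
          c₁ * n + (Δ * Y + M)  ∎) ⟩
      Y * (k * n) + Y * s + (c₁ * n + (Δ * Y + M))  ∎)
      where
      lem₃ : ∀ y a s e → y * a + y * s + y * e ≡ y * (a + s + e)
      lem₃ = solve-∀
      lem₄ : ∀ y k a q s δ d n m → y * (k * (a + q) + (s + δ * d)) + (n + m) + n ≡ k * (y * a + y * q) + y * s + δ * (y * d) + (2 * n + m)
      lem₄ = solve-∀
      lem₅ : ∀ k y n N s δ m → k * (y * n + n + (N + y)) + y * s + δ * N + (2 * N + m) ≡ y * (k * n) + y * s + (k * (n + N + y) + δ * N + 2 * N + m)
      lem₅ = solve-∀
      lem₆ : ∀ δ n N y m → δ * (n + N + y) + δ * N + 2 * N + m ≡ δ * n + (2 * δ + 2) * N + (δ * y + m)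
      lem₆ = solve-∀
      lem₇ : ∀ δ c d n → δ * n + c * (d * n) ≡ (δ + c * d) * n
      lem₇ = solve-∀

-- The upper bound

module Slices {N K : ℕ} (c : Fin N → Fin K) where

  pos : Fin N → ℕ
  pos x = rank (λ y → c y == c x) x

  pos-rank : ∀ x {a} → c x ≡ a → pos x ≡ rank (λ y → c y == a) x
  pos-rank x refl = refl

  -- Cuts all clusters simultaneously, by position within the cluster; this yields the parts `X`,
  -- `Y` and `Z`.
  slice : ℕ → ℕ → Fin N → Bool
  slice lo hi x = not (pos x <ᵇ lo) ∧ (pos x <ᵇ hi)

  slice-size : ∀ a lo len → lo + len ≤ # (λ x → c x == a) → len ≤ # (λ x → (c x == a) ∧ slice lo (lo + len) x)
  slice-size a lo len le = +-cancelˡ-≤ lo _ _ (begin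
    lo + len  ≡⟨ sym (m≤n⇒m⊓n≡m le) ⟩
    (lo + len) ⊓ # p  ≡⟨ sym (#-below p (lo + len)) ⟩
    # (below p (lo + len))  ≤⟨ #-cover cov ⟩
    # (below p lo) + # (λ x → p x ∧ slice lo (lo + len) x) ≤⟨ +-monoˡ-≤ _ (≤-trans (≤-reflexive (#-below p lo)) (m⊓n≤m lo (# p))) ⟩
    lo + # (λ x → p x ∧ slice lo (lo + len) x)  ∎)
    where
    open ≤-Reasoning
    p : Fin N → Bool
    p x = c x == a
    cov : ∀ x → below p (lo + len) x ≡ true → below p lo x ≡ true ⊎ (p x ∧ slice lo (lo + len) x) ≡ true
    cov x e with true? (below p lo x)
    ... | inj₁ b = inj₁ b
    ... | inj₂ b = inj₂ (∧-true (∧-fst {p x} e) (∧-true (false⇒not (¬true⇒false (λ l → true≢false (∧-true (∧-fst {p x} e) (subst (λ r → (r <ᵇ lo) ≡ true) eq l)) b)))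
                         (subst (λ r → (r <ᵇ lo + len) ≡ true) (sym eq) (∧-snd {p x} e))))
      where
      eq : pos x ≡ rank p x
      eq = pos-rank x (==⇒≡ {i = c x} {a} (∧-fst {p x} e))

  slice-disjoint : ∀ lo mid mid′ hi → mid ≤ mid′ → ∀ x → slice lo mid x ≡ true → slice mid′ hi x ≡ true → ⊥
  slice-disjoint lo mid mid′ hi le x e e′ = true≢false (<ᵇ-true (<-≤-trans (true-<ᵇ (∧-snd {not (pos x <ᵇ lo)} e)) le)) (not-true (∧-fst e′))

module Assembly {n N k : ℕ} (G : Graph n) (simple : IsSimple G) (Δ : ℕ) (deg : MaxDegreeAtMost G Δ)
  (col : Fin n → Fin (suc k)) (proper : IsProperColouring G col) (quarter : ∀ j → 4 * # (λ v → col v == j) ≤ n)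
  (R : Fin N → Fin N → Bool) (R-sym : ∀ x y → R x y ≡ true → R y x ≡ true)
  (E Y M d e₀ G₀ : ℕ) (1≤Y : 1 ≤ Y) (E≡ : suc E ≡ 24 * Y)
  (part : Partition R E (Y * Y) Y M)
  (n≤N : n ≤ N) (N≡ : N ≡ k * n + # (λ v → col v == zero) + e₀) (k≤Δ : k ≤ Δ) (N≤ : N ≤ d * n)
  (slack : n < G₀ * suc e₀) (Y> : G₀ * (Δ + (2 * Δ + 2) * d) < Y) (Y≥ : suc ((4 * Δ + 2) * d) ≤ Y)
  (n>₁ : 2 * Y < n) (n>₂ : G₀ * (Δ * Y + M) + G₀ * Y < n) (n>₃ : M * (suc E * (2 * M + 13)) ≤ n)
  where

  open Partition part
  1≤B : 1 ≤ B
  1≤B = ≤-trans 1≤Y H≤B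

  large : suc E * (2 * B + 13) ≤ Q
  large = large-Q {e = suc E} 1≤B B≤ n≤N N<QB n>₃

  opaque
    size-choice : Sizes E Q B
    size-choice = sizes E Q B (≤-trans (*-monoʳ-≤ 24 1≤Y) (≤-reflexive (sym E≡))) large

  open Sizes size-choice

  1≤Q : 1 ≤ Q
  1≤Q = ≤-trans (*-mono-≤ (s≤s (z≤n {E})) (≤-trans (s≤s (z≤n {12})) (m≤n+m 13 (2 * B)))) large

  Q≢0 : NonZero Q
  Q≢0 = >-nonZero 1≤Q

  Y≢0 : NonZero Y
  Y≢0 = >-nonZero 1≤Y

  1≤g : 1 ≤ g
  1≤g = lem g Q≤2g
    where
    lem : ∀ g → Q ≤ 2 * g → 1 ≤ g
    lem zero    q = ⊥-elim (<⇒≱ 1≤Q q)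
    lem (suc g) _ = s≤s z≤n

  1≤N : 1 ≤ N
  1≤N = ≤-trans (≤-trans (s≤s (z≤n {2 * Y})) n>₁) n≤N

  open Steps n N g Q B Q≤2g 1≤g n≤N N<QB

  open Holes R c h using (U; bad; hole?; HasHole; nonempty-intro)

  hole-sym : ∀ i j → HasHole i j → HasHole j i
  hole-sym i j (u , w , a , b , p , q , none) =
    w , u , b , a , q , p , (λ x z wx uz → ¬true⇒false (λ r → true≢false (R-sym x z r) (none z x uz wx)))

  Γ : Fin K → Fin K → Bool
  Γ i j = not (i == j) ∧ not (does (hole? i j))

  Γ-sym : ∀ i j → Γ i j ≡ true → Γ j i ≡ true
  Γ-sym i j e = ∧-true (false⇒not (¬true⇒false (λ j≡i → true≢false (subst (λ z → (z == j) ≡ true) (==⇒≡ {i = j} {i} j≡i) (==-refl j)) (not-true (∧-fst e)))))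
    (false⇒not (¬true⇒false (λ hl → does⇒¬ (hole? i j) (not-true (∧-snd {not (i == j)} e)) (hole-sym j i (does⇒ (hole? j i) hl)))))

  badRow : Fin K → ℕ
  badRow i = # (λ z → bad i (c z))

  light isFull S : Fin K → Bool
  light i = does (Y * badRow i ≤? N)
  isFull i = does (# (U i) ≟ Q)
  S i = isFull i ∧ light i

  S-full : ∀ i → S i ≡ true → # (U i) ≡ Q
  S-full i e = does⇒ (# (U i) ≟ Q) (∧-fst e)

  D : ℕ
  D = _/_ N Y {{Y≢0}}

  YD≤N : Y * D ≤ N
  YD≤N = ≤-trans (≤-reflexive (*-comm Y D)) (m/n*n≤m N Y {{Y≢0}})

  S-light : ∀ i → S i ≡ true → badRow i ≤ D
  S-light i e = ≤-trans (≤-reflexive (sym (m*n/n≡m (badRow i) Y {{Y≢0}})))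
    (/-monoˡ-≤ Y {{Y≢0}} (≤-trans (≤-reflexive (*-comm (badRow i) Y)) (does⇒ (Y * badRow i ≤? N) (∧-snd {isFull i} e))))

  -- A vertex in a heavy cluster accounts for more than `N / Y` pairs counted by `#bad`, so
  -- `few-bad` leaves at most `N / Y` such vertices.
  cover : Y * N ≤ Y * (# S * Q) + (N + B) + N
  cover = begin
    Y * N  ≡⟨ cong (Y *_) (sym (#-all N)) ⟩
    Y * # {N} (λ _ → true)  ≤⟨ *-monoʳ-≤ Y (≤-trans (#-cover cov₁) (+-monoˡ-≤ _ (#-cover cov₂))) ⟩
    Y * (# good + # nonF + # heavy)  ≡⟨ lem Y (# good) (# nonF) (# heavy) ⟩
    Y * # good + Y * # nonF + Y * # heavy  ≤⟨ +-mono-≤ (+-mono-≤ (*-monoʳ-≤ Y good≤) nonfull) heavy≤ ⟩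
    Y * (# S * Q) + (N + B) + N  ∎
    where
    open ≤-Reasoning
    lem : ∀ y a b c → y * (a + b + c) ≡ y * a + y * b + y * c
    lem = solve-∀
    good nonF heavy notHeavy : Fin N → Bool
    good x = S (c x)
    nonF x = not (isFull (c x))
    heavy x = not (light (c x))
    notHeavy x = light (c x)
    cov₁ : ∀ x → true ≡ true → notHeavy x ≡ true ⊎ heavy x ≡ true
    cov₁ x _ with light (c x)
    ... | true  = inj₁ refl
    ... | false = inj₂ refl
    cov₂ : ∀ x → notHeavy x ≡ true → good x ≡ true ⊎ nonF x ≡ true
    cov₂ x l with true? (isFull (c x))
    ... | inj₁ f = inj₁ (∧-true f l)
    ... | inj₂ f = inj₂ (false⇒not f)
    good≤ : # good ≤ # S * Q
    good≤ = begin
      # good  ≡⟨ #-∑ good ⟩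
      ∑ (λ x → ⟦ S (c x) ⟧)  ≡⟨ ∑-fibre c (λ i → ⟦ S i ⟧) ⟩
      ∑ (λ i → # (U i) * ⟦ S i ⟧)  ≤⟨ ∑-mono (λ i → ≤-trans (*-monoˡ-≤ ⟦ S i ⟧ (class≤Q i)) (≤-reflexive (*-comm Q ⟦ S i ⟧))) ⟩
      ∑ (λ i → ⟦ S i ⟧ * Q)  ≡⟨ trans (∑-*ʳ _ Q) (cong (_* Q) (sym (#-∑ S))) ⟩
      # S * Q  ∎
    heavy≤ : Y * # heavy ≤ N
    heavy≤ = *-cancelʳ-≤ (Y * # heavy) N N {{>-nonZero 1≤N}} (begin
      Y * # heavy * N  ≡⟨ *-assoc Y (# heavy) N ⟩
      Y * (# heavy * N)  ≡⟨ cong (λ s → Y * (s * N)) (#-∑ heavy) ⟩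
      Y * (∑ (λ x → ⟦ heavy x ⟧) * N)  ≡⟨ cong (Y *_) (sym (∑-*ʳ _ N)) ⟩
      Y * ∑ (λ x → ⟦ heavy x ⟧ * N)  ≤⟨ *-monoʳ-≤ Y (∑-mono pt) ⟩
      Y * ∑ (λ x → Y * badRow (c x))  ≡⟨ trans (cong (Y *_) (∑-*ˡ Y _)) (sym (*-assoc Y Y _)) ⟩
      Y * Y * Holes.#bad R c h  ≤⟨ few-bad ⟩
      N * N  ∎)
      where
      pt : ∀ x → ⟦ heavy x ⟧ * N ≤ Y * badRow (c x)
      pt x with true? (heavy x)
      ... | inj₂ e = ≤-trans (≤-reflexive (cong (_* N) (⟦⟧-false e))) z≤n
      ... | inj₁ e = ≤-trans (≤-reflexive (trans (cong (_* N) (⟦⟧-true e)) (+-identityʳ N)))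
                       (<⇒≤ (≰⇒> (does⇒¬ (Y * badRow (c x) ≤? N) (not-true e))))

  v m : Fin (suc k) → ℕ
  v j = # (λ g → col g == j)
  -- Besides the class itself, `Δ * D` vertices that red edges may block, rounded up to whole
  -- clusters.
  m j = suc (_/_ (v j + Δ * D) Q {{Q≢0}})

  mQ≤ : ∀ j → m j * Q ≤ v j + Δ * D + Q
  mQ≤ j = round-up≤ (v j + Δ * D) Q {{Q≢0}}

  ≤mQ : ∀ j → v j + Δ * D ≤ m j * Q
  ≤mQ j = ≤round-up (v j + Δ * D) Q {{Q≢0}}

  YQ≤N : Y * Q ≤ N + Y
  YQ≤N = QY≤ 1≤Q QB≤ H≤B

  n≤tQ : n ≤ t * Q
  n≤tQ = ≤-trans n≤tg (*-monoʳ-≤ t g≤Q)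

  2m≤t : ∀ j → m j + m j ≤ t
  2m≤t j = half-size {n} {N} {Q} {Y} {Δ} {D} {v j} {m j} {t} {d} 1≤Q (quarter j) n≤tQ (mQ≤ j) YD≤N YQ≤N N≤ Y≥ n>₁

  clusters : k * t + m zero ≤ # S
  clusters = enough {n} {N} {Q} {Y} {Δ} {D} {v zero} {m zero} {# S} {t₀} {k} {B} {M} {d} {e₀} {G₀} (mQ≤ zero)
    (tQ≤ Y (subst (λ x → x * Q ≤ x * g + 12 * Q) E≡ loss)) YQ≤N YD≤N cover N≡ k≤Δ B≤ N≤ slack Y> n>₂

  open Separation Γ Γ-sym
  open Slices c

  RedPath : Set
  RedPath = ∃ λ l → IsPath R l × Uniq l × n ≤ length l

  BlueCopy : Set
  BlueCopy = ∃ λ (f : Fin n → Fin N) → Injective _≡_ _≡_ f × (∀ i j → G i j ≡ true → R (f i) (f j) ≡ false ⊎ R (f j) (f i) ≡ false)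

  z : ℕ
  z = 3 * h + 2 * B

  red-path : ConnectedMatching t S → RedPath
  red-path (C , C⊑S , conn , pm) = long (FatEnds.long-red-path R R-sym Γ Γ-sym c
      (slice z (z + L)) (slice (z + L) (z + L + L)) (slice 0 (0 + z))
      (slice-disjoint z (z + L) (z + L) (z + L + L) ≤-refl) (λ x a b → slice-disjoint 0 z z (z + L) ≤-refl x b a)
      (λ x a b → slice-disjoint 0 z (z + L) (z + L + L) (m≤m+n z L) x b a)
      h L t g (s≤s z≤n) h≤L (≤-reflexive gain≡) C conn joined sizeX sizeY sizeZ pm (s≤s z≤n))
    where
    long : (∃ λ l → IsPath R l × Uniq l × t * g ≤ length l) → RedPath
    long (l , p , u , le) = l , p , u , ≤-trans n≤tg le
    full : ∀ a → C a ≡ true → # (U a) ≡ Q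
    full a e = S-full a (C⊑S a e)
    fits′ : z + L + L ≤ Q
    fits′ = ≤-trans (≤-reflexive (+-assoc z L L)) fits
    sizeX : ∀ a → C a ≡ true → L ≤ # (λ x → (c x == a) ∧ slice z (z + L) x)
    sizeX a e = slice-size a z L (≤-trans (≤-trans (m≤m+n (z + L) L) fits′) (≤-reflexive (sym (full a e))))
    sizeY : ∀ a → C a ≡ true → L ≤ # (λ x → (c x == a) ∧ slice (z + L) (z + L + L) x)
    sizeY a e = slice-size a (z + L) L (≤-trans fits′ (≤-reflexive (sym (full a e))))
    sizeZ : ∀ a → C a ≡ true → 3 * h + t ≤ # (λ x → (c x == a) ∧ slice 0 (0 + z) x)
    sizeZ a e = ≤-trans (+-monoʳ-≤ (3 * h) t≤2B) (slice-size a 0 z (≤-trans (≤-trans (m≤m+n z (L + L)) fits) (≤-reflexive (sym (full a e)))))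
    RedEdge : (Fin N → Bool) → (Fin N → Bool) → Set
    RedEdge p q = ∃ λ x → ∃ λ w → p x ≡ true × q w ≡ true × R x w ≡ true
    joined : ∀ a b → Γ a b ≡ true → C a ≡ true → C b ≡ true → ∀ p q → p ⊑ U a → q ⊑ U b → h ≤ # p → h ≤ # q → RedEdge p q
    joined a b γ _ _ p q p⊑ q⊑ hp hq = decide (Fin.any? (λ x → Fin.any? (λ w → (p x Bool.≟ true) ×-dec (q w Bool.≟ true) ×-dec (R x w Bool.≟ true))))
      where
      decide : Dec (RedEdge p q) → RedEdge p q
      decide (yes r) = r
      decide (no none) = ⊥-elim (does⇒¬ (hole? a b) (not-true (∧-snd {not (a == b)} γ))
        (p , q , p⊑ , q⊑ , hp , hq , (λ x w px qw → ¬true⇒false (λ r → none (x , w , px , qw , r)))))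

  -- Colour `zero`, whose class size enters `N`, is placed in `rest`, the others in the sets `T`.
  blue-copy : Separated k S (m ∘ suc) (m zero) → BlueCopy
  blue-copy sep = Embedding.embedding G simple Δ deg col proper R W D (fromℕ< 1≤N) W-disj sparse roomy
    where
    open Separated sep
    T′ : Fin (suc k) → Fin K → Bool
    T′ zero    = rest
    T′ (suc i) = T i
    T′⊑ : ∀ j → T′ j ⊑ S
    T′⊑ zero    = rest⊑
    T′⊑ (suc i) = T⊑ i
    T′-size : ∀ j → m j ≤ # (T′ j)
    T′-size zero    = rest-≥
    T′-size (suc i) = ≤-reflexive (sym (T-size i))
    apart : ∀ i j → i ≢ j → ∀ a b → T′ i a ≡ true → T′ j b ≡ true → a ≢ b × Γ a b ≡ false
    apart zero    zero    ne = ⊥-elim (ne refl)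
    apart (suc i) zero    ne a b = T-rest i a b
    apart (suc i) (suc j) ne = T-T i j (ne ∘ cong suc)
    apart zero    (suc j) ne a b p q = (λ e → proj₁ (T-rest j b a q p) (sym e)) ,
      ¬true⇒false (λ γ → true≢false (Γ-sym a b γ) (proj₂ (T-rest j b a q p)))
    W : Fin (suc k) → Fin N → Bool
    W j x = T′ j (c x)
    W-disj : ∀ i j x → W i x ≡ true → W j x ≡ true → i ≡ j
    W-disj i j x p q = decide (i Fin.≟ j)
      where
      decide : Dec (i ≡ j) → i ≡ j
      decide (yes e) = e
      decide (no ne) = ⊥-elim (proj₁ (apart i j ne (c x) (c x) p q) refl)
    sparse : ∀ i j x → i ≢ j → W i x ≡ true → # (λ w → W j w ∧ R x w) ≤ D
    sparse i j x ne p = ≤-trans (#-mono sub) (S-light (c x) (T′⊑ i (c x) p))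
      where
      -- The clusters of `x` and `w` are distinct and not joined in `Γ`, so they have a hole; the
      -- red edge then makes the pair bad.
      sub : (λ w → W j w ∧ R x w) ⊑ (λ w → bad (c x) (c w))
      sub w e = ∧-true (false⇒not c≢) (∧-true hole (nonempty-intro x w (∧-snd {W j w} e)))
        where
        ap = apart i j ne (c x) (c w) p (∧-fst e)
        c≢ : (c x == c w) ≡ false
        c≢ = ≢⇒== (proj₁ ap)
        hole : does (hole? (c x) (c w)) ≡ true
        hole = split (true? (does (hole? (c x) (c w))))
          where
          split : _ ⊎ _ → does (hole? (c x) (c w)) ≡ true
          split (inj₁ t) = t
          split (inj₂ f) = ⊥-elim (true≢false (∧-true (false⇒not c≢) (false⇒not f)) (proj₂ ap))
    roomy : ∀ j → # (λ g → col g == j) + Δ * D ≤ # (W j)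
    roomy j = begin
      v j + Δ * D  ≤⟨ ≤mQ j ⟩
      m j * Q  ≤⟨ *-monoˡ-≤ Q (T′-size j) ⟩
      # (T′ j) * Q  ≡⟨ trans (cong (_* Q) (#-∑ (T′ j))) (sym (∑-*ʳ _ Q)) ⟩
      ∑ (λ i → ⟦ T′ j i ⟧ * Q)  ≤⟨ ∑-mono term ⟩
      ∑ (λ i → # (U i) * ⟦ T′ j i ⟧)  ≡⟨ sym (∑-fibre c (λ i → ⟦ T′ j i ⟧)) ⟩
      ∑ (λ x → ⟦ T′ j (c x) ⟧)  ≡⟨ sym (#-∑ (W j)) ⟩
      # (W j)  ∎
      where
      open ≤-Reasoning
      term : ∀ i → ⟦ T′ j i ⟧ * Q ≤ # (U i) * ⟦ T′ j i ⟧
      term i = decide (true? (T′ j i))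
        where
        decide : T′ j i ≡ true ⊎ T′ j i ≡ false → ⟦ T′ j i ⟧ * Q ≤ # (U i) * ⟦ T′ j i ⟧
        decide (inj₁ e) = ≤-reflexive (trans (cong (⟦ T′ j i ⟧ *_) (sym (S-full i (T′⊑ j i e)))) (*-comm ⟦ T′ j i ⟧ (# (U i))))
        decide (inj₂ e) = ≤-trans (≤-reflexive (cong (_* Q) (⟦⟧-false e))) z≤n

  outcome : RedPath ⊎ BlueCopy
  outcome = conclude (separate t k (m ∘ suc) (2m≤t ∘ suc) S (m zero) clusters)
    where
    conclude : ConnectedMatching t S ⊎ Separated k S (m ∘ suc) (m zero) → RedPath ⊎ BlueCopy
    conclude (inj₁ cm)  = inj₁ (red-path cm)
    conclude (inj₂ sep) = inj₂ (blue-copy sep)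

-- From lists and Boolean red edges back to copies in a colouring

nth : ∀ {N} (l : List (Fin N)) i → i < length l → Fin N
nth (x ∷ l) zero    lt       = x
nth (x ∷ l) (suc i) (s≤s lt) = nth l i lt

nth-mem : ∀ {N} (l : List (Fin N)) i lt → mem l (nth l i lt) ≡ true
nth-mem (x ∷ l) zero    lt       = mem-head x l
nth-mem (x ∷ l) (suc i) (s≤s lt) = ∨-inj₂ {x == nth l i lt} (nth-mem l i lt)

nth-step : ∀ {N} (R : Fin N → Fin N → Bool) l i lt lt′ → IsPath R l → R (nth l i lt) (nth l (suc i) lt′) ≡ true
nth-step R (x ∷ y ∷ l) zero    lt       (s≤s lt′) (e , p) = e
nth-step R (x ∷ y ∷ l) (suc i) (s≤s lt) (s≤s lt′) (e , p) = nth-step R (y ∷ l) i lt lt′ p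

nth-inj : ∀ {N} (l : List (Fin N)) → Uniq l → ∀ i j lt lt′ → nth l i lt ≡ nth l j lt′ → i ≡ j
nth-inj (x ∷ l) u zero zero lt lt′ e = refl
nth-inj (x ∷ l) (a , u) zero (suc j) lt (s≤s lt′) e = ⊥-elim (true≢false (subst (λ z → mem l z ≡ true) (sym e) (nth-mem l j lt′)) a)
nth-inj (x ∷ l) (a , u) (suc i) zero (s≤s lt) lt′ e = ⊥-elim (true≢false (subst (λ z → mem l z ≡ true) e (nth-mem l i lt)) a)
nth-inj (x ∷ l) (a , u) (suc i) (suc j) (s≤s lt) (s≤s lt′) e = cong suc (nth-inj l u i j lt lt′ e)

isRed : Colour → Bool
isRed red  = true
isRed blue = false

isRed⇒red : ∀ {c} → isRed c ≡ true → c ≡ red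
isRed⇒red {red} _ = refl

¬isRed⇒blue : ∀ {c} → isRed c ≡ false → c ≡ blue
¬isRed⇒blue {blue} _ = refl

transpose-inj : ∀ {n} (i j : Fin n) {x y} → Perm.transpose i j x ≡ Perm.transpose i j y → x ≡ y
transpose-inj i j {x} {y} e = trans (sym (Perm.transpose-inverse j i)) (trans (cong (Perm.transpose j i) e) (Perm.transpose-inverse j i))

transpose-j : ∀ {n} (i j : Fin n) → Perm.transpose i j j ≡ i
transpose-j i j with j Fin.≟ i
... | yes e = e
... | no _ rewrite dec-true (j Fin.≟ j) refl = refl

∣-∣-scaled : ∀ {a b x y n} g → a ≤ b + x → b ≤ a + y → g * x ≤ n → g * y ≤ n → g * ∣ a - b ∣ ≤ n
∣-∣-scaled {a} {b} {x} {y} g a≤ b≤ gx gy with ≤-total a b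
... | inj₁ le rewrite m≤n⇒∣m-n∣≡n∸m le = ≤-trans (*-monoʳ-≤ g (m≤n+o⇒m∸n≤o b a b≤)) gy
... | inj₂ le rewrite m≤n⇒∣n-m∣≡n∸m le = ≤-trans (*-monoʳ-≤ g (m≤n+o⇒m∸n≤o a b a≤)) gx

-- The independence number enters here: a colour class is an independent set.
class-quarter : ∀ {n k} (G : Graph n) → IndependenceAtMostQuarter G → (c : Fin n → Fin k) → IsProperColouring G c →
                ∀ j → 4 * # (λ v → c v == j) ≤ n
class-quarter {n} G small c proper j = subst (λ z → 4 * z ≤ n) (trans (∣∣-# S) (#-cong (lookup∘tabulate p))) (small S indep)
  where
  p : Fin n → Bool
  p v = c v == j
  S : Subset n
  S = tabulate p
  inS : ∀ v → v ∈ S → c v ≡ j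
  inS v e = ==⇒≡ {i = c v} {j} (trans (sym (lookup∘tabulate p v)) ([]=⇒lookup e))
  indep : IsIndependent G S
  indep u v Su Sv = ¬true⇒false (λ e → proper u v e (trans (inS u Su) (sym (inS v Sv))))

module Bounds (Δ q E Y M : ℕ) (1≤Y : 1 ≤ Y) (E≡ : suc E ≡ 24 * Y)
  (Y> : suc q * (Δ + (2 * Δ + 2) * (Δ + 2)) < Y) (Y≥ : suc ((4 * Δ + 2) * (Δ + 2)) ≤ Y)
  (M≡ : Kbound Y (suc (Y * Y * (suc E * suc E))) 1 ≡ M)
  (n : ℕ) (n>₁ : 2 * Y < n) (n>₂ : suc q * (Δ * Y + M) + suc q * Y < n) (n>₃ : M * (suc E * (2 * M + 13)) ≤ n)
  (G : Graph n) (simple : IsSimple G) (deg : MaxDegreeAtMost G Δ) (small : IndependenceAtMostQuarter G)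
  where

  slackness : ℕ
  slackness = n / suc q

  arrows : ∀ k (c : Fin n → Fin (suc k)) → IsProperColouring G c → k ≤ Δ →
           Arrows (k * n + # (λ v → c v == zero) + slackness) (Defs.path n) G
  -- A single colour class would contain all `n` vertices, against the quarter bound. So `k` is
  -- positive, and `n ≤ N` follows.
  arrows zero c proper k≤Δ = ⊥-elim (<⇒≱ n>₁ (≤-trans n≤0 z≤n))
    where
    all : # (λ v → c v == zero) ≡ n
    all = trans (#-cong (λ v → cong (_== zero) (one (c v)))) (#-all n)
      where
      one : (i : Fin 1) → i ≡ zero
      one zero = refl
    n≤0 : n ≤ 0
    n≤0 = *-cancelˡ-≤ 3 (+-cancelˡ-≤ n _ _ (≤-trans
            (subst (λ z → 4 * z ≤ n) all (class-quarter G small c proper zero)) (≤-reflexive (sym (+-identityʳ n)))))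
  arrows k@(suc k′) c proper k≤Δ χ χ-sym = conclude A.outcome
    where
    s N : ℕ
    s = # (λ v → c v == zero)
    N = k * n + s + slackness
    R : Fin N → Fin N → Bool
    R x y = isRed (χ x y)
    R-sym : ∀ x y → R x y ≡ true → R y x ≡ true
    R-sym x y e = trans (cong isRed (χ-sym y x)) e
    n≤N : n ≤ N
    n≤N = ≤-trans (m≤m+n n (k′ * n)) (≤-trans (m≤m+n (k * n) s) (m≤m+n (k * n + s) slackness))
    N≤ : N ≤ (Δ + 2) * n
    N≤ = ≤-trans (+-mono-≤ (+-mono-≤ (*-monoˡ-≤ n k≤Δ) (#≤n _)) (m/n≤m n (suc q))) (≤-reflexive (lem Δ n))
      where
      lem : ∀ d n → d * n + n + n ≡ (d + 2) * n
      lem = solve-∀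
    n< : n < suc q * suc slackness
    n< = begin-strict
      n  ≡⟨ m≡m%n+[m/n]*n n (suc q) ⟩
      n % suc q + n / suc q * suc q  <⟨ +-monoˡ-< _ (m%n<n n (suc q)) ⟩
      suc q + n / suc q * suc q  ≡⟨ *-comm (suc slackness) (suc q) ⟩
      suc q * suc slackness  ∎
      where open ≤-Reasoning
    part : Partition R E (Y * Y) Y M
    part = subst (Partition R E (Y * Y) Y) M≡ (partition R E (Y * Y) Y 1≤Y (≤-trans (≤-trans (s≤s (z≤n {2 * Y})) n>₁) n≤N))
    module A = Assembly G simple Δ deg c proper (class-quarter G small c proper) R R-sym E Y M (Δ + 2) slackness (suc q) 1≤Y E≡ part
                 n≤N refl k≤Δ N≤ n< Y> Y≥ n>₁ n>₂ n>₃
    red-copy : A.RedPath → HasCopy red (Defs.path n) χ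
    red-copy (l , p , u , le) = f , (λ {i} {j} e → Fin.toℕ-injective (nth-inj l u (toℕ i) (toℕ j) _ _ e)) , edge
      where
      lt : ∀ (i : Fin n) → toℕ i < length l
      lt i = <-≤-trans (Fin.toℕ<n i) le
      f : Fin n → Fin N
      f i = nth l (toℕ i) (lt i)
      step : ∀ i j → suc (toℕ i) ≡ toℕ j → R (f i) (f j) ≡ true
      step i j e = go (toℕ j) (lt j) (sym e)
        where
        go : ∀ m lm → m ≡ suc (toℕ i) → R (f i) (nth l m lm) ≡ true
        go .(suc (toℕ i)) lm refl = nth-step R l (toℕ i) (lt i) lm p
      edge : ∀ i j → Defs.path n i j ≡ true → χ (f i) (f j) ≡ red
      edge i j e = isRed⇒red (dir (∨-case {suc (toℕ i) ≡ᵇ toℕ j} e))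
        where
        dir : _ ⊎ _ → R (f i) (f j) ≡ true
        dir (inj₁ a) = step i j (true-≡ᵇ a)
        dir (inj₂ b) = R-sym (f j) (f i) (step j i (true-≡ᵇ b))
    blue-copy : A.BlueCopy → HasCopy blue G χ
    blue-copy (f , inj , edge) = f , inj , λ i j e → dir i j (edge i j e)
      where
      dir : ∀ i j → R (f i) (f j) ≡ false ⊎ R (f j) (f i) ≡ false → χ (f i) (f j) ≡ blue
      dir i j (inj₁ a) = ¬isRed⇒blue a
      dir i j (inj₂ b) = trans (χ-sym (f i) (f j)) (¬isRed⇒blue b)
    conclude : A.RedPath ⊎ A.BlueCopy → HasCopy red (Defs.path n) χ ⊎ HasCopy blue G χ
    conclude (inj₁ r) = inj₁ (red-copy r)
    conclude (inj₂ b) = inj₂ (blue-copy b)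

  upper-bound : ∀ r k s → k ≤ Δ → IsRamseyNumber (Defs.path n) G r → IsSigma G (suc k) s → r ≤ k * n + s + slackness
  upper-bound r k s k≤Δ (_ , minimal) ((c₀ , proper , i₀ , cs) , _) = ≮⇒≥ (λ lt → minimal _ lt
      (subst (λ z → Arrows (k * n + z + slackness) (Defs.path n) G) size (arrows k c (λ i j e eq → proper i j e (transpose-inj zero i₀ eq)) k≤Δ)))
    where
    -- Renames the class of size `σ` to colour `zero`.
    c : Fin n → Fin (suc k)
    c v = Perm.transpose zero i₀ (c₀ v)
    agree : ∀ v → (c v == zero) ≡ (c₀ v == i₀)
    agree v with c₀ v Fin.≟ i₀
    ... | yes refl = cong (_== zero) (transpose-j zero (c₀ v))
    ... | no ne    = ≢⇒== (λ e → ne (transpose-inj zero i₀ (trans e (sym (transpose-j zero i₀)))))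
    size : # (λ v → c v == zero) ≡ s
    size = trans (#-cong agree) (trans (sym (classSize-# c₀ i₀)) cs)

-- The threshold and the theorem

ramsey-bound : ∀ {w} Δ q (G : Graph (suc w)) → 1 ≤ w → suc q * Δ ≤ suc w → IsSimple G → MaxDegreeAtMost G Δ →
  (∀ r k s → k ≤ Δ → IsRamseyNumber (Defs.path (suc w)) G r → IsSigma G (suc k) s → r ≤ k * suc w + s + suc w / suc q) →
  ∀ r χ s → IsRamseyNumber (Defs.path (suc w)) G r → IsChromaticNumber G χ → IsSigma G χ s →
  suc q * ∣ r - ((χ ∸ 1) * suc w + s) ∣ ≤ suc w
ramsey-bound Δ q G 1≤w large simple deg upper r zero s ram ((c , _) , _) sig with c zero
... | ()
ramsey-bound {w} Δ q G 1≤w large simple deg upper r (suc k) s ram chrom@(_ , minimal) sig =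
  ∣-∣-scaled (suc q) (upper r k s k≤Δ ram sig) lower
    (≤-trans (≤-reflexive (*-comm (suc q) (suc w / suc q))) (m/n*n≤m (suc w) (suc q))) large
  where
  k≤Δ : k ≤ Δ
  k≤Δ = s≤s⁻¹ (≮⇒≥ (λ lt → minimal (suc Δ) lt (greedily-colourable G Δ simple deg)))
  -- The red cliques have `n - 1` vertices each, so the lower bound falls short by `k ≤ Δ`, which is
  -- negligible once `suc q * Δ ≤ n`.
  lower : k * suc w + s ≤ r + Δ
  lower = begin
    k * suc w + s  ≡⟨ lem k w s ⟩
    k * w + s + k  ≤⟨ +-mono-≤ (lower-bound G r (suc k) s 1≤w (proj₁ ram) chrom sig) k≤Δ ⟩
    r + Δ  ∎
    where
    open ≤-Reasoning
    lem : ∀ k w s → k * suc w + s ≡ k * w + s + k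
    lem = solve-∀

-- `y₀` adds up the two lower bounds required of `Y`, and `E` is such that `suc E` computes to
-- `24 * Y`.
module Threshold (Δ q : ℕ) where
  y₀ Y E M : ℕ
  y₀ = suc q * (Δ + (2 * Δ + 2) * (Δ + 2)) + (4 * Δ + 2) * (Δ + 2)
  Y = suc y₀
  E = y₀ + 23 * Y
  M = Kbound Y (suc (Y * Y * (suc E * suc E))) 1

LargeBound : ℕ → ℕ → ℕ → Set
LargeBound Δ q n₀ = ∀ n → n₀ ≤ n → (G : Graph n) → IsSimple G → MaxDegreeAtMost G Δ → IndependenceAtMostQuarter G →
  ∀ r χ s → IsRamseyNumber (Defs.path n) G r → IsChromaticNumber G χ → IsSigma G χ s → suc q * ∣ r - ((χ ∸ 1) * n + s) ∣ ≤ n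

threshold : ∀ Δ q → ∃ (LargeBound Δ q)
threshold Δ q = choose E Y M (s≤s z≤n) refl (s≤s (m≤m+n _ _)) (s≤s (m≤n+m _ (suc q * (Δ + (2 * Δ + 2) * (Δ + 2))))) refl
  where
  open Threshold Δ q
  -- The constants become variables here, known only through their inequalities.
  choose : ∀ E Y M → 1 ≤ Y → suc E ≡ 24 * Y → suc q * (Δ + (2 * Δ + 2) * (Δ + 2)) < Y → suc ((4 * Δ + 2) * (Δ + 2)) ≤ Y →
    Kbound Y (suc (Y * Y * (suc E * suc E))) 1 ≡ M →
    ∃ (LargeBound Δ q)
  -- The leading `2` makes `n - 1` positive and the bounds on `n` strict.
  choose E Y M 1≤Y E≡ Y> Y≥ M≡ = 2 + (a + (b + (c + d))) , bound
    where
    a b c d : ℕ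
    a = 2 * Y
    b = suc q * (Δ * Y + M) + suc q * Y
    c = M * (suc E * (2 * M + 13))
    d = suc q * Δ
    bound : LargeBound Δ q (2 + (a + (b + (c + d))))
    bound (suc (suc w)) (s≤s (s≤s le)) G simple deg small =
      ramsey-bound Δ q G (s≤s z≤n) (m≤n⇒m≤1+n (m≤n⇒m≤1+n d≤)) simple deg
        (Bounds.upper-bound Δ q E Y M 1≤Y E≡ Y> Y≥ M≡ (suc (suc w)) (s≤s (m≤n⇒m≤1+n a≤)) (s≤s (m≤n⇒m≤1+n b≤)) (m≤n⇒m≤1+n (m≤n⇒m≤1+n c≤)) G simple deg small)
      where
      a≤ : a ≤ w
      a≤ = ≤-trans (m≤m+n a _) le
      bcd≤ : b + (c + d) ≤ w
      bcd≤ = ≤-trans (m≤n+m _ a) le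
      b≤ : b ≤ w
      b≤ = ≤-trans (m≤m+n b _) bcd≤
      cd≤ : c + d ≤ w
      cd≤ = ≤-trans (m≤n+m _ b) bcd≤
      c≤ : c ≤ w
      c≤ = ≤-trans (m≤m+n c d) cd≤
      d≤ : d ≤ w
      d≤ = ≤-trans (m≤n+m d c) cd≤

theorem1 : (Δ : ℕ) → 3 ≤ Δ →
    -- δ = p / (suc q) > 0
    (p q : ℕ) → 1 ≤ p →
    ∃ λ (n₀ : ℕ) → ∀ (n : ℕ) → n₀ ≤ n →
    (G : Graph n) → IsSimple G → MaxDegreeAtMost G Δ → IndependenceAtMostQuarter G →
    (r χ s : ℕ) → IsRamseyNumber (path n) G r → IsChromaticNumber G χ → IsSigma G χ s →
    suc q * ∣ r - ((χ ∸ 1) * n + s) ∣ ≤ p * n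
theorem1 Δ _ p q 1≤p with threshold Δ q
... | n₀ , h = n₀ , λ n le G simple deg small r χ s ram chrom sig →
  ≤-trans (h n le G simple deg small r χ s ram chrom sig) (≤-trans (≤-reflexive (sym (*-identityˡ n))) (*-monoˡ-≤ n 1≤p))
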